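{- The theory $T_1$ proves the pigeonhole principle: $T_1$ proves $\mathrm{php}(a,N)=1$, with free variables $a$ and $N$. (Here $a$ codes an $n\times(n+1)$ binary array with $n=|N|$, i.e. a multi-valued partial map from $\{1,\dots,n+1\}$ to $\{1,\dots,n\}$, and $\mathrm{php}(a,N)=1$ expresses that if every column contains at least one $1$, then not every row contains at most one $1$.)
   Context: **The theory $T_1$** (quantifier-free; objects are finite strings over $\{0,1\}$). *Terms and function symbols, each of rank $0$ or $1$:* variables are terms of rank $0$; $f(t_1,\dots,t_n)$ is a term whose rank is the maximum of the ranks of $f,t_1,\dots,t_n$. Function symbols of rank $0$: constants $\varepsilon,0,1$; unary $\mathrm{zero},\mathrm{one},\mathrm{lh},\mathrm{rh}$; binary $x\cdot y$ (also written $xy$), $y\triangleright x$, $x\triangleleft y$; and $\mathrm{cond}(x,y,z_0,z_1)$. If $t$ is a term with all variables among $x_1,\dots,x_n$, then $[\lambda x_1\dots x_n.t]$ is an $n$-ary symbol of the rank of $t$. If $h$ is $(n+1)$-ary, $\ell\mathrm{CRN}[h]$ and $r\mathrm{CRN}[h]$ are $(n+1)$-ary of the rank of $h$. If $g$ is $(n+2)$-ary, $h$ is $(n+4)$-ary of rank $0$ and $h_\ell,h_r$ are unary of rank $0$, then $\mathrm{TRN}[g,h,h_\ell,h_r]$ is $(n+2)$-ary of rank $1$. *Formulas* are Boolean combinations of equations between terms. *Axioms* ($i,j\in\{0,1\}$): a complete set of propositional axioms; equality axioms (reflexivity, symmetry, transitivity, congruence for all function symbols); $\varepsilon\ne0$,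 $0\neq1$, $1\ne\varepsilon$; $x\cdot\varepsilon=x$, $x\cdot(y i)=(x\cdot y)\cdot i$; $x\cdot y=\varepsilon\to x=\varepsilon\land y=\varepsilon$; $x\cdot y=i\to(x=\varepsilon\land y=i)\lor(x=i\land y=\varepsilon)$; $\varepsilon\triangleright x=x$, $(iy)\triangleright x=i\triangleright(y\triangleright x)$, $i\triangleright\varepsilon=\varepsilon$, $i\triangleright(jx)=x$, $y\triangleright x=\varepsilon\leftrightarrow x\triangleright(yi)\neq\varepsilon$; $x\triangleleft\varepsilon=x$, $x\triangleleft(yi)=(x\triangleleft y)\triangleleft i$, $\varepsilon\triangleleft i=\varepsilon$, $(xj)\triangleleft i=x$, $x\triangleleft y=\varepsilon\leftrightarrow(iy)\triangleleft x\ne\varepsilon$; $\mathrm{zero}(\varepsilon)=\varepsilon$, $\mathrm{zero}(xi)=\mathrm{zero}(x)\cdot0$; $\mathrm{one}(\varepsilon)=\varepsilon$, $\mathrm{one}(xi)=\mathrm{one}(x)\cdot1$; $\mathrm{cond}(\varepsilon,x,y,z)=x$, $\mathrm{cond}(w0,x,y,z)=\mathrm{zero}(z\triangleleft y)\cdot y$, $\mathrm{cond}(w1,x,y,z)=\mathrm{zero}(y\triangleleft z)\cdot z$; $\mathrm{lh}(x)\cdot\mathrm{rh}(x)=x$, $\mathrm{lh}(x)\triangleleft\mathrm{rh}(x)=\varepsilon$, $1\triangleright(\mathrm{lh}(x)\triangleright\mathrm{rh}(x))=\varepsilon$; writing $E(x;y,z)$ for $\mathrm{cond}(\mathrm{lh}(x)\triangleright\mathrm{rh}(x),y,z,z)$: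 $\mathrm{lh}(xi)=E(x;\mathrm{lh}(x),\mathrm{lh}(x)\cdot((\mathrm{rh}(x)\cdot i)\triangleleft\mathrm{rh}(x)))$, $\mathrm{rh}(xi)=E(x;\mathrm{rh}(x)\cdot i,1\triangleright(\mathrm{rh}(x)\cdot i))$, $\mathrm{lh}(ix)=E(x;(i\cdot\mathrm{lh}(x))\triangleleft1,i\cdot\mathrm{lh}(x))$, $\mathrm{rh}(ix)=E(x;(\mathrm{lh}(x)\triangleright(i\cdot\mathrm{lh}(x)))\cdot\mathrm{rh}(x),\mathrm{rh}(x))$; $[\lambda\vec x.t](\vec x)=t$; $\ell\mathrm{CRN}[h](\varepsilon,\vec y)=\varepsilon$, $\ell\mathrm{CRN}[h](ix,\vec y)=((h(ix,\vec y)\cdot0)\triangleleft h(ix,\vec y))\cdot\ell\mathrm{CRN}[h](x,\vec y)$; $r\mathrm{CRN}[h](\varepsilon,\vec y)=\varepsilon$, $r\mathrm{CRN}[h](xi,\vec y)=r\mathrm{CRN}[h](x,\vec y)\cdot(h(xi,\vec y)\triangleright(0\cdot h(xi,\vec y)))$; and for $f=\mathrm{TRN}[g,h,h_\ell,h_r]$: $f(x,z,\vec y)=\mathrm{cond}(x\triangleleft1,g(x,z,\vec y),t,t)$ with $t=h(x,z,\vec y,f(\mathrm{lh}(x),h_\ell(z),\vec y),f(\mathrm{rh}(x),h_r(z),\vec y))$. *Rules:* a complete set of propositional rules; substitution $A\vdash A[t/x]$; NIND: from $A[\varepsilon]$, $A[x]\to A[0x]$, $A[x]\to A[1x]$ infer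 $A$, and likewise with $x0,x1$ in place of $0x,1x$; TIND: from $A[\varepsilon,z]$, $A[0,z]$, $A[1,z]$, $A[\mathrm{lh}(x),h_\ell(z)]\land A[\mathrm{rh}(x),h_r(z)]\to A[x,z]$ infer $A$, for unary $h_\ell,h_r$ of rank $0$. **Defined functions.** $\mathrm{dl}(x)=1\triangleright x$, $\mathrm{dr}(x)=x\triangleleft1$ (delete leftmost/rightmost bit); $\mathrm{bl}(x)=x\triangleleft\mathrm{dl}(x)$, $\mathrm{br}(x)=\mathrm{dr}(x)\triangleright x$ (leftmost/rightmost bit); $\mathrm{c}_0(x,y,z)=\mathrm{cond}(x,y,z,z)$; $\mathrm{c}_B(x,y,z)=\mathrm{cond}(x,z,z,y)$; $\mathrm{sg}(x)=\mathrm{c}_B(x,1,0)$, $\lnot_Bx=\mathrm{c}_B(x,0,1)$, $x\land_By=\mathrm{c}_B(x,\mathrm{sg}(y),0)$, $x\lor_By=\mathrm{c}_B(x,1,\mathrm{sg}(y))$, $x\to_By=\mathrm{c}_B(x,\mathrm{sg}(y),1)$. $\mathrm{STRN}[g,h](x,\vec y)$ is the instance of TRN without the parameter $z$: it equals $\mathrm{c}_0(\mathrm{dr}(x),g(x,\vec y),h(x,\vec y,\mathrm{STRN}[g,h](\mathrm{lh}(x),\vec y),\mathrm{STRN}[g,h](\mathrm{rh}(x),\vec y)))$. $\mathrm{AND}=\mathrm{STRN}[\lambda x.x,\lambda xuv.u\land_Bv]$, $\mathrm{OR}=\mathrm{STRN}[\lambda x.x,\lambda xuv.u\lor_Bv]$,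 $\#=\mathrm{STRN}[\lambda xy.\mathrm{c}_0(x,\varepsilon,y),\lambda xyuv.u\cdot v]$ (so $|x\# y|=|x||y|$). $\mathrm{lp}(x,y)=\mathrm{zero}(y\triangleleft x)\cdot x$; $\mathrm{rc}(x,y)=(x\triangleleft y)\triangleright x$; $\max(x,y)=\mathrm{c}_0(x\triangleright y,x,y)$. $\mathrm{not}=\ell\mathrm{CRN}[\lambda x.\lnot_B\mathrm{bl}(x)]$; $\mathrm{and}_2(x,y)=\ell\mathrm{CRN}[\lambda zxy.\,\mathrm{bl}(\mathrm{rc}(x,z))\land_B\mathrm{bl}(\mathrm{rc}(y,z))](\mu,\mathrm{lp}(x,\mu),\mathrm{lp}(y,\mu))$ with $\mu=\max(x,y)$ (bitwise conjunction after left-padding to equal length). $\mathrm{first}_1=r\mathrm{CRN}[\lambda x.\mathrm{c}_B(\mathrm{OR}(\mathrm{dr}(x)),0,\mathrm{br}(x))]$ (keeps only the leftmost $1$); $\mathrm{delfirst}_1(x)=\mathrm{and}_2(x,\mathrm{not}(\mathrm{first}_1(x)))$. **Pigeonhole functions** (the functions defined recursively below are instances of $r\mathrm{CRN}$ on the indicated variable, with value $\varepsilon$ when that variable is $\varepsilon$): $\mathrm{adj}(a,N)=\bigl(a\triangleleft((N1\# N)\triangleright a)\bigr)\cdot\mathrm{zero}(a\triangleright(N1\# N))$ (so $a$ is cut or padded with $0$'s on the right to length $n(n+1)$ and read as an $n\times(n+1)$ array in row-major order); $\mathrm{entry}(a,N,k,l)=\mathrm{bl}\bigl(((N1\#\mathrm{dr}(l))\cdot\mathrm{dr}(k))\triangleright\mathrm{adj}(a,N)\bigr)$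 (column $|k|$, row $|l|$); for $l\neq\varepsilon$, $\mathrm{loc}(a,N,k,l)=\mathrm{loc}(a,N,k,\mathrm{dr}(l))\cdot\mathrm{entry}(a,N,k,l)$, and $\mathrm{col}(a,N,k)=\mathrm{loc}(a,N,k,N)$; for $k\ne\varepsilon$, $\mathrm{wor}(a,N,k,l)=\mathrm{wor}(a,N,\mathrm{dr}(k),l)\cdot\mathrm{entry}(a,N,k,l)$, and $\mathrm{row}(a,N,l)=\mathrm{wor}(a,N,N1,l)$; for $x\ne\varepsilon$, $\mathrm{pam}(a,N,x)=\mathrm{pam}(a,N,\mathrm{dr}(x))\cdot\mathrm{OR}(\mathrm{col}(a,N,x))$, and $\mathrm{map}(a,N)=\mathrm{AND}(\mathrm{pam}(a,N,N1))$; for $x\neq\varepsilon$, $\mathrm{jni}(a,N,x)=\mathrm{jni}(a,N,\mathrm{dr}(x))\cdot\lnot_B\mathrm{OR}(\mathrm{delfirst}_1(\mathrm{row}(a,N,x)))$, and $\mathrm{inj}(a,N)=\mathrm{AND}(\mathrm{jni}(a,N,N))$; finally $\mathrm{php}(a,N)=\mathrm{map}(a,N)\to_B\lnot_B\,\mathrm{inj}(a,N)$. -}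

module Defs where

open import Data.Bool.Base as Bool using (Bool; true; false)
open import Data.Fin.Base using (Fin; zero; suc)
open import Data.Nat.Base using (ℕ; zero; suc; _+_; _⊔_)
open import Data.Nat.Properties using (_≟_; ⊔-identityʳ)
open import Data.Product.Base using (_,_)
open import Data.Vec.Base using (Vec; []; _∷_; _++_; lookup; tabulate)
import Data.Vec.Recursive as Tuple
open import Function.Base using (_∘_)
open import Relation.Binary.PropositionalEquality
  using (_≡_; _≢_; refl; cong; trans)
open import Relation.Nullary.Decidable.Core using (does)

infixl 10 _⟨_⟩ _[_] _[_]* _[_≔_]
infix  6 _≐_ _≠_
infix  5 ¬_
infixr 4 _∧_
infixr 3 _∨_
infixr 2 _⇒_ _⇔_
infix  1 T₁⊢_

-- `Term V` is the type of terms with variables in V.  Formulas use V = ℕ; the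
-- body of [λx₁…xₙ.t] uses V = Fin n, which enforces that all variables of t
-- are among x₁,…,xₙ.  The parameter z of TRN is the second argument, and the
-- two recursive values are the last two arguments of h, whence the arity
-- 2 + (n + 2).

data Term (V : Set) : Set
data Fun : ℕ → Set
rankF : ∀ {n} → Fun n → ℕ
rank  : ∀ {V} → Term V → ℕ
ranks : ∀ {V n} → Vec (Term V) n → ℕ

data Term V where
  var : V → Term V
  app : ∀ {n} → Fun n → Vec (Term V) n → Term V

data Fun where
  εˢ 0ˢ 1ˢ       : Fun 0
  zeroˢ oneˢ     : Fun 1
  lh rh          : Fun 1
  ·ˢ ▷ˢ ◁ˢ       : Fun 2
  cond           : Fun 4
  lam            : ∀ {n} → Term (Fin n) → Fun n
  ℓCRN rCRN      : ∀ {n} → Fun (suc n) → Fun (suc n)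
  TRN            : ∀ {n} (g : Fun (2 + n)) (h : Fun (2 + (n + 2))) (hℓ hr : Fun 1) →
                   .(rankF h ≡ 0) → .(rankF hℓ ≡ 0) → .(rankF hr ≡ 0) → Fun (2 + n)

rankF εˢ                  = 0
rankF 0ˢ                  = 0
rankF 1ˢ                  = 0
rankF zeroˢ               = 0
rankF oneˢ                = 0
rankF lh                  = 0
rankF rh                  = 0
rankF ·ˢ                  = 0
rankF ▷ˢ                  = 0
rankF ◁ˢ                  = 0
rankF cond                = 0
rankF (lam t)             = rank t
rankF (ℓCRN h)            = rankF h
rankF (rCRN h)            = rankF h
rankF (TRN _ _ _ _ _ _ _) = 1

rank (var _)    = 0
rank (app f ts) = rankF f ⊔ ranks ts

ranks []       = 0
ranks (t ∷ ts) = rank t ⊔ ranks ts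

-- f ⟨ t₁ , … , tₙ ⟩ for n ≥ 1.
_⟨_⟩ : ∀ {V n} → Fun n → Term V Tuple.^ n → Term V
_⟨_⟩ {n = n} f ts = app f (Tuple.toVec n ts)

-- ƛ n λ (x₁ , … , xₙ) → t  is the symbol [λx₁…xₙ.t].
ƛ : ∀ n → (Term (Fin n) Tuple.^ n → Term (Fin n)) → Fun n
ƛ n t = lam (t (Tuple.tabulate n var))

module _ {V : Set} where

  infixl 9 _·_ _▷_ _◁_

  ε 𝟎 𝟏 : Term V
  ε = app εˢ []
  𝟎 = app 0ˢ []
  𝟏 = app 1ˢ []

  bit : Bool → Term V
  bit false = 𝟎
  bit true  = 𝟏

  -- y ▷ x deletes |y| bits from the left of x, and x ◁ y deletes |y| bits from
  -- the right of x.
  _·_ _▷_ _◁_ : Term V → Term V → Term V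
  x · y = ·ˢ ⟨ x , y ⟩
  y ▷ x = ▷ˢ ⟨ y , x ⟩
  x ◁ y = ◁ˢ ⟨ x , y ⟩

  E : Term V → Term V → Term V → Term V
  E x y z = cond ⟨ lh ⟨ x ⟩ ▷ rh ⟨ x ⟩ , y , z , z ⟩

-- Simultaneous substitution.
_[_]  : ∀ {V W} → Term V → (V → Term W) → Term W
_[_]* : ∀ {V W n} → Vec (Term V) n → (V → Term W) → Vec (Term W) n

var x    [ σ ] = σ x
app f ts [ σ ] = app f (ts [ σ ]*)

[]       [ σ ]* = []
(t ∷ ts) [ σ ]* = t [ σ ] ∷ ts [ σ ]*

data Formula : Set where
  _≐_         : (t u : Term ℕ) → Formula
  ¬_          : Formula → Formula
  _∧_ _∨_ _⇒_ : (A B : Formula) → Formula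

_⇔_ : Formula → Formula → Formula
A ⇔ B = (A ⇒ B) ∧ (B ⇒ A)

_≠_ : Term ℕ → Term ℕ → Formula
t ≠ u = ¬ (t ≐ u)

substF : (ℕ → Term ℕ) → Formula → Formula
substF σ (t ≐ u) = t [ σ ] ≐ u [ σ ]
substF σ (¬ A)   = ¬ substF σ A
substF σ (A ∧ B) = substF σ A ∧ substF σ B
substF σ (A ∨ B) = substF σ A ∨ substF σ B
substF σ (A ⇒ B) = substF σ A ⇒ substF σ B

single : ℕ → Term ℕ → ℕ → Term ℕ
single x t y = Bool.if does (x ≟ y) then t else var y

_[_≔_] : Formula → ℕ → Term ℕ → Formula
A [ x ≔ t ] = substF (single x t) A

eval : (Term ℕ → Term ℕ → Bool) → Formula → Bool
eval v (t ≐ u) = v t u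
eval v (¬ A)   = Bool.not (eval v A)
eval v (A ∧ B) = eval v A Bool.∧ eval v B
eval v (A ∨ B) = eval v A Bool.∨ eval v B
eval v (A ⇒ B) = Bool.not (eval v A) Bool.∨ eval v B

-- Propositional tautology: equations are treated as independent atoms.
Tautology : Formula → Set
Tautology A = ∀ v → eval v A ≡ true

-- t₁ ≐ u₁ ⇒ … ⇒ tₙ ≐ uₙ ⇒ A
equations⇒ : ∀ {n} → Vec (Term ℕ) n → Vec (Term ℕ) n → Formula → Formula
equations⇒ []       []       A = A
equations⇒ (t ∷ ts) (u ∷ us) A = t ≐ u ⇒ equations⇒ ts us A

private variable
  n       : ℕ
  i j     : Bool
  w x y z : Term ℕ
  ys      : Vec (Term ℕ) n

-- The variables of an axiom are represented by arbitrary terms; the theory has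
-- the substitution rule, so this does not change the set of theorems.
data Axiom : Formula → Set where
  ≐-refl  : Axiom (x ≐ x)
  ≐-sym   : Axiom (x ≐ y ⇒ y ≐ x)
  ≐-trans : Axiom (x ≐ y ∧ y ≐ z ⇒ x ≐ z)
  ≐-cong  : (f : Fun n) (ts us : Vec (Term ℕ) n) →
            Axiom (equations⇒ ts us (app f ts ≐ app f us))

  ε≠0 : Axiom (ε ≠ 𝟎)
  0≠1 : Axiom (𝟎 ≠ 𝟏)
  1≠ε : Axiom (𝟏 ≠ ε)

  ·-ε    : Axiom (x · ε ≐ x)
  ·-bit  : Axiom (x · (y · bit i) ≐ (x · y) · bit i)
  ·-≐ε   : Axiom (x · y ≐ ε ⇒ x ≐ ε ∧ y ≐ ε)
  ·-≐bit : Axiom (x · y ≐ bit i ⇒ (x ≐ ε ∧ y ≐ bit i) ∨ (x ≐ bit i ∧ y ≐ ε))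

  ε▷      : Axiom (ε ▷ x ≐ x)
  bit·▷   : Axiom ((bit i · y) ▷ x ≐ bit i ▷ (y ▷ x))
  bit▷ε   : Axiom (bit i ▷ ε ≐ ε)
  bit▷bit : Axiom (bit i ▷ (bit j · x) ≐ x)
  ▷-≐ε    : Axiom (y ▷ x ≐ ε ⇔ x ▷ (y · bit i) ≠ ε)

  ◁ε      : Axiom (x ◁ ε ≐ x)
  ◁·bit   : Axiom (x ◁ (y · bit i) ≐ (x ◁ y) ◁ bit i)
  ε◁bit   : Axiom (ε ◁ bit i ≐ ε)
  bit◁bit : Axiom ((x · bit j) ◁ bit i ≐ x)
  ◁-≐ε    : Axiom (x ◁ y ≐ ε ⇔ (bit i · y) ◁ x ≠ ε)

  zero-ε   : Axiom (zeroˢ ⟨ ε ⟩ ≐ ε)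
  zero-bit : Axiom (zeroˢ ⟨ x · bit i ⟩ ≐ zeroˢ ⟨ x ⟩ · 𝟎)
  one-ε    : Axiom (oneˢ ⟨ ε ⟩ ≐ ε)
  one-bit  : Axiom (oneˢ ⟨ x · bit i ⟩ ≐ oneˢ ⟨ x ⟩ · 𝟏)

  cond-ε : Axiom (cond ⟨ ε , x , y , z ⟩ ≐ x)
  cond-0 : Axiom (cond ⟨ w · 𝟎 , x , y , z ⟩ ≐ zeroˢ ⟨ z ◁ y ⟩ · y)
  cond-1 : Axiom (cond ⟨ w · 𝟏 , x , y , z ⟩ ≐ zeroˢ ⟨ y ◁ z ⟩ · z)

  lh·rh  : Axiom (lh ⟨ x ⟩ · rh ⟨ x ⟩ ≐ x)
  lh◁rh  : Axiom (lh ⟨ x ⟩ ◁ rh ⟨ x ⟩ ≐ ε)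
  lh▷rh  : Axiom (𝟏 ▷ (lh ⟨ x ⟩ ▷ rh ⟨ x ⟩) ≐ ε)
  lh-bitʳ : Axiom (lh ⟨ x · bit i ⟩ ≐
                   E x (lh ⟨ x ⟩) (lh ⟨ x ⟩ · ((rh ⟨ x ⟩ · bit i) ◁ rh ⟨ x ⟩)))
  rh-bitʳ : Axiom (rh ⟨ x · bit i ⟩ ≐
                   E x (rh ⟨ x ⟩ · bit i) (𝟏 ▷ (rh ⟨ x ⟩ · bit i)))
  lh-bitˡ : Axiom (lh ⟨ bit i · x ⟩ ≐
                   E x ((bit i · lh ⟨ x ⟩) ◁ 𝟏) (bit i · lh ⟨ x ⟩))
  rh-bitˡ : Axiom (rh ⟨ bit i · x ⟩ ≐
                   E x ((lh ⟨ x ⟩ ▷ (bit i · lh ⟨ x ⟩)) · rh ⟨ x ⟩) (rh ⟨ x ⟩))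

  lam-β : (t : Term (Fin n)) (ts : Vec (Term ℕ) n) →
          Axiom (app (lam t) ts ≐ t [ lookup ts ])

  ℓCRN-ε   : (h : Fun (suc n)) → Axiom (app (ℓCRN h) (ε ∷ ys) ≐ ε)
  ℓCRN-bit : (h : Fun (suc n)) →
             let hx = app h (bit i · x ∷ ys) in
             Axiom (app (ℓCRN h) (bit i · x ∷ ys) ≐
                    ((hx · 𝟎) ◁ hx) · app (ℓCRN h) (x ∷ ys))
  rCRN-ε   : (h : Fun (suc n)) → Axiom (app (rCRN h) (ε ∷ ys) ≐ ε)
  rCRN-bit : (h : Fun (suc n)) →
             let hx = app h (x · bit i ∷ ys) in
             Axiom (app (rCRN h) (x · bit i ∷ ys) ≐
                    app (rCRN h) (x ∷ ys) · (hx ▷ (𝟎 · hx)))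

  TRN-def : (g : Fun (2 + n)) (h : Fun (2 + (n + 2))) (hℓ hr : Fun 1)
            .(p : rankF h ≡ 0) .(pℓ : rankF hℓ ≡ 0) .(pr : rankF hr ≡ 0) →
            let f = TRN g h hℓ hr p pℓ pr
                t = app h (x ∷ z ∷ ys ++
                           app f (lh ⟨ x ⟩ ∷ hℓ ⟨ z ⟩ ∷ ys) ∷
                           app f (rh ⟨ x ⟩ ∷ hr ⟨ z ⟩ ∷ ys) ∷ [])
            in Axiom (app f (x ∷ z ∷ ys) ≐
                      cond ⟨ x ◁ 𝟏 , app g (x ∷ z ∷ ys) , t , t ⟩)

data T₁⊢_ : Formula → Set where
  axiom : ∀ {A} → Axiom A → T₁⊢ A
  taut  : ∀ {A} → Tautology A → T₁⊢ A
  mp    : ∀ {A B} → T₁⊢ A ⇒ B → T₁⊢ A → T₁⊢ B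
  sub   : ∀ {A} (x : ℕ) (t : Term ℕ) → T₁⊢ A → T₁⊢ A [ x ≔ t ]
  NINDˡ : ∀ A (x : ℕ) →
          T₁⊢ A [ x ≔ ε ] →
          T₁⊢ A ⇒ A [ x ≔ 𝟎 · var x ] →
          T₁⊢ A ⇒ A [ x ≔ 𝟏 · var x ] →
          T₁⊢ A
  NINDʳ : ∀ A (x : ℕ) →
          T₁⊢ A [ x ≔ ε ] →
          T₁⊢ A ⇒ A [ x ≔ var x · 𝟎 ] →
          T₁⊢ A ⇒ A [ x ≔ var x · 𝟏 ] →
          T₁⊢ A
  -- As x ≢ z, the successive substitutions below agree with the simultaneous
  -- ones A[lh(x),hℓ(z)] and A[rh(x),hr(z)].
  TIND  : ∀ A (x z : ℕ) → x ≢ z →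
          (hℓ hr : Fun 1) → rankF hℓ ≡ 0 → rankF hr ≡ 0 →
          T₁⊢ A [ x ≔ ε ] →
          T₁⊢ A [ x ≔ 𝟎 ] →
          T₁⊢ A [ x ≔ 𝟏 ] →
          T₁⊢ A [ x ≔ lh ⟨ var x ⟩ ] [ z ≔ hℓ ⟨ var z ⟩ ] ∧
              A [ x ≔ rh ⟨ var x ⟩ ] [ z ≔ hr ⟨ var z ⟩ ] ⇒ A →
          T₁⊢ A

dl dr bl br : Fun 1
dl = ƛ 1 λ x → 𝟏 ▷ x
dr = ƛ 1 λ x → x ◁ 𝟏
bl = ƛ 1 λ x → x ◁ dl ⟨ x ⟩
br = ƛ 1 λ x → dr ⟨ x ⟩ ▷ x

c₀ cB : Fun 3
c₀ = ƛ 3 λ (x , y , z) → cond ⟨ x , y , z , z ⟩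
cB = ƛ 3 λ (x , y , z) → cond ⟨ x , z , z , y ⟩

sg notB : Fun 1
sg   = ƛ 1 λ x → cB ⟨ x , 𝟏 , 𝟎 ⟩
notB = ƛ 1 λ x → cB ⟨ x , 𝟎 , 𝟏 ⟩

andB orB impB : Fun 2
andB = ƛ 2 λ (x , y) → cB ⟨ x , sg ⟨ y ⟩ , 𝟎 ⟩
orB  = ƛ 2 λ (x , y) → cB ⟨ x , 𝟏 , sg ⟨ y ⟩ ⟩
impB = ƛ 2 λ (x , y) → cB ⟨ x , sg ⟨ y ⟩ , 𝟏 ⟩

ranks-vars : ∀ {V n} (ρ : Fin n → V) → ranks (tabulate (var ∘ ρ)) ≡ 0
ranks-vars {n = zero}  ρ = refl
ranks-vars {n = suc n} ρ = ranks-vars (ρ ∘ suc)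

-- The parameter z is a dummy: g and h ignore it, it is started at ε and passed
-- on unchanged.
STRN : (g : Fun (suc n)) (h : Fun (suc (n + 2))) → .(rankF h ≡ 0) → Fun (suc n)
STRN g h p =
  lam (app (TRN (skip g) (skip h) idˢ idˢ (rank-skip h p) refl refl)
           (var zero ∷ ε ∷ tabulate (var ∘ suc)))
  where
  skip : ∀ {m} → Fun (suc m) → Fun (2 + m)
  skip f = lam (app f (var zero ∷ tabulate (λ k → var (suc (suc k)))))

  idˢ : Fun 1
  idˢ = ƛ 1 λ z → z

  rank-skip : ∀ {m} (f : Fun (suc m)) → rankF f ≡ 0 → rankF (skip f) ≡ 0
  rank-skip {m} f q =
    trans (cong (rankF f ⊔_) (ranks-vars {V = Fin (2 + m)} {n = m} (λ k → suc (suc k))))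
          (trans (⊔-identityʳ (rankF f)) q)

AND OR : Fun 1
AND = STRN (ƛ 1 λ x → x) (ƛ 3 λ (x , u , v) → andB ⟨ u , v ⟩) refl
OR  = STRN (ƛ 1 λ x → x) (ƛ 3 λ (x , u , v) → orB  ⟨ u , v ⟩) refl

-- |x # y| = |x||y|
# : Fun 2
# = STRN (ƛ 2 λ (x , y) → c₀ ⟨ x , ε , y ⟩) (ƛ 4 λ (x , y , u , v) → u · v) refl

lp rc max : Fun 2
lp  = ƛ 2 λ (x , y) → zeroˢ ⟨ y ◁ x ⟩ · x
rc  = ƛ 2 λ (x , y) → (x ◁ y) ▷ x
max = ƛ 2 λ (x , y) → c₀ ⟨ x ▷ y , x , y ⟩

not : Fun 1
not = ℓCRN (ƛ 1 λ x → notB ⟨ bl ⟨ x ⟩ ⟩)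

and₂ : Fun 2
and₂ = ƛ 2 λ (x , y) →
  let μ = max ⟨ x , y ⟩ in
  ℓCRN (ƛ 3 λ (z , x , y) → andB ⟨ bl ⟨ rc ⟨ x , z ⟩ ⟩ , bl ⟨ rc ⟨ y , z ⟩ ⟩ ⟩)
    ⟨ μ , lp ⟨ x , μ ⟩ , lp ⟨ y , μ ⟩ ⟩

first₁ delfirst₁ : Fun 1
first₁    = rCRN (ƛ 1 λ x → cB ⟨ OR ⟨ dr ⟨ x ⟩ ⟩ , 𝟎 , br ⟨ x ⟩ ⟩)
delfirst₁ = ƛ 1 λ x → and₂ ⟨ x , not ⟨ first₁ ⟨ x ⟩ ⟩ ⟩

adj : Fun 2
adj = ƛ 2 λ (a , N) →
  let s = # ⟨ N · 𝟏 , N ⟩ in (a ◁ (s ▷ a)) · zeroˢ ⟨ a ▷ s ⟩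

entry : Fun 4
entry = ƛ 4 λ (a , N , k , l) →
  bl ⟨ (# ⟨ N · 𝟏 , dr ⟨ l ⟩ ⟩ · dr ⟨ k ⟩) ▷ adj ⟨ a , N ⟩ ⟩

-- rCRN recurses on the first argument, so the recursion variable of each of
-- loc, wor, pam and jni is moved there.

loc wor : Fun 4
loc = ƛ 4 λ (a , N , k , l) →
  rCRN (ƛ 4 λ (l , a , N , k) → entry ⟨ a , N , k , l ⟩) ⟨ l , a , N , k ⟩
wor = ƛ 4 λ (a , N , k , l) →
  rCRN (ƛ 4 λ (k , a , N , l) → entry ⟨ a , N , k , l ⟩) ⟨ k , a , N , l ⟩

col row : Fun 3
col = ƛ 3 λ (a , N , k) → loc ⟨ a , N , k , N ⟩
row = ƛ 3 λ (a , N , l) → wor ⟨ a , N , N · 𝟏 , l ⟩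

pam jni : Fun 3
pam = ƛ 3 λ (a , N , x) →
  rCRN (ƛ 3 λ (x , a , N) → OR ⟨ col ⟨ a , N , x ⟩ ⟩) ⟨ x , a , N ⟩
jni = ƛ 3 λ (a , N , x) →
  rCRN (ƛ 3 λ (x , a , N) → notB ⟨ OR ⟨ delfirst₁ ⟨ row ⟨ a , N , x ⟩ ⟩ ⟩ ⟩) ⟨ x , a , N ⟩

map inj php : Fun 2
map = ƛ 2 λ (a , N) → AND ⟨ pam ⟨ a , N , N · 𝟏 ⟩ ⟩
inj = ƛ 2 λ (a , N) → AND ⟨ jni ⟨ a , N , N ⟩ ⟩
php = ƛ 2 λ (a , N) → impB ⟨ map ⟨ a , N ⟩ , notB ⟨ inj ⟨ a , N ⟩ ⟩ ⟩

{-# OPTIONS --safe #-}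

-- In T₁ the ones of a string can be counted: TRN adds up the bits as a balanced tree of
-- carry-save additions, and a full adder puts the result into binary form, modulo a power
-- of 2 that exceeds every count below.  By associativity of that sum the count is also
-- computed bit by bit.
--
-- Let l run through the rows.  Row l covers for the first time the columns in which it has a
-- one and no earlier row has; there is at most one such column, by injectivity.  Hence the
-- number of columns covered by the rows up to l plus the number of those rows that cover
-- nothing new equals the number of rows up to l.  If all n + 1 columns are covered in the end,
-- then n + 1 + m = n for the number m of idle rows, so 1 + m = 0, which is impossible since m
-- is the count of a string of length n and so its last digits are 0.
module Submission where

open import Defs
open import Data.Bool.Base as Bool using (Bool; true; false; if_then_else_)
open import Data.Nat.Base using (ℕ; zero; suc; _+_; _⊔_; _≤_; _<_; z≤n; s≤s)
open import Data.Nat.Properties as ℕ using (_≟_)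
open import Data.Product.Base using (_×_; _,_; proj₁; proj₂)
open import Data.Sum.Base using (inj₁; inj₂)
open import Data.Vec.Base using (Vec; []; _∷_; lookup)
open import Relation.Binary.PropositionalEquality
  using (_≡_; _≢_; refl; sym; trans; cong; cong₂; subst; subst₂)
open import Relation.Nullary.Decidable using (dec-true; dec-false)

-- Substitution

-- The recursion schemes shape the construction. Carry-save addition works position by position, so
-- the tree passes pairs of numbers upwards and a single proper addition takes place at the root.
-- Similarly `rCRN` does not see the bits it has already produced; a carry is therefore not
-- propagated but read off from the prefixes of the summands.
--
-- The tree splits a string by `lh` and `rh`, and appending one bit moves the boundary between the
-- halves on many levels. Hence the laws of addition have to be available before counts can be
-- compared bit by bit. They are proved digit by digit, with statements about the carries as part of
-- the induction formula.
--
-- Numbers have n + 2 digits, a length that is given by a term. Since the count of a string of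
-- length n vanishes from digit n on, adding 1 to it cannot wrap around; everything else is modular
-- arithmetic and uses no order relation.

bound  : Term ℕ → ℕ
bounds : ∀ {n} → Vec (Term ℕ) n → ℕ

bound (var x)    = suc x
bound (app f ts) = bounds ts

bounds []       = 0
bounds (t ∷ ts) = bound t ⊔ bounds ts

boundF : Formula → ℕ
boundF (t ≐ u) = bound t ⊔ bound u
boundF (¬ A)   = boundF A
boundF (A ∧ B) = boundF A ⊔ boundF B
boundF (A ∨ B) = boundF A ⊔ boundF B
boundF (A ⇒ B) = boundF A ⊔ boundF B

Agree : ℕ → (σ τ : ℕ → Term ℕ) → Set
Agree b σ τ = ∀ x → x < b → σ x ≡ τ x

agreeˡ : ∀ {a b σ τ} → Agree (a ⊔ b) σ τ → Agree a σ τ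
agreeˡ {a} {b} e x x<a = e x (ℕ.<-≤-trans x<a (ℕ.m≤m⊔n a b))

agreeʳ : ∀ {a b σ τ} → Agree (a ⊔ b) σ τ → Agree b σ τ
agreeʳ {a} {b} e x x<b = e x (ℕ.<-≤-trans x<b (ℕ.m≤n⊔m a b))

[]-ext  : ∀ {σ τ} t → Agree (bound t) σ τ → t [ σ ] ≡ t [ τ ]
[]*-ext : ∀ {σ τ : ℕ → Term ℕ} {n} (ts : Vec _ n) → Agree (bounds ts) σ τ → ts [ σ ]* ≡ ts [ τ ]*

[]-ext (var x)    e = e x (ℕ.n<1+n x)
[]-ext (app f ts) e = cong (app f) ([]*-ext ts e)

[]*-ext []       e = refl
[]*-ext {σ} {τ} (t ∷ ts) e =
  cong₂ _∷_ ([]-ext t (agreeˡ {bound t} {bounds ts} {σ} {τ} e))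
            ([]*-ext ts (agreeʳ {bound t} {bounds ts} {σ} {τ} e))

substF-ext : ∀ {σ τ} A → Agree (boundF A) σ τ → substF σ A ≡ substF τ A
substF-ext {σ} {τ} (t ≐ u) e =
  cong₂ _≐_ ([]-ext t (agreeˡ {bound t} {bound u} {σ} {τ} e))
            ([]-ext u (agreeʳ {bound t} {bound u} {σ} {τ} e))
substF-ext (¬ A) e = cong ¬_ (substF-ext A e)
substF-ext {σ} {τ} (A ∧ B) e =
  cong₂ _∧_ (substF-ext A (agreeˡ {boundF A} {boundF B} {σ} {τ} e))
            (substF-ext B (agreeʳ {boundF A} {boundF B} {σ} {τ} e))
substF-ext {σ} {τ} (A ∨ B) e =
  cong₂ _∨_ (substF-ext A (agreeˡ {boundF A} {boundF B} {σ} {τ} e))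
            (substF-ext B (agreeʳ {boundF A} {boundF B} {σ} {τ} e))
substF-ext {σ} {τ} (A ⇒ B) e =
  cong₂ _⇒_ (substF-ext A (agreeˡ {boundF A} {boundF B} {σ} {τ} e))
            (substF-ext B (agreeʳ {boundF A} {boundF B} {σ} {τ} e))

infixl 9 _⨾_

_⨾_ : (σ τ : ℕ → Term ℕ) → ℕ → Term ℕ
(σ ⨾ τ) x = σ x [ τ ]

[]-comp  : ∀ {σ τ : ℕ → Term ℕ} t → t [ σ ] [ τ ] ≡ t [ σ ⨾ τ ]
[]*-comp : ∀ {σ τ : ℕ → Term ℕ} {n} (ts : Vec _ n) → ts [ σ ]* [ τ ]* ≡ ts [ σ ⨾ τ ]*

[]-comp (var x)    = refl
[]-comp (app f ts) = cong (app f) ([]*-comp ts)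

[]*-comp []       = refl
[]*-comp (t ∷ ts) = cong₂ _∷_ ([]-comp t) ([]*-comp ts)

substF-comp : ∀ {σ τ} A → substF τ (substF σ A) ≡ substF (σ ⨾ τ) A
substF-comp (t ≐ u) = cong₂ _≐_ ([]-comp t) ([]-comp u)
substF-comp (¬ A)   = cong ¬_ (substF-comp A)
substF-comp (A ∧ B) = cong₂ _∧_ (substF-comp A) (substF-comp B)
substF-comp (A ∨ B) = cong₂ _∨_ (substF-comp A) (substF-comp B)
substF-comp (A ⇒ B) = cong₂ _⇒_ (substF-comp A) (substF-comp B)

[]-id  : ∀ (t : Term ℕ) → t [ var ] ≡ t
[]*-id : ∀ {n} (ts : Vec (Term ℕ) n) → ts [ var ]* ≡ ts

[]-id (var x)    = refl
[]-id (app f ts) = cong (app f) ([]*-id ts)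

[]*-id []       = refl
[]*-id (t ∷ ts) = cong₂ _∷_ ([]-id t) ([]*-id ts)

substF-id : ∀ A → substF var A ≡ A
substF-id (t ≐ u) = cong₂ _≐_ ([]-id t) ([]-id u)
substF-id (¬ A)   = cong ¬_ (substF-id A)
substF-id (A ∧ B) = cong₂ _∧_ (substF-id A) (substF-id B)
substF-id (A ∨ B) = cong₂ _∨_ (substF-id A) (substF-id B)
substF-id (A ⇒ B) = cong₂ _⇒_ (substF-id A) (substF-id B)

single-hit : ∀ x t → single x t x ≡ t
single-hit x t = cong (λ b → if b then t else var x) (dec-true (x ≟ x) refl)

single-miss : ∀ x {y} t → x ≢ y → single x t y ≡ var y
single-miss x {y} t x≢y = cong (λ b → if b then t else var y) (dec-false (x ≟ y) x≢y)

single-agree : ∀ {x b} t → b ≤ x → Agree b (single x t) var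
single-agree {x} t b≤x y y<b = single-miss x t (λ { refl → ℕ.<-irrefl refl (ℕ.<-≤-trans y<b b≤x) })

[]-fresh : ∀ {x} t u → bound t ≤ x → t [ single x u ] ≡ t
[]-fresh t u b≤x = trans ([]-ext t (single-agree u b≤x)) ([]-id t)

-- The single substitutions first move the variables of A out of the way, to
-- m, m + 1, …, and then replace each by its value.
module _ {A : Formula} (σ : ℕ → Term ℕ) where
  private
    sup : ℕ → ℕ
    sup zero    = 0
    sup (suc j) = sup j ⊔ bound (σ j)

    sup-bound : ∀ {x} j → x < j → bound (σ x) ≤ sup j
    sup-bound {x} (suc j) x<1+j with ℕ.m≤n⇒m<n∨m≡n (ℕ.≤-pred x<1+j)
    ... | inj₁ x<j  = ℕ.≤-trans (sup-bound j x<j) (ℕ.m≤m⊔n (sup j) _)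
    ... | inj₂ refl = ℕ.m≤n⊔m (sup j) _

    k m : ℕ
    k = boundF A
    -- Above every variable of `A` and of the values `σ j` with `j < k`, so the names `m + j` clash
    -- neither with variables still to be moved nor with values already put in.
    m = k ⊔ sup k

    away : ℕ → ℕ → Term ℕ
    away zero    = var
    away (suc j) = away j ⨾ single j (var (m + j))

    away≥ : ∀ j {x} → j ≤ x → away j x ≡ var x
    away≥ zero    _ = refl
    away≥ (suc j) {x} j<x rewrite away≥ j (ℕ.<⇒≤ j<x) = single-miss j _ (ℕ.<⇒≢ j<x)

    away< : ∀ j {x} → j ≤ k → x < j → away j x ≡ var (m + x)
    away< (suc j) {x} j<k x<1+j with ℕ.m≤n⇒m<n∨m≡n (ℕ.≤-pred x<1+j)
    ... | inj₁ x<j rewrite away< j (ℕ.<⇒≤ j<k) x<j =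
          single-miss j _ (ℕ.<⇒≢ (ℕ.<-≤-trans j<k (ℕ.≤-trans (ℕ.m≤m⊔n k (sup k)) (ℕ.m≤m+n m x))))
    ... | inj₂ refl rewrite away≥ j {x} ℕ.≤-refl = single-hit j _

    back : ℕ → ℕ → Term ℕ
    back zero    = away k
    back (suc j) = back j ⨾ single (m + j) (σ j)

    back≥ : ∀ j {x} → j ≤ x → x < k → back j x ≡ var (m + x)
    back≥ zero    _   x<k = away< k ℕ.≤-refl x<k
    back≥ (suc j) {x} j<x x<k rewrite back≥ j (ℕ.<⇒≤ j<x) x<k =
      single-miss (m + j) _ (λ e → ℕ.<⇒≢ j<x (ℕ.+-cancelˡ-≡ m j x e))

    back< : ∀ j {x} → j ≤ k → x < j → back j x ≡ σ x
    back< (suc j) {x} j<k x<1+j with ℕ.m≤n⇒m<n∨m≡n (ℕ.≤-pred x<1+j)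
    ... | inj₁ x<j rewrite back< j (ℕ.<⇒≤ j<k) x<j =
          []-fresh (σ x) _ (ℕ.≤-trans (sup-bound k (ℕ.<-trans x<j j<k))
                             (ℕ.≤-trans (ℕ.m≤n⊔m k (sup k)) (ℕ.m≤m+n m j)))
    ... | inj₂ refl rewrite back≥ j {x} ℕ.≤-refl j<k = single-hit (m + j) _

    ⊢away : T₁⊢ A → ∀ j → T₁⊢ substF (away j) A
    ⊢away d zero    = subst T₁⊢_ (sym (substF-id A)) d
    ⊢away d (suc j) = subst T₁⊢_ (substF-comp A) (sub j _ (⊢away d j))

    ⊢back : T₁⊢ A → ∀ j → T₁⊢ substF (back j) A
    ⊢back d zero    = ⊢away d k
    ⊢back d (suc j) = subst T₁⊢_ (substF-comp A) (sub (m + j) _ (⊢back d j))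

  ⊢-subst : T₁⊢ A → T₁⊢ substF σ A
  ⊢-subst d = subst T₁⊢_ (substF-ext A (λ x x<k → back< k ℕ.≤-refl x<k)) (⊢back d k)

-- Propositional and equational reasoning under a hypothesis

infix 1 _⊢_

-- The rules of the calculus derive plain theorems; open hypotheses are kept as the premise of an
-- implication and accumulate by `∧`.
_⊢_ : Formula → Formula → Set
Γ ⊢ A = T₁⊢ Γ ⇒ A

Prop : ℕ → Set
Prop zero    = Bool
Prop (suc n) = Bool → Prop n

Valid : ∀ n → Prop n → Set
Valid zero    φ = φ ≡ true
Valid (suc n) φ = ∀ b → Valid n (φ b)

valid? : ∀ n → Prop n → Bool
valid? zero    φ = φ
valid? (suc n) φ = valid? n (φ false) Bool.∧ valid? n (φ true)

∧-true : ∀ {a b} → a Bool.∧ b ≡ true → a ≡ true × b ≡ true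
∧-true {true} {true} refl = refl , refl

-- Evaluating the full truth table makes `refl` a proof of any tautology in `n` Booleans. In the
-- rules below these Booleans are the values of whole formulas under a valuation.
valid : ∀ n {φ : Prop n} → valid? n φ ≡ true → Valid n φ
valid zero    e       = e
valid (suc n) e false = valid n (proj₁ (∧-true e))
valid (suc n) e true  = valid n (proj₂ (∧-true e))

infixr 2 _⊃_

_⊃_ : Bool → Bool → Bool
a ⊃ b = Bool.not a Bool.∨ b

variable
  Γ A B C : Formula
  x y z w t u v x′ y′ z′ w′ : Term ℕ
  i j k : Bool

lift : T₁⊢ A → Γ ⊢ A
lift {A} {Γ} = mp (taut λ V → valid 2 {λ a g → a ⊃ g ⊃ a} refl (eval V A) (eval V Γ))

hyp₀ : A ⊢ A
hyp₀ {A} = taut λ V → valid 1 {λ a → a ⊃ a} refl (eval V A)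

ax : Axiom A → Γ ⊢ A
ax a = lift (axiom a)

infixl 6 _$_

_$_ : Γ ⊢ A ⇒ B → Γ ⊢ A → Γ ⊢ B
_$_ {Γ} {A} {B} p q =
  mp (mp (taut λ V → valid 3 {λ g a b → (g ⊃ a ⊃ b) ⊃ (g ⊃ a) ⊃ g ⊃ b} refl
                       (eval V Γ) (eval V A) (eval V B)) p) q

hyp : Γ ∧ A ⊢ A
hyp {Γ} {A} = taut λ V → valid 2 {λ g a → (g Bool.∧ a) ⊃ a} refl (eval V Γ) (eval V A)

wk : Γ ⊢ B → Γ ∧ A ⊢ B
wk {Γ} {B} {A} =
  mp (taut λ V → valid 3 {λ g b a → (g ⊃ b) ⊃ (g Bool.∧ a) ⊃ b} refl
                   (eval V Γ) (eval V B) (eval V A))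

hyp¹ : (Γ ∧ A) ∧ B ⊢ A
hyp¹ = wk hyp

intro : Γ ∧ A ⊢ B → Γ ⊢ A ⇒ B
intro {Γ} {A} {B} =
  mp (taut λ V → valid 3 {λ g a b → ((g Bool.∧ a) ⊃ b) ⊃ g ⊃ a ⊃ b} refl
                   (eval V Γ) (eval V A) (eval V B))

pair : Γ ⊢ A → Γ ⊢ B → Γ ⊢ A ∧ B
pair {Γ} {A} {B} p q =
  mp (mp (taut λ V → valid 3 {λ g a b → (g ⊃ a) ⊃ (g ⊃ b) ⊃ g ⊃ (a Bool.∧ b)} refl
                       (eval V Γ) (eval V A) (eval V B)) p) q

fst : Γ ⊢ A ∧ B → Γ ⊢ A
fst {Γ} {A} {B} =
  mp (taut λ V → valid 3 {λ g a b → (g ⊃ (a Bool.∧ b)) ⊃ g ⊃ a} refl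
                   (eval V Γ) (eval V A) (eval V B))

snd : Γ ⊢ A ∧ B → Γ ⊢ B
snd {Γ} {A} {B} =
  mp (taut λ V → valid 3 {λ g a b → (g ⊃ (a Bool.∧ b)) ⊃ g ⊃ b} refl
                   (eval V Γ) (eval V A) (eval V B))

left : Γ ⊢ A → Γ ⊢ A ∨ B
left {Γ} {A} {B} =
  mp (taut λ V → valid 3 {λ g a b → (g ⊃ a) ⊃ g ⊃ (a Bool.∨ b)} refl
                   (eval V Γ) (eval V A) (eval V B))

right : Γ ⊢ B → Γ ⊢ A ∨ B
right {Γ} {B} {A} =
  mp (taut λ V → valid 3 {λ g b a → (g ⊃ b) ⊃ g ⊃ (a Bool.∨ b)} refl
                   (eval V Γ) (eval V B) (eval V A))

cases : Γ ⊢ A ∨ B → Γ ∧ A ⊢ C → Γ ∧ B ⊢ C → Γ ⊢ C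
cases {Γ} {A} {B} {C} p q r =
  mp (mp (mp (taut λ V → valid 4 {λ g a b c → (g ⊃ (a Bool.∨ b)) ⊃ ((g Bool.∧ a) ⊃ c) ⊃
                                            ((g Bool.∧ b) ⊃ c) ⊃ g ⊃ c} refl
                           (eval V Γ) (eval V A) (eval V B) (eval V C)) p) q) r

em : ∀ A → Γ ⊢ A ∨ ¬ A
em {Γ} A = taut λ V → valid 2 {λ g a → g ⊃ (a Bool.∨ Bool.not a)} refl (eval V Γ) (eval V A)

absurd : Γ ⊢ A → Γ ⊢ ¬ A → Γ ⊢ C
absurd {Γ} {A} {C} p q =
  mp (mp (taut λ V → valid 3 {λ g a c → (g ⊃ a) ⊃ (g ⊃ Bool.not a) ⊃ g ⊃ c} refl
                       (eval V Γ) (eval V A) (eval V C)) p) q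

refute : Γ ∧ A ⊢ ¬ A → Γ ⊢ ¬ A
refute {Γ} {A} =
  mp (taut λ V → valid 2 {λ g a → ((g Bool.∧ a) ⊃ Bool.not a) ⊃ g ⊃ Bool.not a} refl
                   (eval V Γ) (eval V A))

cut : Γ ⊢ A → Γ ∧ A ⊢ B → Γ ⊢ B
cut p q = intro q $ p

split : ∀ A → Γ ∧ A ⊢ C → Γ ∧ ¬ A ⊢ C → Γ ⊢ C
split A = cases (em A)

rfl : Γ ⊢ x ≐ x
rfl = ax ≐-refl

sy : Γ ⊢ x ≐ y → Γ ⊢ y ≐ x
sy p = ax ≐-sym $ p

infixr 4 _∙_

_∙_ : Γ ⊢ x ≐ y → Γ ⊢ y ≐ z → Γ ⊢ x ≐ z
p ∙ q = ax ≐-trans $ pair p q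

infix  3 _∎
infixr 2 _≈⟨_⟩_ _≈⟨_⟨_

_≈⟨_⟩_ : ∀ x → Γ ⊢ x ≐ y → Γ ⊢ y ≐ z → Γ ⊢ x ≐ z
_ ≈⟨ p ⟩ q = p ∙ q

_≈⟨_⟨_ : ∀ x → Γ ⊢ y ≐ x → Γ ⊢ y ≐ z → Γ ⊢ x ≐ z
_ ≈⟨ p ⟨ q = sy p ∙ q

_∎ : ∀ x → Γ ⊢ x ≐ x
_ ∎ = rfl

infixr 5 _∷_

data Eqs (Γ : Formula) : ∀ {n} → Vec (Term ℕ) n → Vec (Term ℕ) n → Set where
  []  : Eqs Γ [] []
  _∷_ : ∀ {n} {ts us : Vec (Term ℕ) n} → Γ ⊢ t ≐ u → Eqs Γ ts us → Eqs Γ (t ∷ ts) (u ∷ us)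

discharge : ∀ {n} {ts us : Vec (Term ℕ) n} → Eqs Γ ts us → Γ ⊢ equations⇒ ts us A → Γ ⊢ A
discharge []       d = d
discharge (p ∷ ps) d = discharge ps (d $ p)

congF : ∀ {n} (f : Fun n) {ts us} → Eqs Γ ts us → Γ ⊢ app f ts ≐ app f us
congF f ps = discharge ps (ax (≐-cong f _ _))

cong1 : ∀ f → Γ ⊢ x ≐ x′ → Γ ⊢ f ⟨ x ⟩ ≐ f ⟨ x′ ⟩
cong1 f p = congF f (p ∷ [])

cong2 : ∀ f → Γ ⊢ x ≐ x′ → Γ ⊢ y ≐ y′ → Γ ⊢ f ⟨ x , y ⟩ ≐ f ⟨ x′ , y′ ⟩
cong2 f p q = congF f (p ∷ q ∷ [])

cong3 : ∀ f → Γ ⊢ x ≐ x′ → Γ ⊢ y ≐ y′ → Γ ⊢ z ≐ z′ → Γ ⊢ f ⟨ x , y , z ⟩ ≐ f ⟨ x′ , y′ , z′ ⟩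
cong3 f p q r = congF f (p ∷ q ∷ r ∷ [])

cong4 : ∀ f → Γ ⊢ x ≐ x′ → Γ ⊢ y ≐ y′ → Γ ⊢ z ≐ z′ → Γ ⊢ w ≐ w′ →
        Γ ⊢ f ⟨ x , y , z , w ⟩ ≐ f ⟨ x′ , y′ , z′ , w′ ⟩
cong4 f p q r s = congF f (p ∷ q ∷ r ∷ s ∷ [])

infixl 9 _·≐_ _▷≐_ _◁≐_

_·≐_ : Γ ⊢ x ≐ x′ → Γ ⊢ y ≐ y′ → Γ ⊢ x · y ≐ x′ · y′
_·≐_ = cong2 ·ˢ

_▷≐_ : Γ ⊢ x ≐ x′ → Γ ⊢ y ≐ y′ → Γ ⊢ x ▷ y ≐ x′ ▷ y′
_▷≐_ = cong2 ▷ˢ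

_◁≐_ : Γ ⊢ x ≐ x′ → Γ ⊢ y ≐ y′ → Γ ⊢ x ◁ y ≐ x′ ◁ y′
_◁≐_ = cong2 ◁ˢ

infix 4 _≋_

_≋_ : {Γ : Formula} (σ τ : ℕ → Term ℕ) → Set
_≋_ {Γ} σ τ = ∀ n → Γ ⊢ σ n ≐ τ n

leibT  : ∀ {σ τ} t → _≋_ {Γ} σ τ → Γ ⊢ t [ σ ] ≐ t [ τ ]
leibT* : ∀ {σ τ : ℕ → Term ℕ} {n} (ts : Vec _ n) → _≋_ {Γ} σ τ → Eqs Γ (ts [ σ ]*) (ts [ τ ]*)

leibT (var x)    e = e x
leibT (app f ts) e = congF f (leibT* ts e)

leibT* []       e = []
leibT* (t ∷ ts) e = leibT t e ∷ leibT* ts e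

-- Both directions together, as `¬` and the premise of `⇒` interchange them.
leib⇔ : ∀ {σ τ} A → _≋_ {Γ} σ τ → (Γ ⊢ substF σ A ⇒ substF τ A) × (Γ ⊢ substF τ A ⇒ substF σ A)
leib⇔ (t ≐ u) e = intro (sy (wk (leibT t e)) ∙ hyp ∙ wk (leibT u e)) ,
                  intro (wk (leibT t e) ∙ hyp ∙ sy (wk (leibT u e)))
leib⇔ (¬ A) e with leib⇔ A e
... | f , g = intro (refute (absurd (wk (wk g) $ hyp) (wk hyp))) ,
              intro (refute (absurd (wk (wk f) $ hyp) (wk hyp)))
leib⇔ (A ∧ B) e with leib⇔ A e | leib⇔ B e
... | f , g | f′ , g′ = intro (pair (wk f $ fst hyp) (wk f′ $ snd hyp)) ,
                        intro (pair (wk g $ fst hyp) (wk g′ $ snd hyp))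
leib⇔ (A ∨ B) e with leib⇔ A e | leib⇔ B e
... | f , g | f′ , g′ =
  intro (cases hyp (left (wk (wk f) $ hyp)) (right (wk (wk f′) $ hyp))) ,
  intro (cases hyp (left (wk (wk g) $ hyp)) (right (wk (wk g′) $ hyp)))
leib⇔ (A ⇒ B) e with leib⇔ A e | leib⇔ B e
... | f , g | f′ , g′ =
  intro (intro (wk (wk f′) $ (wk hyp $ (wk (wk g) $ hyp)))) ,
  intro (intro (wk (wk g′) $ (wk hyp $ (wk (wk f) $ hyp))))

leib : ∀ {σ τ} A → _≋_ {Γ} σ τ → Γ ⊢ substF σ A → Γ ⊢ substF τ A
leib A e d = proj₁ (leib⇔ A e) $ d

-- Induction rules

infixr 5 _◂_

_◂_ : Term ℕ → (ℕ → Term ℕ) → ℕ → Term ℕ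
(t ◂ σ) zero    = t
(t ◂ σ) (suc n) = σ n

⊤ᶠ : Formula
⊤ᶠ = ε ≐ ε

close : ⊤ᶠ ⊢ A → T₁⊢ A
close d = mp d (axiom ≐-refl)

-- The induction rules have no side context. A lemma is therefore proved for variables, with the
-- induction on variable 0 and its hypotheses as premises inside `A`; then it is instantiated by `σ`
-- and lifted to `Γ`.
indˡ : ∀ A σ → ⊤ᶠ ⊢ A [ 0 ≔ ε ] → (∀ i → A ⊢ A [ 0 ≔ bit i · var 0 ]) → Γ ⊢ substF σ A
indˡ A σ b s = lift (⊢-subst σ (NINDˡ A 0 (close b) (s false) (s true)))

indʳ : ∀ A σ → ⊤ᶠ ⊢ A [ 0 ≔ ε ] → (∀ i → A ⊢ A [ 0 ≔ var 0 · bit i ]) → Γ ⊢ substF σ A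
indʳ A σ b s = lift (⊢-subst σ (NINDʳ A 0 (close b) (s false) (s true)))

-- The parameter z of TIND is instantiated by a variable that does not occur in A.
indᵗ : ∀ A σ → ⊤ᶠ ⊢ A [ 0 ≔ ε ] → (∀ i → ⊤ᶠ ⊢ A [ 0 ≔ bit i ]) →
       A [ 0 ≔ lh ⟨ var 0 ⟩ ] ∧ A [ 0 ≔ rh ⟨ var 0 ⟩ ] ⊢ A → Γ ⊢ substF σ A
indᵗ A σ b₀ b₁ s =
  lift (⊢-subst σ (TIND A 0 m (λ ()) lh rh refl refl (close b₀) (close (b₁ false)) (close (b₁ true))
    (subst₂ (λ B C → B ∧ C ⊢ A) (sym (fresh lh (lh ⟨ var 0 ⟩) (below lh)))
                                (sym (fresh rh (rh ⟨ var 0 ⟩) (below rh))) s)))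
  where
  m : ℕ
  m = suc (boundF A)

  below : ∀ f y → y < boundF A → bound (single 0 (f ⟨ var 0 ⟩) y) ≤ m
  below f zero    _   = s≤s z≤n
  below f (suc y) y<b = ℕ.≤-trans y<b (ℕ.n≤1+n _)

  fresh : ∀ f t → (∀ y → y < boundF A → bound (single 0 t y) ≤ m) →
          A [ 0 ≔ t ] [ m ≔ f ⟨ var m ⟩ ] ≡ A [ 0 ≔ t ]
  fresh f t p = trans (substF-comp A)
                (substF-ext A λ y y<b → []-fresh (single 0 t y) _ (p y y<b))

-- Strings

one zr : Term ℕ → Term ℕ
one x = oneˢ ⟨ x ⟩
zr x  = zeroˢ ⟨ x ⟩

-- x ~ y says that |x| = |y|.
infix 6 _~_

_~_ : Term ℕ → Term ℕ → Formula
x ~ y = one x ≐ one y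

infixl 9 _·ₗ_ _·ᵣ_
_·ₗ_ : Γ ⊢ x ≐ x′ → ∀ y → Γ ⊢ x · y ≐ x′ · y
p ·ₗ y = p ·≐ rfl
_·ᵣ_ : ∀ x → Γ ⊢ y ≐ y′ → Γ ⊢ x · y ≐ x · y′
x ·ᵣ p = rfl ·≐ p

·-snoc : ∀ i → Γ ⊢ x · (y · bit i) ≐ (x · y) · bit i
·-snoc i = ax ·-bit

▷cons : ∀ i j → Γ ⊢ bit i ▷ (bit j · x) ≐ x
▷cons i j = ax bit▷bit

◁snoc : ∀ i j → Γ ⊢ (x · bit j) ◁ bit i ≐ x
◁snoc i j = ax bit◁bit

one-snoc : ∀ i → Γ ⊢ one (x · bit i) ≐ one x · 𝟏
one-snoc i = ax one-bit

zr-snoc : ∀ i → Γ ⊢ zr (x · bit i) ≐ zr x · 𝟎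
zr-snoc i = ax zero-bit

ε· : ∀ x → Γ ⊢ ε · x ≐ x
ε· x = indʳ (ε · var 0 ≐ var 0) (x ◂ var)
  (ax ·-ε)
  (λ i → ax ·-bit ∙ hyp₀ ·ₗ bit i)

·-assoc : ∀ x y z → Γ ⊢ (x · y) · z ≐ x · (y · z)
·-assoc x y z = indʳ ((var 1 · var 2) · var 0 ≐ var 1 · (var 2 · var 0)) (z ◂ x ◂ y ◂ var)
  (ax ·-ε ∙ var 1 ·ᵣ sy (ax ·-ε))
  (λ i → ax ·-bit ∙ hyp₀ ·ₗ bit i ∙ sy (ax ·-bit) ∙ var 1 ·ᵣ sy (ax ·-bit))

bit≠ε : ∀ i → Γ ⊢ bit i ≠ ε
bit≠ε false = refute (absurd (sy hyp) (ax ε≠0))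
bit≠ε true  = ax 1≠ε

snoc≠ε : ∀ x i → Γ ⊢ x · bit i ≠ ε
snoc≠ε x i = refute (absurd (snd (ax ·-≐ε $ hyp)) (bit≠ε i))

cons≠ε : ∀ i x → Γ ⊢ bit i · x ≠ ε
cons≠ε i x = refute (absurd (fst (ax ·-≐ε $ hyp)) (bit≠ε i))

-- Transfers an equation derived in T₁ to the Booleans of the metalanguage: different bits
-- contradict `0≠1`, so the continuation may assume `i ≡ j`.
bit-distinct : Γ ⊢ bit i ≐ bit j → (i ≡ j → Γ ⊢ C) → Γ ⊢ C
bit-distinct {i = false} {false} p k = k refl
bit-distinct {i = false} {true}  p k = absurd p (ax 0≠1)
bit-distinct {i = true}  {false} p k = absurd (sy p) (ax 0≠1)
bit-distinct {i = true}  {true}  p k = k refl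

bit▷-any : ∀ i j z → Γ ⊢ bit i ▷ z ≐ bit j ▷ z
bit▷-any false false z = rfl
bit▷-any true  true  z = rfl
bit▷-any true  false z = sy (bit▷-any false true z)
bit▷-any false true  z = indˡ (𝟎 ▷ var 0 ≐ 𝟏 ▷ var 0) (z ◂ var)
  (ax (bit▷ε {false}) ∙ sy (ax (bit▷ε {true})))
  (λ k → ax (bit▷bit {false}) ∙ sy (ax (bit▷bit {true})))

bit◁-any : ∀ i j z → Γ ⊢ z ◁ bit i ≐ z ◁ bit j
bit◁-any false false z = rfl
bit◁-any true  true  z = rfl
bit◁-any true  false z = sy (bit◁-any false true z)
bit◁-any false true  z = indʳ (var 0 ◁ 𝟎 ≐ var 0 ◁ 𝟏) (z ◂ var)
  (ax (ε◁bit {false}) ∙ sy (ax (ε◁bit {true})))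
  (λ k → ax (bit◁bit {i = false}) ∙ sy (ax (bit◁bit {i = true})))

▷-· : ∀ x y z → Γ ⊢ (x · y) ▷ z ≐ x ▷ (y ▷ z)
▷-· x y z = indˡ ((var 0 · var 1) ▷ var 2 ≐ var 0 ▷ (var 1 ▷ var 2)) (x ◂ y ◂ z ◂ var)
  (ε· (var 1) ▷≐ rfl ∙ sy (ax ε▷))
  (λ i → ·-assoc (bit i) (var 0) (var 1) ▷≐ rfl ∙ ax bit·▷ ∙ rfl ▷≐ hyp₀ ∙ sy (ax bit·▷))

◁-· : ∀ x y z → Γ ⊢ x ◁ (y · z) ≐ (x ◁ y) ◁ z
◁-· x y z = indʳ (var 1 ◁ (var 2 · var 0) ≐ (var 1 ◁ var 2) ◁ var 0) (z ◂ x ◂ y ◂ var)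
  (rfl ◁≐ ax ·-ε ∙ sy (ax ◁ε))
  (λ i → rfl ◁≐ ax ·-bit ∙ ax ◁·bit ∙ hyp₀ ◁≐ rfl ∙ sy (ax ◁·bit))

▷-bit-comm : ∀ x i z → Γ ⊢ x ▷ (bit i ▷ z) ≐ bit i ▷ (x ▷ z)
▷-bit-comm x i z = rfl ▷≐ bit▷-any i true z ∙
  indˡ (var 0 ▷ (𝟏 ▷ var 1) ≐ 𝟏 ▷ (var 0 ▷ var 1)) (x ◂ z ◂ var)
    (ax ε▷ ∙ rfl ▷≐ sy (ax ε▷))
    (λ j → ax bit·▷ ∙ rfl ▷≐ hyp₀ ∙ bit▷-any j true _ ∙ rfl ▷≐ bit▷-any true j _ ∙ rfl ▷≐ sy (ax bit·▷))
  ∙ bit▷-any true i _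

◁-bit-comm : ∀ z x i → Γ ⊢ (z ◁ x) ◁ bit i ≐ (z ◁ bit i) ◁ x
◁-bit-comm z x i = bit◁-any i true _ ∙
  indʳ ((var 1 ◁ var 0) ◁ 𝟏 ≐ (var 1 ◁ 𝟏) ◁ var 0) (x ◂ z ◂ var)
    (ax ◁ε ◁≐ rfl ∙ sy (ax ◁ε))
    (λ j → ax ◁·bit ◁≐ rfl ∙ bit◁-any true j _ ∙ bit◁-any j true _ ◁≐ rfl ∙ hyp₀ ◁≐ rfl ∙ sy (ax ◁·bit))
  ∙ bit◁-any true i z ◁≐ rfl

▷-cancel : ∀ x y → Γ ⊢ x ▷ (x · y) ≐ y
▷-cancel x y = indˡ (var 0 ▷ (var 0 · var 1) ≐ var 1) (x ◂ y ◂ var)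
  (ax ε▷ ∙ ε· _)
  (λ i → ax bit·▷ ∙ rfl ▷≐ (rfl ▷≐ ·-assoc _ _ _) ∙ sy (▷-bit-comm _ i _) ∙ rfl ▷≐ ax bit▷bit ∙ hyp₀)

◁-cancel : ∀ x y → Γ ⊢ (x · y) ◁ y ≐ x
◁-cancel x y = indʳ ((var 1 · var 0) ◁ var 0 ≐ var 1) (y ◂ x ◂ var)
  (ax ◁ε ∙ ax ·-ε)
  (λ i → ax ◁·bit ∙ ax ·-bit ◁≐ rfl ◁≐ rfl ∙ ◁-bit-comm _ _ i ∙ ax bit◁bit ◁≐ rfl ∙ hyp₀)

▷-self : ∀ x → Γ ⊢ x ▷ x ≐ ε
▷-self x = rfl ▷≐ sy (ax ·-ε) ∙ ▷-cancel x ε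

◁-self : ∀ x → Γ ⊢ x ◁ x ≐ ε
◁-self x = sy (ε· x) ◁≐ rfl ∙ ◁-cancel ε x

▷ε : ∀ x → Γ ⊢ x ▷ ε ≐ ε
▷ε x = indˡ (var 0 ▷ ε ≐ ε) (x ◂ var) (ax ε▷) (λ i → ax bit·▷ ∙ rfl ▷≐ hyp₀ ∙ ax bit▷ε)

ε◁ : ∀ x → Γ ⊢ ε ◁ x ≐ ε
ε◁ x = indʳ (ε ◁ var 0 ≐ ε) (x ◂ var) (ax ◁ε) (λ i → ax ◁·bit ∙ hyp₀ ◁≐ rfl ∙ ax ε◁bit)

bit▷bit≐ε : ∀ i j → Γ ⊢ bit i ▷ bit j ≐ ε
bit▷bit≐ε i j = rfl ▷≐ sy (ax ·-ε) ∙ ax bit▷bit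

bit◁bit≐ε : ∀ i j → Γ ⊢ bit j ◁ bit i ≐ ε
bit◁bit≐ε i j = sy (ε· _) ◁≐ rfl ∙ ax bit◁bit

snoc▷ : ∀ x i y → Γ ⊢ (x · bit i) ▷ y ≐ bit i ▷ (x ▷ y)
snoc▷ x i y = ▷-· x (bit i) y ∙ ▷-bit-comm x i y

·-cancelˡ : Γ ⊢ x · y ≐ x · z → Γ ⊢ y ≐ z
·-cancelˡ p = sy (▷-cancel _ _) ∙ rfl ▷≐ p ∙ ▷-cancel _ _

·-cancelʳ : Γ ⊢ x · y ≐ z · y → Γ ⊢ x ≐ z
·-cancelʳ p = sy (◁-cancel _ _) ∙ p ◁≐ rfl ∙ ◁-cancel _ _

snoc-injˡ : ∀ i j → Γ ⊢ x · bit i ≐ y · bit j → Γ ⊢ x ≐ y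
snoc-injˡ i j p = sy (◁snoc true i) ∙ p ◁≐ rfl ∙ ◁snoc true j

snoc-injʳ : ∀ i j → Γ ⊢ x · bit i ≐ y · bit j → Γ ⊢ bit i ≐ bit j
snoc-injʳ i j p = ·-cancelˡ (p ∙ sy (snoc-injˡ i j p) ·ₗ _)

cons-injʳ : ∀ i j → Γ ⊢ bit i · x ≐ bit j · y → Γ ⊢ x ≐ y
cons-injʳ i j p = sy (▷cons true i) ∙ rfl ▷≐ p ∙ ▷cons true j

cons-injˡ : ∀ i j → Γ ⊢ bit i · x ≐ bit j · y → Γ ⊢ bit i ≐ bit j
cons-injˡ i j p = ·-cancelʳ (p ∙ _ ·ᵣ sy (cons-injʳ i j p))

Bit : Term ℕ → Formula
Bit x = x ≐ 𝟎 ∨ x ≐ 𝟏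

bit-Bit : ∀ i → Γ ⊢ Bit (bit i)
bit-Bit false = left rfl
bit-Bit true  = right rfl

Bit-≐ : Γ ⊢ x ≐ y → Γ ⊢ Bit y → Γ ⊢ Bit x
Bit-≐ p q = cases q (left (wk p ∙ hyp)) (right (wk p ∙ hyp))

onBit : Γ ⊢ Bit x → (∀ i → Γ ∧ x ≐ bit i ⊢ C) → Γ ⊢ C
onBit p k = cases p (k false) (k true)

-- An induction that ignores its hypothesis serves as a case distinction on the last bit. The
-- remaining string is named by the term `x ◁ 𝟏`, since a quantifier-free formula cannot assert its
-- existence.
snocCase : ∀ x → Γ ∧ x ≐ ε ⊢ C → (∀ i → Γ ∧ x ≐ (x ◁ 𝟏) · bit i ⊢ C) → Γ ⊢ C
snocCase x p k = cases
  (indʳ (v0 ≐ ε ∨ (v0 ≐ (v0 ◁ 𝟏) · 𝟎 ∨ v0 ≐ (v0 ◁ 𝟏) · 𝟏)) (x ◂ var)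
    (left rfl) λ { false → right (left (sy (◁snoc true false) ·ₗ _)) ; true → right (right (sy (◁snoc true true) ·ₗ _)) })
  p (cases hyp (mono (k false)) (mono (k true)))
  where
  v0 : Term ℕ
  v0 = var 0
  mono : ∀ {A B} → Γ ∧ A ⊢ C → (Γ ∧ B) ∧ A ⊢ C
  mono q = wk (wk (intro q)) $ hyp

consCase : ∀ x → Γ ∧ x ≐ ε ⊢ C → (∀ i → Γ ∧ x ≐ bit i · (𝟏 ▷ x) ⊢ C) → Γ ⊢ C
consCase x p k = cases
  (indˡ (v0 ≐ ε ∨ (v0 ≐ 𝟎 · (𝟏 ▷ v0) ∨ v0 ≐ 𝟏 · (𝟏 ▷ v0))) (x ◂ var)
    (left rfl) λ { false → right (left (𝟎 ·ᵣ sy (▷cons true false))) ; true → right (right (𝟏 ·ᵣ sy (▷cons true true))) })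
  p (cases hyp (mono (k false)) (mono (k true)))
  where
  v0 : Term ℕ
  v0 = var 0
  mono : ∀ {A B} → Γ ∧ A ⊢ C → (Γ ∧ B) ∧ A ⊢ C
  mono q = wk (wk (intro q)) $ hyp

-- Lengths

one-· : ∀ x y → Γ ⊢ one (x · y) ≐ one x · one y
one-· x y = indʳ (one (var 1 · var 0) ≐ one (var 1) · one (var 0)) (y ◂ x ◂ var)
  (cong1 oneˢ (ax ·-ε) ∙ sy (ax ·-ε) ∙ rfl ·≐ sy (ax one-ε))
  (λ i → cong1 oneˢ (·-snoc i) ∙ one-snoc i ∙ hyp₀ ·ₗ _ ∙ sy (·-snoc true) ∙ rfl ·≐ sy (one-snoc i))

zr-· : ∀ x y → Γ ⊢ zr (x · y) ≐ zr x · zr y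
zr-· x y = indʳ (zr (var 1 · var 0) ≐ zr (var 1) · zr (var 0)) (y ◂ x ◂ var)
  (cong1 zeroˢ (ax ·-ε) ∙ sy (ax ·-ε) ∙ rfl ·≐ sy (ax zero-ε))
  (λ i → cong1 zeroˢ (·-snoc i) ∙ zr-snoc i ∙ hyp₀ ·ₗ _ ∙ sy (·-snoc false) ∙ rfl ·≐ sy (zr-snoc i))

one-bit1 : ∀ i → Γ ⊢ one (bit i) ≐ 𝟏
one-bit1 i = cong1 oneˢ (sy (ε· _)) ∙ ax one-bit ∙ ax one-ε ·ₗ _ ∙ ε· _

zr-bit : ∀ i → Γ ⊢ zr (bit i) ≐ 𝟎
zr-bit i = cong1 zeroˢ (sy (ε· _)) ∙ ax zero-bit ∙ ax zero-ε ·ₗ _ ∙ ε· _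

one-cons : ∀ i x → Γ ⊢ one (bit i · x) ≐ 𝟏 · one x
one-cons i x = one-· _ _ ∙ one-bit1 i ·ₗ _

zr-cons : ∀ i x → Γ ⊢ zr (bit i · x) ≐ 𝟎 · zr x
zr-cons i x = zr-· _ _ ∙ zr-bit i ·ₗ _

one-zr : ∀ x → Γ ⊢ zr x ~ x
one-zr x = indʳ (zr (var 0) ~ var 0) (x ◂ var)
  (cong1 oneˢ (ax zero-ε))
  (λ i → cong1 oneˢ (zr-snoc i) ∙ one-snoc false ∙ hyp₀ ·ₗ _ ∙ sy (one-snoc i))

zr-one : ∀ x → Γ ⊢ zr (one x) ≐ zr x
zr-one x = indʳ (zr (one (var 0)) ≐ zr (var 0)) (x ◂ var)
  (cong1 zeroˢ (ax one-ε))
  (λ i → cong1 zeroˢ (one-snoc i) ∙ zr-snoc true ∙ hyp₀ ·ₗ _ ∙ sy (zr-snoc i))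

zr-~ : Γ ⊢ x ~ y → Γ ⊢ zr x ≐ zr y
zr-~ p = sy (zr-one _) ∙ cong1 zeroˢ p ∙ zr-one _

one≐ε : Γ ⊢ one x ≐ ε → Γ ⊢ x ≐ ε
one≐ε {x = x} p = indʳ (one (var 0) ≐ ε ⇒ var 0 ≐ ε) (x ◂ var)
  (intro rfl) (λ i → intro (absurd (sy (one-snoc i) ∙ hyp) (snoc≠ε _ true))) $ p

~ε : Γ ⊢ x ~ ε → Γ ⊢ x ≐ ε
~ε p = one≐ε (p ∙ ax one-ε)

~snoc : ∀ i j → Γ ⊢ x ~ y → Γ ⊢ x · bit i ~ y · bit j
~snoc i j p = one-snoc i ∙ p ·ₗ _ ∙ sy (one-snoc j)

~snoc⁻ : ∀ i j → Γ ⊢ x · bit i ~ y · bit j → Γ ⊢ x ~ y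
~snoc⁻ i j p = ·-cancelʳ (sy (one-snoc i) ∙ p ∙ one-snoc j)

~· : Γ ⊢ x ~ x′ → Γ ⊢ y ~ y′ → Γ ⊢ x · y ~ x′ · y′
~· p q = one-· _ _ ∙ p ·≐ q ∙ sy (one-· _ _)

~cancelʳ : Γ ⊢ x · y ~ x′ · y′ → Γ ⊢ y ~ y′ → Γ ⊢ x ~ x′
~cancelʳ p q = ·-cancelʳ (sy (one-· _ _) ∙ p ∙ one-· _ _ ∙ rfl ·≐ sy q)

~refl : Γ ⊢ x ≐ y → Γ ⊢ x ~ y
~refl = cong1 oneˢ

-- The reason why `▷` respects `~`: a deletion depends on `t` only through `one t`.
one▷ : ∀ t x → Γ ⊢ one t ▷ x ≐ t ▷ x
one▷ t x = indˡ (one (var 0) ▷ var 1 ≐ var 0 ▷ var 1) (t ◂ x ◂ var)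
  (ax one-ε ▷≐ rfl)
  (λ i → one-cons i _ ▷≐ rfl ∙ ax (bit·▷ {i = true}) ∙ rfl ▷≐ hyp₀ ∙ bit▷-any true i _ ∙ sy (ax bit·▷))

◁one : ∀ x t → Γ ⊢ x ◁ one t ≐ x ◁ t
◁one x t = indʳ (var 1 ◁ one (var 0) ≐ var 1 ◁ var 0) (t ◂ x ◂ var)
  (rfl ◁≐ ax one-ε)
  (λ i → rfl ◁≐ ax one-bit ∙ ax (◁·bit {i = true}) ∙ hyp₀ ◁≐ rfl ∙ bit◁-any true i _ ∙ sy (ax ◁·bit))

▷-~ : Γ ⊢ x ~ y → Γ ⊢ z ≐ w → Γ ⊢ x ▷ z ≐ y ▷ w
▷-~ p q = sy (one▷ _ _) ∙ p ▷≐ q ∙ one▷ _ _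

◁-~ : Γ ⊢ z ≐ w → Γ ⊢ x ~ y → Γ ⊢ z ◁ x ≐ w ◁ y
◁-~ q p = sy (◁one _ _) ∙ q ◁≐ p ∙ ◁one _ _

one-▷ : ∀ t x → Γ ⊢ one (t ▷ x) ≐ t ▷ one x
one-▷ t x = indˡ (one (var 0 ▷ var 1) ≐ var 0 ▷ one (var 1)) (t ◂ x ◂ var)
  (~refl (ax ε▷) ∙ sy (ax ε▷))
  (λ i → ~refl (ax bit·▷) ∙ one-bit▷ i _ ∙ rfl ▷≐ hyp₀ ∙ sy (ax bit·▷))
  where
  one-bit▷ : ∀ i x → Γ ⊢ one (bit i ▷ x) ≐ bit i ▷ one x
  one-bit▷ i x = ~refl (bit▷-any i true x) ∙
    indˡ (one (𝟏 ▷ var 0) ≐ 𝟏 ▷ one (var 0)) (x ◂ var)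
      (~refl (ax (bit▷ε {true})) ∙ ax one-ε ∙ sy (ax (bit▷ε {true})) ∙ rfl ▷≐ sy (ax one-ε))
      (λ j → ~refl (ax (bit▷bit {true})) ∙ sy (ax (bit▷bit {true} {true})) ∙ rfl ▷≐ sy (one-cons j _))
    ∙ bit▷-any true i _

▷~▷ : Γ ⊢ x ~ y → Γ ⊢ z ~ w → Γ ⊢ x ▷ z ~ y ▷ w
▷~▷ p q = one-▷ _ _ ∙ ▷-~ p q ∙ sy (one-▷ _ _)

~▷ : Γ ⊢ x ~ y → Γ ⊢ x ▷ (y · z) ≐ z
~▷ p = ▷-~ p rfl ∙ ▷-cancel _ _

~◁ : Γ ⊢ x ~ y → Γ ⊢ (z · y) ◁ x ≐ z
~◁ p = ◁-~ rfl p ∙ ◁-cancel _ _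

-- Prefixes

-- The first |t| bits of `x`, and all of `x` if `t` is at least as long: what is cut off on the
-- right is as long as what `t` leaves over.
take : ∀ {V} → Term V → Term V → Term V
take t x = x ◁ (t ▷ x)

module Advance {Γ} {x y w : Term ℕ} (j : Bool) (p : Γ ⊢ x ≐ y · (bit j · w)) where
  re : Γ ⊢ x ≐ (y · bit j) · w
  re = p ∙ sy (·-assoc _ _ _)

  ◁w : Γ ⊢ x ◁ w ≐ y · bit j
  ◁w = re ◁≐ rfl ∙ ◁-cancel _ _

take-drop : ∀ t x → Γ ⊢ x ≐ take t x · (t ▷ x)
take-drop t x = indʳ (var 1 ≐ take (var 0) (var 1) · (var 0 ▷ var 1)) (t ◂ x ◂ var)
  (sy (ε· _) ∙ (sy (◁-self _) ∙ rfl ◁≐ sy (ax ε▷)) ·≐ sy (ax ε▷))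
  (λ i → step (var 0) (var 1) i hyp₀)
  where
  step : ∀ t x i → Γ ⊢ x ≐ take t x · (t ▷ x) → Γ ⊢ x ≐ take (t · bit i) x · ((t · bit i) ▷ x)
  step t x i p = consCase (t ▷ x)
    (let e = snoc▷ t i x ∙ rfl ▷≐ hyp ∙ ax bit▷ε in
     sy (ax ·-ε) ∙ (sy (ax ◁ε) ∙ rfl ◁≐ sy e) ·≐ sy e)
    (λ j → let e = snoc▷ t i x ∙ rfl ▷≐ hyp ∙ ax bit▷bit
               open Advance j (wk p ∙ rfl ·≐ hyp) in
     re ∙ (sy ◁w ∙ rfl ◁≐ sy e) ·≐ sy e)

take-snoc : ∀ t i j {x w} → Γ ⊢ t ▷ x ≐ bit j · w → Γ ⊢ take (t · bit i) x ≐ take t x · bit j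
take-snoc t i j {x} p =
  rfl ◁≐ (snoc▷ t i x ∙ rfl ▷≐ p ∙ ax bit▷bit) ∙ Advance.◁w j (take-drop t x ∙ rfl ·≐ p)

take-full : ∀ t i {x} → Γ ⊢ t ▷ x ≐ ε → Γ ⊢ take (t · bit i) x ≐ take t x
take-full t i {x} p = rfl ◁≐ (snoc▷ t i x ∙ rfl ▷≐ p ∙ ax bit▷ε ∙ sy p)

take-all : Γ ⊢ t ~ x → Γ ⊢ take t x ≐ x
take-all p = rfl ◁≐ (▷-~ p rfl ∙ ▷-self _) ∙ ax ◁ε

take-ε : ∀ x → Γ ⊢ take ε x ≐ ε
take-ε x = rfl ◁≐ ax ε▷ ∙ ◁-self _

take~ : ∀ t x → Γ ⊢ t ▷ x ≠ ε → Γ ⊢ take t x ~ t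
take~ t x q = indʳ (var 0 ▷ var 1 ≠ ε ⇒ take (var 0) (var 1) ~ var 0) (t ◂ x ◂ var)
  (intro (~refl (take-ε _)))
  (λ i → intro (consCase (var 0 ▷ var 1)
     (absurd (snoc▷ _ i _ ∙ rfl ▷≐ hyp ∙ ax bit▷ε) hyp¹)
     (λ j → ~refl (take-snoc _ i j hyp) ∙ ~snoc j i (wk (wk hyp₀) $ refute (absurd (sy hyp¹ ∙ hyp) (cons≠ε j _))))))
  $ q

take-one~ : Γ ⊢ t ~ u → Γ ⊢ x ~ y → Γ ⊢ take t x ~ take u y
take-one~ p q = ~cancelʳ (~refl (sy (take-drop _ _)) ∙ q ∙ ~refl (take-drop _ _)) (▷~▷ p q)

-- Boolean functions

β : ∀ {n} {t : Term _} (ts : Vec (Term ℕ) n) → Γ ⊢ app (lam t) ts ≐ t [ lookup ts ]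
β ts = ax (lam-β _ ts)

cond-same : ∀ w i → Γ ⊢ cond ⟨ w · bit i , x , y , y ⟩ ≐ y
cond-same w false = ax cond-0 ∙ (cong1 zeroˢ (◁-self _) ∙ ax zero-ε) ·≐ rfl ∙ ε· _
cond-same w true  = ax cond-1 ∙ (cong1 zeroˢ (◁-self _) ∙ ax zero-ε) ·≐ rfl ∙ ε· _

cB-ε : Γ ⊢ cB ⟨ ε , y , z ⟩ ≐ z
cB-ε = β _ ∙ ax cond-ε

cB-bit : ∀ c a b → Γ ⊢ cB ⟨ bit c , bit a , bit b ⟩ ≐ bit (if c then a else b)
cB-bit false a b = β _ ∙ cong4 cond (sy (ε· _)) rfl rfl rfl ∙ ax cond-0 ∙
                   (cong1 zeroˢ (bit◁bit≐ε b a) ∙ ax zero-ε) ·≐ rfl ∙ ε· _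
cB-bit true  a b = β _ ∙ cong4 cond (sy (ε· _)) rfl rfl rfl ∙ ax cond-1 ∙
                   (cong1 zeroˢ (bit◁bit≐ε a b) ∙ ax zero-ε) ·≐ rfl ∙ ε· _

sg-ε : Γ ⊢ sg ⟨ ε ⟩ ≐ 𝟎
sg-ε = β _ ∙ cB-ε

sg-bit : ∀ i → Γ ⊢ sg ⟨ bit i ⟩ ≐ bit i
sg-bit false = β _ ∙ cB-bit false true false
sg-bit true  = β _ ∙ cB-bit true true false

notB-ε : Γ ⊢ notB ⟨ ε ⟩ ≐ 𝟏
notB-ε = β _ ∙ cB-ε

notB-bit : ∀ i → Γ ⊢ notB ⟨ bit i ⟩ ≐ bit (Bool.not i)
notB-bit false = β _ ∙ cB-bit false false true
notB-bit true  = β _ ∙ cB-bit true false true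

andB-bit : ∀ i j → Γ ⊢ andB ⟨ bit i , bit j ⟩ ≐ bit (i Bool.∧ j)
andB-bit false j = β _ ∙ cong3 cB rfl (sg-bit j) rfl ∙ cB-bit false j false
andB-bit true  j = β _ ∙ cong3 cB rfl (sg-bit j) rfl ∙ cB-bit true j false

orB-bit : ∀ i j → Γ ⊢ orB ⟨ bit i , bit j ⟩ ≐ bit (i Bool.∨ j)
orB-bit false j = β _ ∙ cong3 cB rfl rfl (sg-bit j) ∙ cB-bit false true j
orB-bit true  j = β _ ∙ cong3 cB rfl rfl (sg-bit j) ∙ cB-bit true true j

xorB : Fun 2
xorB = ƛ 2 λ (x , y) → cB ⟨ x , notB ⟨ y ⟩ , sg ⟨ y ⟩ ⟩

xorB-bit : ∀ i j → Γ ⊢ xorB ⟨ bit i , bit j ⟩ ≐ bit (i Bool.xor j)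
xorB-bit false j = β _ ∙ cong3 cB rfl (notB-bit j) (sg-bit j) ∙ cB-bit false (Bool.not j) j
xorB-bit true  j = β _ ∙ cong3 cB rfl (notB-bit j) (sg-bit j) ∙ cB-bit true (Bool.not j) j

xor₃ maj : Fun 3
xor₃ = ƛ 3 λ (x , y , z) → xorB ⟨ x , xorB ⟨ y , z ⟩ ⟩
maj  = ƛ 3 λ (x , y , z) → cB ⟨ x , orB ⟨ y , z ⟩ , andB ⟨ y , z ⟩ ⟩

xor₃ᵇ majᵇ : Bool → Bool → Bool → Bool
xor₃ᵇ i j k = i Bool.xor (j Bool.xor k)
majᵇ i j k  = if i then j Bool.∨ k else j Bool.∧ k

xor₃-bit : ∀ i j k → Γ ⊢ xor₃ ⟨ bit i , bit j , bit k ⟩ ≐ bit (xor₃ᵇ i j k)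
xor₃-bit i j k = β _ ∙ cong2 xorB rfl (xorB-bit j k) ∙ xorB-bit i (j Bool.xor k)

maj-bit : ∀ i j k → Γ ⊢ maj ⟨ bit i , bit j , bit k ⟩ ≐ bit (majᵇ i j k)
maj-bit i j k = β _ ∙ cong3 cB rfl (orB-bit j k) (andB-bit j k) ∙ cB-bit i (j Bool.∨ k) (j Bool.∧ k)

Bit2 : ∀ f (φ : Bool → Bool → Bool) → (∀ {Γ} i j → Γ ⊢ f ⟨ bit i , bit j ⟩ ≐ bit (φ i j)) →
       Γ ⊢ Bit x → Γ ⊢ Bit y → Γ ⊢ Bit (f ⟨ x , y ⟩)
Bit2 f φ t p q = onBit p λ i → onBit (wk q) λ j →
  Bit-≐ (cong2 f hyp¹ hyp ∙ t i j) (bit-Bit (φ i j))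

-- lb and fb are the bits appended by rCRN and ℓCRN.
lb fb : Term ℕ → Term ℕ
lb x = x ▷ (𝟎 · x)
fb x = (x · 𝟎) ◁ x

lb-ε : Γ ⊢ lb ε ≐ 𝟎
lb-ε = ax ε▷ ∙ ax ·-ε

lb-snoc : ∀ x i → Γ ⊢ lb (x · bit i) ≐ bit i
lb-snoc x i = ▷-· x (bit i) _ ∙ rfl ▷≐ ▷cons i false ∙ ▷-cancel x (bit i)

lb-bit : ∀ i → Γ ⊢ lb (bit i) ≐ bit i
lb-bit i = sy (ε· _) ▷≐ (rfl ·≐ sy (ε· _)) ∙ lb-snoc ε i

lb-≐ : Γ ⊢ x ≐ y → Γ ⊢ lb x ≐ lb y
lb-≐ p = p ▷≐ (rfl ·≐ p)

lb-Bit : ∀ x → Γ ⊢ Bit (lb x)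
lb-Bit x = snocCase x (Bit-≐ (lb-≐ hyp ∙ lb-ε) (bit-Bit false))
                      (λ i → Bit-≐ (lb-≐ hyp ∙ lb-snoc _ i) (bit-Bit i))

fb-bit : ∀ i → Γ ⊢ fb (bit i) ≐ bit i
fb-bit i = ◁snoc i false

fb-≐ : Γ ⊢ x ≐ y → Γ ⊢ fb x ≐ fb y
fb-≐ p = (p ·≐ rfl) ◁≐ p

br-snoc : ∀ x i → Γ ⊢ br ⟨ x · bit i ⟩ ≐ bit i
br-snoc x i = β _ ∙ (β _ ∙ ◁snoc true i) ▷≐ rfl ∙ ▷-cancel x (bit i)

bl-cons : ∀ i x → Γ ⊢ bl ⟨ bit i · x ⟩ ≐ bit i
bl-cons i x = β _ ∙ rfl ◁≐ (β _ ∙ ▷cons true i) ∙ ◁-cancel (bit i) x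

dr-snoc : ∀ i → Γ ⊢ dr ⟨ x · bit i ⟩ ≐ x
dr-snoc i = β _ ∙ ◁snoc true i

dl-cons : ∀ i → Γ ⊢ dl ⟨ bit i · x ⟩ ≐ x
dl-cons i = β _ ∙ ▷cons true i

-- Tree recursion

module _ (g : Fun 1) (h : Fun 3) (p : rankF h ≡ 0) where
  private
    f : Fun 1
    f = STRN g h p

  STRN₁ : ∀ x → let t = h ⟨ x , f ⟨ lh ⟨ x ⟩ ⟩ , f ⟨ rh ⟨ x ⟩ ⟩ ⟩ in
          Γ ⊢ f ⟨ x ⟩ ≐ cond ⟨ x ◁ 𝟏 , g ⟨ x ⟩ , t , t ⟩
  STRN₁ x = β _ ∙ ax (TRN-def _ _ _ _ _ _ _) ∙ cong4 cond rfl (β _) e e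
    where
    e = β _ ∙ congF h (rfl ∷ (congF _ (rfl ∷ β _ ∷ []) ∙ sy (β _)) ∷
                            (congF _ (rfl ∷ β _ ∷ []) ∙ sy (β _)) ∷ [])

module _ (g : Fun 2) (h : Fun 4) (p : rankF h ≡ 0) where
  private
    f : Fun 2
    f = STRN g h p

  STRN₂ : ∀ x y → let t = h ⟨ x , y , f ⟨ lh ⟨ x ⟩ , y ⟩ , f ⟨ rh ⟨ x ⟩ , y ⟩ ⟩ in
          Γ ⊢ f ⟨ x , y ⟩ ≐ cond ⟨ x ◁ 𝟏 , g ⟨ x , y ⟩ , t , t ⟩
  STRN₂ x y = β _ ∙ ax (TRN-def _ _ _ _ _ _ _) ∙ cong4 cond rfl (β _) e e
    where
    e = β _ ∙ congF h (rfl ∷ rfl ∷ (congF _ (rfl ∷ β _ ∷ rfl ∷ []) ∙ sy (β _)) ∷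
                                  (congF _ (rfl ∷ β _ ∷ rfl ∷ []) ∙ sy (β _)) ∷ [])

-- Disjunction and conjunction of the bits of a string

-- The possible values of `OR` and `AND`, which return `ε` on the empty string.
Tri : Term ℕ → Formula
Tri x = x ≐ ε ∨ Bit x

Tri-≐ : Γ ⊢ x ≐ y → Γ ⊢ Tri y → Γ ⊢ Tri x
Tri-≐ p q = cases q (left (wk p ∙ hyp)) (right (Bit-≐ (wk p) hyp))

onTri : Γ ⊢ Tri x → Γ ∧ x ≐ ε ⊢ C → (∀ i → Γ ∧ x ≐ bit i ⊢ C) → Γ ⊢ C
onTri p q r = cases p q (onBit hyp λ i → wk (wk (intro (r i))) $ hyp)

sg-Bit : Γ ⊢ Tri x → Γ ⊢ Bit (sg ⟨ x ⟩)
sg-Bit p = onTri p (Bit-≐ (cong1 sg hyp ∙ sg-ε) (bit-Bit false))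
                   (λ i → Bit-≐ (cong1 sg hyp ∙ sg-bit i) (bit-Bit i))

cB-sg : ∀ a b → Γ ⊢ Tri x → Γ ⊢ cB ⟨ x , bit a , bit b ⟩ ≐ cB ⟨ sg ⟨ x ⟩ , bit a , bit b ⟩
cB-sg a b p = onTri p
  (cong3 cB hyp rfl rfl ∙ cB-ε ∙ sy (cong3 cB (cong1 sg hyp ∙ sg-ε) rfl rfl ∙ cB-bit false a b))
  (λ i → cong3 cB (hyp ∙ sy (sg-bit i) ∙ cong1 sg (sy hyp)) rfl rfl)

orB-sg : Γ ⊢ Tri x → Γ ⊢ Tri y → Γ ⊢ orB ⟨ x , y ⟩ ≐ orB ⟨ sg ⟨ x ⟩ , sg ⟨ y ⟩ ⟩
orB-sg p q = onBit (sg-Bit q) λ j →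
  β _ ∙ cong3 cB rfl rfl hyp ∙ cB-sg true j (wk p) ∙
  sy (β _ ∙ cong3 cB rfl rfl (cong1 sg hyp ∙ sg-bit j))

leaf₁ : ∀ g h p → Γ ⊢ x ◁ 𝟏 ≐ ε → Γ ⊢ STRN g h p ⟨ x ⟩ ≐ g ⟨ x ⟩
leaf₁ g h p q = STRN₁ g h p _ ∙ cong4 cond q rfl rfl rfl ∙ ax cond-ε

node₁ : ∀ g h p w i → Γ ⊢ x ◁ 𝟏 ≐ w · bit i →
        Γ ⊢ STRN g h p ⟨ x ⟩ ≐ h ⟨ x , STRN g h p ⟨ lh ⟨ x ⟩ ⟩ , STRN g h p ⟨ rh ⟨ x ⟩ ⟩ ⟩
node₁ g h p w i q = STRN₁ g h p _ ∙ cong4 cond q rfl rfl rfl ∙ cond-same w i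

OR-leaf : Γ ⊢ x ◁ 𝟏 ≐ ε → Γ ⊢ OR ⟨ x ⟩ ≐ x
OR-leaf q = leaf₁ _ _ refl q ∙ β _

OR-node : ∀ w i → Γ ⊢ x ◁ 𝟏 ≐ w · bit i → Γ ⊢ OR ⟨ x ⟩ ≐ orB ⟨ OR ⟨ lh ⟨ x ⟩ ⟩ , OR ⟨ rh ⟨ x ⟩ ⟩ ⟩
OR-node w i q = node₁ _ _ refl w i q ∙ β _

AND-leaf : Γ ⊢ x ◁ 𝟏 ≐ ε → Γ ⊢ AND ⟨ x ⟩ ≐ x
AND-leaf q = leaf₁ _ _ refl q ∙ β _

AND-node : ∀ w i → Γ ⊢ x ◁ 𝟏 ≐ w · bit i → Γ ⊢ AND ⟨ x ⟩ ≐ andB ⟨ AND ⟨ lh ⟨ x ⟩ ⟩ , AND ⟨ rh ⟨ x ⟩ ⟩ ⟩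
AND-node w i q = node₁ _ _ refl w i q ∙ β _

short : ∀ i → Γ ⊢ bit i ◁ 𝟏 ≐ ε
short i = bit◁bit≐ε true i

-- The leaves of TRN are the strings of length at most 1.
leafCase : ∀ x → Γ ∧ x ≐ ε ⊢ C → (∀ i → Γ ∧ x ≐ bit i ⊢ C) →
           (∀ i → Γ ∧ x ◁ 𝟏 ≐ (x ◁ 𝟏 ◁ 𝟏) · bit i ⊢ C) → Γ ⊢ C
leafCase x p q r = snocCase x p λ i → snocCase (x ◁ 𝟏)
  (wk (wk (intro (q i))) $ (hyp¹ ∙ hyp ·ₗ _ ∙ ε· _))
  (λ j → wk (wk (intro (r j))) $ hyp)

-- sg makes this a bit also for x = ε, where OR ⟨ x ⟩ is ε.
nz : Term ℕ → Term ℕ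
nz x = sg ⟨ OR ⟨ x ⟩ ⟩

zr-split : Γ ⊢ x ≐ y · z → Γ ⊢ zr x ≐ x → Γ ⊢ zr y ≐ y ∧ zr z ≐ z
zr-split p q = pair (·-cancelʳ (e ∙ _ ·ᵣ sy e′)) e′
  where
  e = sy (zr-· _ _) ∙ cong1 zeroˢ (sy p) ∙ q ∙ p
  e′ = sy (~▷ (sy (one-zr _))) ∙ rfl ▷≐ e ∙ ▷-cancel _ _

zr-join : Γ ⊢ x ≐ y · z → Γ ⊢ zr y ≐ y → Γ ⊢ zr z ≐ z → Γ ⊢ zr x ≐ x
zr-join p q r = cong1 zeroˢ p ∙ zr-· _ _ ∙ q ·≐ r ∙ sy p

-- Absence of ones is expressed by `zr x ≐ x`, an equation that holds for a concatenation exactly if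
-- it holds for both parts, hence passes between `x` and its halves.
OR-spec : Term ℕ → Formula
OR-spec x = Tri (OR ⟨ x ⟩) ∧ ((zr x ≐ x ∧ nz x ≐ 𝟎) ∨ (¬ (zr x ≐ x) ∧ nz x ≐ 𝟏))

OR-correct : ∀ x → Γ ⊢ OR-spec x
OR-correct s = indᵗ (OR-spec (var 0)) (s ◂ var) (at-ε rfl) (λ i → at-bit i rfl)
  (leafCase (var 0) (at-ε hyp) (λ i → at-bit i hyp)
    (λ i → at-node i hyp (wk (fst hyp₀)) (wk (snd hyp₀))))
  where
  at-ε : Γ ⊢ x ≐ ε → Γ ⊢ OR-spec x
  at-ε p = pair (left e) (left (pair (cong1 zeroˢ p ∙ ax zero-ε ∙ sy p) (cong1 sg e ∙ sg-ε)))
    where e = OR-leaf (p ◁≐ rfl ∙ ax (ε◁bit {true})) ∙ p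

  at-bit : ∀ i → Γ ⊢ x ≐ bit i → Γ ⊢ OR-spec x
  at-bit {x = x} i p = pair (right (Bit-≐ (e i p) (bit-Bit i))) (tail i p)
    where
    e : ∀ i → Γ ⊢ x ≐ bit i → Γ ⊢ OR ⟨ x ⟩ ≐ bit i
    e i p = OR-leaf (p ◁≐ rfl ∙ short i) ∙ p

    tail : ∀ i → Γ ⊢ x ≐ bit i → Γ ⊢ (zr x ≐ x ∧ nz x ≐ 𝟎) ∨ (¬ (zr x ≐ x) ∧ nz x ≐ 𝟏)
    tail false p = left (pair (cong1 zeroˢ p ∙ zr-bit false ∙ sy p) (cong1 sg (e false p) ∙ sg-bit false))
    tail true  p = right (pair
      (refute (absurd (sy (zr-bit true) ∙ cong1 zeroˢ (sy (wk p)) ∙ hyp ∙ wk p) (ax 0≠1)))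
      (cong1 sg (e true p) ∙ sg-bit true))

  at-node : ∀ i → Γ ⊢ x ◁ 𝟏 ≐ w · bit i → Γ ⊢ OR-spec (lh ⟨ x ⟩) → Γ ⊢ OR-spec (rh ⟨ x ⟩) →
            Γ ⊢ OR-spec x
  at-node {w = w} i n p q = cut e (pair
    (right (Bit-≐ hyp (Bit2 orB _ orB-bit (sg-Bit (wk (fst p))) (sg-Bit (wk (fst q))))))
    (cases (wk (snd p))
      (cases (wk (wk (snd q)))
        (left (pair (zr-join (sy (ax lh·rh)) (wk (fst hyp)) (fst hyp))
                    (cong1 sg (wk hyp¹ ∙ cong2 orB (wk (snd hyp)) (snd hyp) ∙ orB-bit false false) ∙ sg-bit false)))
        (right (pair (refute (absurd (snd (zr-split (sy (ax lh·rh)) hyp)) (wk (fst hyp))))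
                     (cong1 sg (wk hyp¹ ∙ cong2 orB (wk (snd hyp)) (snd hyp) ∙ orB-bit false true) ∙ sg-bit true))))
      (right (pair (refute (absurd (fst (zr-split (sy (ax lh·rh)) hyp)) (wk (fst hyp))))
                   (onBit (wk (wk (sg-Bit (fst q)))) λ j →
                    cong1 sg (wk hyp¹ ∙ cong2 orB (wk (snd hyp)) hyp ∙ orB-bit true j) ∙ sg-bit true)))))
    where
    e = OR-node w i n ∙ orB-sg (fst p) (fst q)

OR-Tri : ∀ x → Γ ⊢ Tri (OR ⟨ x ⟩)
OR-Tri x = fst (OR-correct x)

nz-Bit : ∀ x → Γ ⊢ Bit (nz x)
nz-Bit x = sg-Bit (OR-Tri x)

nz-≐ : Γ ⊢ x ≐ y → Γ ⊢ nz x ≐ nz y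
nz-≐ p = cong1 sg (cong1 OR p)

nz≐0 : Γ ⊢ zr x ≐ x → Γ ⊢ nz x ≐ 𝟎
nz≐0 p = cases (snd (OR-correct _)) (snd hyp) (absurd (wk p) (fst hyp))

nz≐1 : Γ ⊢ ¬ (zr x ≐ x) → Γ ⊢ nz x ≐ 𝟏
nz≐1 p = cases (snd (OR-correct _)) (absurd (fst hyp) (wk p)) (snd hyp)

nz-ε : Γ ⊢ nz ε ≐ 𝟎
nz-ε = nz≐0 (ax zero-ε)

nz-snoc : ∀ x i → Γ ⊢ nz (x · bit i) ≐ orB ⟨ nz x , bit i ⟩
nz-snoc x true = nz≐1 (refute (absurd (snoc-injʳ false true (sy (zr-snoc true) ∙ hyp)) (ax 0≠1))) ∙
  onBit (nz-Bit x) λ { false → sy (cong2 orB hyp rfl ∙ orB-bit false true)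
                     ; true  → sy (cong2 orB hyp rfl ∙ orB-bit true true) }
nz-snoc x false = cases (snd (OR-correct x))
  (nz≐0 (zr-snoc false ∙ fst hyp ·ₗ _) ∙ sy (cong2 orB (snd hyp) rfl ∙ orB-bit false false))
  (nz≐1 (refute (absurd (snoc-injˡ false false (sy (zr-snoc false) ∙ hyp)) (wk (fst hyp)))) ∙
   sy (cong2 orB (snd hyp) rfl ∙ orB-bit true false))

nz-snocᵇ : ∀ i j → Γ ⊢ nz x ≐ bit i → Γ ⊢ nz (x · bit j) ≐ bit (i Bool.∨ j)
nz-snocᵇ i j p = nz-snoc _ j ∙ cong2 orB p rfl ∙ orB-bit i j

lb-OR : ∀ x → Γ ⊢ lb (OR ⟨ x ⟩) ≐ nz x
lb-OR x = onTri (OR-Tri x) (lb-≐ hyp ∙ lb-ε ∙ sy (cong1 sg hyp ∙ sg-ε))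
                           (λ i → lb-≐ hyp ∙ lb-bit i ∙ sy (cong1 sg hyp ∙ sg-bit i))

cB-OR : ∀ a b → Γ ⊢ cB ⟨ OR ⟨ x ⟩ , bit a , bit b ⟩ ≐ cB ⟨ nz x , bit a , bit b ⟩
cB-OR a b = cB-sg a b (OR-Tri _)

notB-OR : ∀ x → Γ ⊢ notB ⟨ OR ⟨ x ⟩ ⟩ ≐ notB ⟨ nz x ⟩
notB-OR x = β _ ∙ cB-OR false true ∙ sy (β _)

AND-spec : Term ℕ → Formula
AND-spec x = Tri (AND ⟨ x ⟩) ∧ (AND ⟨ x ⟩ ≐ 𝟏 ⇒ one x ≐ x)

AND-correct : ∀ x → Γ ⊢ AND-spec x
AND-correct s = indᵗ (AND-spec (var 0)) (s ◂ var) (at-ε rfl) (λ i → at-bit i rfl)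
  (leafCase (var 0) (at-ε hyp) (λ i → at-bit i hyp)
    (λ i → at-node i hyp (wk (fst hyp₀)) (wk (snd hyp₀))))
  where
  at-ε : Γ ⊢ x ≐ ε → Γ ⊢ AND-spec x
  at-ε p = pair (left (AND-leaf (p ◁≐ rfl ∙ ax (ε◁bit {true})) ∙ p))
                (intro (cong1 oneˢ (wk p) ∙ ax one-ε ∙ sy (wk p)))

  at-bit : ∀ i → Γ ⊢ x ≐ bit i → Γ ⊢ AND-spec x
  at-bit {x = x} i p = pair (right (Bit-≐ e (bit-Bit i)))
    (intro (let r = wk p ∙ sy (wk e) ∙ hyp in cong1 oneˢ r ∙ one-bit1 true ∙ sy r))
    where
    e = AND-leaf (p ◁≐ rfl ∙ short i) ∙ p

  at-node : ∀ i → Γ ⊢ x ◁ 𝟏 ≐ w · bit i → Γ ⊢ AND-spec (lh ⟨ x ⟩) → Γ ⊢ AND-spec (rh ⟨ x ⟩) →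
            Γ ⊢ AND-spec x
  at-node {x = x} {w = w} i n p q =
    onBit (sg-Bit (fst q)) λ j →
    onTri (wk (fst p))
      -- If the value at the left half were `ε`, `andB` would fall back to its default `𝟎`, so this
      -- case can be treated without excluding it.
      (let e = wk (wk (AND-node w i n)) ∙ β _ ∙ cong3 cB hyp rfl rfl ∙ cB-ε in
       pair (right (Bit-≐ e (bit-Bit false))) (intro (absurd (sy (wk e) ∙ hyp) (ax 0≠1))))
      (λ k →
       let e = wk (wk (AND-node w i n)) ∙ β _ ∙ cong3 cB hyp hyp¹ rfl ∙ cB-bit k j false in
       pair (right (Bit-≐ e (bit-Bit _)))
            (intro (tail k j (wk e ∙ rfl) hyp (wk hyp) (wk hyp¹) (wk (wk (wk p))) (wk (wk (wk q))))))
    where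
    tail : ∀ {Δ} k j → Δ ⊢ AND ⟨ x ⟩ ≐ bit (if k then j else false) → Δ ⊢ AND ⟨ x ⟩ ≐ 𝟏 →
           Δ ⊢ AND ⟨ lh ⟨ x ⟩ ⟩ ≐ bit k → Δ ⊢ sg ⟨ AND ⟨ rh ⟨ x ⟩ ⟩ ⟩ ≐ bit j →
           Δ ⊢ AND-spec (lh ⟨ x ⟩) → Δ ⊢ AND-spec (rh ⟨ x ⟩) → Δ ⊢ one x ≐ x
    tail true true e h a b p q =
      ~refl (sy (ax lh·rh)) ∙ one-· _ _ ∙ (snd p $ a) ·≐ (snd q $ r) ∙ ax lh·rh
      where r = onTri (fst q) (absurd (sy (cong1 sg hyp ∙ sg-ε) ∙ wk b) (ax 0≠1))
                  λ { false → absurd (sy (cong1 sg hyp ∙ sg-bit false) ∙ wk b) (ax 0≠1) ; true → hyp }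
    tail true  false e h a b p q = absurd (sy e ∙ h) (ax 0≠1)
    tail false j     e h a b p q = absurd (sy e ∙ h) (ax 0≠1)

AND-Tri : ∀ x → Γ ⊢ Tri (AND ⟨ x ⟩)
AND-Tri x = fst (AND-correct x)

AND≐1 : Γ ⊢ AND ⟨ x ⟩ ≐ 𝟏 → Γ ⊢ one x ≐ x
AND≐1 p = snd (AND-correct _) $ p

-- Simultaneous induction on strings of equal length

≡⇒≐ : x ≡ y → Γ ⊢ x ≐ y
≡⇒≐ refl = rfl

bit-[] : ∀ i (σ : ℕ → Term ℕ) → bit i [ σ ] ≡ bit i
bit-[] false σ = refl
bit-[] true  σ = refl

leib-comp : ∀ {ρ σ τ} A → _≋_ {Γ} ρ (σ ⨾ τ) → Γ ⊢ substF ρ A → Γ ⊢ substF τ (substF σ A)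
leib-comp {Γ} A e d = subst (Γ ⊢_) (sym (substF-comp A)) (leib A e d)

leib∘ : ∀ {σ τ σ′ τ′} A → _≋_ {Γ} (σ ⨾ τ) (σ′ ⨾ τ′) →
        Γ ⊢ substF τ (substF σ A) → Γ ⊢ substF τ′ (substF σ′ A)
leib∘ {Γ} A e d = leib-comp A e (subst (Γ ⊢_) (substF-comp A) d)

~▷ε : Γ ⊢ x ~ y → Γ ⊢ t ▷ x ≐ ε → Γ ⊢ t ▷ y ≐ ε
~▷ε p q = ~ε (▷~▷ rfl (sy p) ∙ ~refl q)

module _ (A : Formula) where
  private
    v0 v1 v2 v3 : Term ℕ
    v0 = var 0
    v1 = var 1
    v2 = var 2
    v3 = var 3

    next : Bool → Bool → Bool → ℕ → Term ℕ
    next i j k = v0 · bit i ◂ v1 · bit j ◂ v2 · bit k ◂ λ n → var (3 + n)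

    τ : ℕ → Term ℕ
    τ = take v0 v1 ◂ take v0 v2 ◂ take v0 v3 ◂ λ n → var (4 + n)

    Len : Formula
    Len = v1 ~ v2 ∧ v1 ~ v3

    -- The induction rule follows one string only. With `v0` as that string, the claim is made for
    -- the prefixes of length |v0| of the other three; they grow in step, and stop growing together
    -- because the three lengths agree. In the end `v0` is the first of the three itself.
    Q : Formula
    Q = Len ⇒ substF τ A

  module _ (base : ⊤ᶠ ⊢ substF (ε ◂ ε ◂ ε ◂ λ n → var (3 + n)) A)
           (step : ∀ i j k → (v0 ~ v1 ∧ v0 ~ v2) ∧ A ⊢ substF (next i j k) A) where
    private
      at-ε : ⊤ᶠ ⊢ Q [ 0 ≔ ε ]
      at-ε = intro (leib∘ A
        (λ { 0 → sy (take-ε _) ; 1 → sy (take-ε _) ; 2 → sy (take-ε _) ; (suc (suc (suc n))) → rfl })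
        (lift (⊢-subst (λ n → var (suc n)) (close base))))

      no-end : ∀ j → Γ ⊢ x ~ y → Γ ⊢ v0 ▷ x ≐ bit j · w → Γ ⊢ v0 ▷ y ≐ ε → Γ ⊢ C
      no-end j l p q = absurd (sy p ∙ ~▷ε (sy l) q) (cons≠ε j _)

      at-snoc : ∀ i → Q ⊢ Q [ 0 ≔ v0 · bit i ]
      at-snoc i = intro (consCase (v0 ▷ v1)
        (leib-comp A
          (λ { 0 → sy (take-full v0 i hyp)
             ; 1 → sy (take-full v0 i (~▷ε (fst hyp¹) hyp))
             ; 2 → sy (take-full v0 i (~▷ε (snd hyp¹) hyp))
             ; (suc (suc (suc n))) → rfl })
          (wk (wk hyp₀ $ hyp)))
        λ j → consCase (v0 ▷ v2) (no-end j (wk (fst hyp¹)) hyp¹ hyp)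
        λ k → consCase (v0 ▷ v3) (no-end j (wk (wk (snd hyp¹))) (wk hyp¹) hyp)
        λ l → leib∘ A
          (λ { 0 → rfl ·≐ ≡⇒≐ (bit-[] j τ) ∙ sy (take-snoc v0 i j (wk hyp¹))
             ; 1 → rfl ·≐ ≡⇒≐ (bit-[] k τ) ∙ sy (take-snoc v0 i k hyp¹)
             ; 2 → rfl ·≐ ≡⇒≐ (bit-[] l τ) ∙ sy (take-snoc v0 i l hyp)
             ; (suc (suc (suc n))) → rfl })
          (lift (⊢-subst τ (step j k l)) $
            pair (pair (take-one~ rfl (wk (wk (fst hyp¹)))) (take-one~ rfl (wk (wk (snd hyp¹)))))
                 (wk (wk (wk (wk hyp₀ $ hyp))))))

    ind₃ : ∀ σ → Γ ⊢ σ 0 ~ σ 1 → Γ ⊢ σ 0 ~ σ 2 → Γ ⊢ substF σ A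
    ind₃ {Γ} σ p q = leib A
      (λ { 0 → take-all rfl ; 1 → take-all p ; 2 → take-all q ; (suc (suc (suc n))) → rfl })
      (subst (Γ ⊢_) (substF-comp A) (indʳ Q (σ 0 ◂ σ) at-ε at-snoc $ pair p q))

-- Length-preserving functions that read a string from left to right

▷◁-comm : ∀ t x → Γ ⊢ t ▷ (x ◁ 𝟏) ≐ (t ▷ x) ◁ 𝟏
▷◁-comm t x = indˡ (var 0 ▷ (var 1 ◁ 𝟏) ≐ (var 0 ▷ var 1) ◁ 𝟏) (t ◂ x ◂ var)
  (ax ε▷ ∙ sy (ax ε▷) ◁≐ rfl)
  (λ i → ax bit·▷ ∙ rfl ▷≐ hyp₀ ∙ bit▷◁ i (var 0 ▷ var 1) ∙ sy (ax bit·▷) ◁≐ rfl)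
  where
  bit▷◁ : ∀ i z → Γ ⊢ bit i ▷ (z ◁ 𝟏) ≐ (bit i ▷ z) ◁ 𝟏
  bit▷◁ i z = consCase z
    (rfl ▷≐ (hyp ◁≐ rfl ∙ ε◁ 𝟏) ∙ ▷ε _ ∙ sy (ε◁ 𝟏) ∙ (sy (▷ε _) ∙ rfl ▷≐ sy hyp) ◁≐ rfl)
    λ j → snocCase (𝟏 ▷ z)
      (let e = hyp¹ ∙ rfl ·≐ hyp ∙ ax ·-ε in
       rfl ▷≐ (e ◁≐ rfl ∙ short j) ∙ ▷ε _ ∙ sy (ε◁ 𝟏) ∙ (sy (bit▷bit≐ε i j) ∙ rfl ▷≐ sy e) ◁≐ rfl)
      λ k → let e = hyp¹ ∙ rfl ·≐ hyp in
        rfl ▷≐ (e ◁≐ rfl ∙ ·-snoc k ◁≐ rfl ∙ ◁snoc true k) ∙ ▷cons i j ∙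
        sy (◁snoc true k) ∙ (sy (▷cons i j) ∙ rfl ▷≐ sy e) ◁≐ rfl

take-dr : ∀ t x → Γ ⊢ t ▷ x ≠ ε → Γ ⊢ take t x ≐ take t (x ◁ 𝟏)
take-dr t x p = snocCase (t ▷ x) (absurd hyp (wk p)) λ i →
  rfl ◁≐ hyp ∙ ax ◁·bit ∙ ◁-bit-comm x _ i ∙ bit◁-any i true x ◁≐ rfl ∙ rfl ◁≐ sy (▷◁-comm t x)

▷≠ε-snoc : ∀ t i → Γ ⊢ (t · bit i) ▷ x ≠ ε → Γ ⊢ t ▷ x ≠ ε
▷≠ε-snoc t i p = refute (absurd (snoc▷ t i _ ∙ rfl ▷≐ hyp ∙ ax bit▷ε) (wk p))

~lb : ∀ i z → Γ ⊢ x ~ y → Γ ⊢ x · lb z ~ y · bit i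
~lb i z p = onBit (lb-Bit z) λ j → ~refl (rfl ·≐ hyp) ∙ ~snoc j i (wk p)

module _ (ψ : Fun 3) where
  -- The parameters of `rCRN` never change, so its recursion variable merely marks a position, and
  -- `ψ` computes the bit at that position from the prefixes ending there.
  scanᵇ : Fun 4
  scanᵇ = ƛ 4 λ (t , x , y , z) → ψ ⟨ take t x , take t y , take t z ⟩

  scan : Fun 3
  scan = ƛ 3 λ (x , y , z) → rCRN scanᵇ ⟨ x , x , y , z ⟩

  private
    R : Term ℕ → Term ℕ → Term ℕ → Term ℕ → Term ℕ
    R t x y z = rCRN scanᵇ ⟨ t , x , y , z ⟩

    Inside : Term ℕ → Term ℕ → Term ℕ → Term ℕ → Formula
    Inside t x y z = t ▷ x ≠ ε ∧ (t ▷ y ≠ ε ∧ t ▷ z ≠ ε)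

    R-dr : ∀ t x y z → Γ ⊢ Inside t x y z ⇒ R t x y z ≐ R t (x ◁ 𝟏) (y ◁ 𝟏) (z ◁ 𝟏)
    R-dr t x y z = indʳ (Inside v0 v1 v2 v3 ⇒ R v0 v1 v2 v3 ≐ R v0 (v1 ◁ 𝟏) (v2 ◁ 𝟏) (v3 ◁ 𝟏))
      (t ◂ x ◂ y ◂ z ◂ var)
      (intro (ax (rCRN-ε scanᵇ) ∙ sy (ax (rCRN-ε scanᵇ))))
      (λ i → intro (ax (rCRN-bit scanᵇ) ∙
         (wk hyp₀ $ pair (▷≠ε-snoc v0 i (fst hyp))
                      (pair (▷≠ε-snoc v0 i (fst (snd hyp))) (▷≠ε-snoc v0 i (snd (snd hyp)))))
         ·≐ lb-≐ (β _ ∙ cong3 ψ (take-dr _ _ (fst hyp)) (take-dr _ _ (fst (snd hyp)))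
                                (take-dr _ _ (snd (snd hyp))) ∙ sy (β _))
         ∙ sy (ax (rCRN-bit scanᵇ))))
      where
      v0 v1 v2 v3 : Term ℕ
      v0 = var 0
      v1 = var 1
      v2 = var 2
      v3 = var 3

  scan-ε : Γ ⊢ scan ⟨ ε , y , z ⟩ ≐ ε
  scan-ε = β _ ∙ ax (rCRN-ε scanᵇ)

  scan-snoc : ∀ i j k → Γ ⊢ x ~ y → Γ ⊢ x ~ z →
    Γ ⊢ scan ⟨ x · bit i , y · bit j , z · bit k ⟩ ≐
        scan ⟨ x , y , z ⟩ · lb (ψ ⟨ x · bit i , y · bit j , z · bit k ⟩)
  scan-snoc {x = x} i j k p q = β _ ∙ ax (rCRN-bit scanᵇ) ∙
    ((R-dr x _ _ _ $ pair (in▷ i rfl) (pair (in▷ j p) (in▷ k q))) ∙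
     cong4 (rCRN scanᵇ) rfl (◁snoc true i) (◁snoc true j) (◁snoc true k) ∙ sy (β _)) ·≐
    lb-≐ (β _ ∙ cong3 ψ (take-all rfl) (take-all (~snoc i j p)) (take-all (~snoc i k q)))
    where
    in▷ : ∀ {y} i → _ ⊢ x ~ y → _ ⊢ x ▷ (y · bit i) ≠ ε
    in▷ i p = refute (absurd (sy (~▷ (wk p)) ∙ hyp) (bit≠ε i))

  scan~ : ∀ x y z → Γ ⊢ scan ⟨ x , y , z ⟩ ~ x
  scan~ x y z = ~refl (β _) ∙
    indʳ (R (var 0) (var 1) (var 2) (var 3) ~ var 0) (x ◂ x ◂ y ◂ z ◂ var)
      (~refl (ax (rCRN-ε scanᵇ))) (λ i → ~refl (ax (rCRN-bit scanᵇ)) ∙ ~lb i _ hyp₀)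

-- Addition modulo 2 ^ |u| of binary numbers, least significant bit first

Table : Fun 3 → (Bool → Bool → Bool → Bool) → Set
Table f φ = ∀ {Γ} i j k → Γ ⊢ f ⟨ bit i , bit j , bit k ⟩ ≐ bit (φ i j k)

bitwise : Fun 3 → Fun 3
bitwise f = scan (ƛ 3 λ (x , y , z) → f ⟨ br ⟨ x ⟩ , br ⟨ y ⟩ , br ⟨ z ⟩ ⟩)

bitwise-ε : ∀ f → Γ ⊢ bitwise f ⟨ ε , y , z ⟩ ≐ ε
bitwise-ε f = scan-ε _

bitwise~ : ∀ f x y z → Γ ⊢ bitwise f ⟨ x , y , z ⟩ ~ x
bitwise~ f = scan~ _

bitwise-snoc : ∀ {f φ} → Table f φ → ∀ i j k → Γ ⊢ x ~ y → Γ ⊢ x ~ z →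
  Γ ⊢ bitwise f ⟨ x · bit i , y · bit j , z · bit k ⟩ ≐ bitwise f ⟨ x , y , z ⟩ · bit (φ i j k)
bitwise-snoc {f = f} {φ} T i j k p q = scan-snoc _ i j k p q ∙
  _ ·ᵣ (lb-≐ (β _ ∙ cong3 f (br-snoc _ i) (br-snoc _ j) (br-snoc _ k) ∙ T i j k) ∙ lb-bit (φ i j k))

-- The mirror image of `first₁`.
lastOne : Fun 1
lastOne = ℓCRN (ƛ 1 λ x → cB ⟨ OR ⟨ dl ⟨ x ⟩ ⟩ , 𝟎 , bl ⟨ x ⟩ ⟩)

lastOne-ε : Γ ⊢ lastOne ⟨ ε ⟩ ≐ ε
lastOne-ε = ax (ℓCRN-ε _)

lastOne-cons : ∀ i j → Γ ⊢ nz x ≐ bit j →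
               Γ ⊢ lastOne ⟨ bit i · x ⟩ ≐ bit (if j then false else i) · lastOne ⟨ x ⟩
lastOne-cons {x = x} i j p = ax (ℓCRN-bit _) ∙ (fb-≐ e ∙ fb-bit _) ·ₗ _
  where
  e = β _ ∙ cong3 cB (cong1 OR (dl-cons i)) rfl (bl-cons i x) ∙ cB-OR false i ∙
      cong3 cB p rfl rfl ∙ cB-bit j false i

lastOne~ : ∀ x → Γ ⊢ lastOne ⟨ x ⟩ ~ x
lastOne~ x = indˡ (lastOne ⟨ var 0 ⟩ ~ var 0) (x ◂ var)
  (~refl lastOne-ε)
  (λ i → onBit (nz-Bit (var 0)) λ j →
    ~refl (lastOne-cons i j hyp) ∙ one-cons _ _ ∙ 𝟏 ·ᵣ wk hyp₀ ∙ sy (one-cons i _))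

-- `ℓCRN` unfolds at the left end of a string, whereas addition proceeds at the right end; this
-- lemma and the next one translate between the two.
lastOne-snoc1 : ∀ x → Γ ⊢ lastOne ⟨ x · 𝟏 ⟩ ≐ zr x · 𝟏
lastOne-snoc1 x = indˡ (lastOne ⟨ var 0 · 𝟏 ⟩ ≐ zr (var 0) · 𝟏) (x ◂ var)
  (cong1 lastOne (ε· _ ∙ sy (ax ·-ε)) ∙ lastOne-cons true false nz-ε ∙ _ ·ᵣ lastOne-ε ∙ ax ·-ε ∙
   sy (ε· _) ∙ sy (ax zero-ε) ·ₗ _)
  (λ i → cong1 lastOne (·-assoc _ _ _) ∙
    lastOne-cons i true nz-one ∙ _ ·ᵣ hyp₀ ∙ sy (·-assoc _ _ _) ∙ sy (zr-cons i _) ·ₗ _)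
  where
  nz-one : ∀ {x} → Γ ⊢ nz (x · 𝟏) ≐ 𝟏
  nz-one {x = x} = onBit (nz-Bit x) λ { false → nz-snocᵇ false true hyp ; true → nz-snocᵇ true true hyp }

lastOne-snoc0 : ∀ x → Γ ⊢ lastOne ⟨ x · 𝟎 ⟩ ≐ lastOne ⟨ x ⟩ · 𝟎
lastOne-snoc0 x = indˡ (lastOne ⟨ var 0 · 𝟎 ⟩ ≐ lastOne ⟨ var 0 ⟩ · 𝟎) (x ◂ var)
  (cong1 lastOne (ε· _ ∙ sy (ax ·-ε)) ∙ lastOne-cons false false nz-ε ∙ _ ·ᵣ lastOne-ε ∙ ax ·-ε ∙
   sy (ε· _) ∙ sy lastOne-ε ·ₗ _)
  (λ i → onBit (nz-Bit (var 0)) λ j → cong1 lastOne (·-assoc _ _ _) ∙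
    lastOne-cons i j (nz0 j hyp) ∙ _ ·ᵣ wk hyp₀ ∙ sy (·-assoc _ _ _) ∙ sy (lastOne-cons i j hyp) ·ₗ _)
  where
  nz0 : ∀ {x} j → Γ ⊢ nz x ≐ bit j → Γ ⊢ nz (x · 𝟎) ≐ bit j
  nz0 false p = nz-snocᵇ false false p
  nz0 true  p = nz-snocᵇ true false p

-- The carry out of u + v is the bit of u at the last position where u and v agree.
conj eqv : Fun 3
conj = ƛ 3 λ (x , y , z) → andB ⟨ x , y ⟩
eqv  = ƛ 3 λ (x , y , z) → notB ⟨ xorB ⟨ x , y ⟩ ⟩

conj-bit : Table conj (λ i j k → i Bool.∧ j)
conj-bit i j k = β _ ∙ andB-bit i j

eqv-bit : Table eqv (λ i j k → Bool.not (i Bool.xor j))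
eqv-bit i j k = β _ ∙ cong1 notB (xorB-bit i j) ∙ notB-bit (i Bool.xor j)

carry : Fun 2
carry = ƛ 2 λ (u , v) →
  sg ⟨ OR ⟨ bitwise conj ⟨ u , lastOne ⟨ bitwise eqv ⟨ u , v , v ⟩ ⟩ , u ⟩ ⟩ ⟩

carry-Bit : ∀ u v → Γ ⊢ Bit (carry ⟨ u , v ⟩)
carry-Bit u v = Bit-≐ (β _) (nz-Bit _)

carry-ε : Γ ⊢ carry ⟨ ε , v ⟩ ≐ 𝟎
carry-ε = β _ ∙ nz-≐ (bitwise-ε conj) ∙ nz-ε

conj-zr : Γ ⊢ u ~ v → Γ ⊢ nz (bitwise conj ⟨ u , zr v , u ⟩) ≐ 𝟎
conj-zr {u = u} {v = v} p = ind₃ (nz (bitwise conj ⟨ var 0 , zr (var 1) , var 0 ⟩) ≐ 𝟎)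
  (nz-≐ (bitwise-ε conj) ∙ nz-ε)
  (λ i j k → nz-≐ (cong3 (bitwise conj) rfl (zr-snoc j) rfl ∙
      bitwise-snoc conj-bit i false i (fst (fst hyp₀) ∙ sy (one-zr _)) rfl) ∙
    at i (snd hyp₀))
  (u ◂ v ◂ u ◂ var) p rfl
  where
  at : ∀ {Γ x} i → Γ ⊢ nz x ≐ 𝟎 → Γ ⊢ nz (x · bit (i Bool.∧ false)) ≐ 𝟎
  at false p = nz-snocᵇ false false p
  at true  p = nz-snocᵇ false false p

-- If the new digits agree, theirs is the last agreement and the carry is their common value; if
-- they differ, the last agreement stays where it was and so does the carry. Both cases are given by
-- the majority of `i`, `j` and `c`.
carry-snoc : ∀ i j c → Γ ⊢ u ~ v → Γ ⊢ carry ⟨ u , v ⟩ ≐ bit c →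
             Γ ⊢ carry ⟨ u · bit i , v · bit j ⟩ ≐ bit (majᵇ i j c)
carry-snoc {Γ = Γ} {u = u} {v = v} i j c p q =
  β _ ∙ nz-≐ (cong3 (bitwise conj) rfl (cong1 lastOne (bitwise-snoc eqv-bit i j j p p)) rfl) ∙ go i j c q
  where
  e : Term ℕ
  e = bitwise eqv ⟨ u , v , v ⟩

  agree : ∀ i → Γ ⊢ nz (bitwise conj ⟨ u · bit i , lastOne ⟨ e · 𝟏 ⟩ , u · bit i ⟩) ≐ bit (i Bool.∧ true)
  agree i = nz-≐ (cong3 (bitwise conj) rfl (lastOne-snoc1 e) rfl ∙
      bitwise-snoc conj-bit i true i (sy (one-zr _ ∙ bitwise~ eqv _ _ _)) rfl) ∙
    nz-snocᵇ false (i Bool.∧ true) (nz-≐ (cong3 (bitwise conj) rfl (zr-~ (bitwise~ eqv _ _ _)) rfl) ∙ conj-zr rfl)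

  differ : ∀ i c → Γ ⊢ carry ⟨ u , v ⟩ ≐ bit c →
    Γ ⊢ nz (bitwise conj ⟨ u · bit i , lastOne ⟨ e · 𝟎 ⟩ , u · bit i ⟩) ≐ bit (c Bool.∨ (i Bool.∧ false))
  differ i c q = nz-≐ (cong3 (bitwise conj) rfl (lastOne-snoc0 e) rfl ∙
      bitwise-snoc conj-bit i false i (sy (lastOne~ _ ∙ bitwise~ eqv _ _ _)) rfl) ∙
    nz-snocᵇ c (i Bool.∧ false) (sy (β _) ∙ q)

  go : ∀ i j c → Γ ⊢ carry ⟨ u , v ⟩ ≐ bit c →
    Γ ⊢ nz (bitwise conj ⟨ u · bit i , lastOne ⟨ e · bit (Bool.not (i Bool.xor j)) ⟩ , u · bit i ⟩) ≐ bit (majᵇ i j c)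
  go false false c     q = agree false
  go true  true  c     q = agree true
  go false true  false q = differ false false q
  go false true  true  q = differ false true q
  go true  false false q = differ true false q
  go true  false true  q = differ true true q

addᵇ : Fun 3
addᵇ = ƛ 3 λ (x , y , z) → xor₃ ⟨ br ⟨ x ⟩ , br ⟨ y ⟩ , carry ⟨ dr ⟨ x ⟩ , dr ⟨ y ⟩ ⟩ ⟩

add : Fun 2
add = ƛ 2 λ (u , v) → scan addᵇ ⟨ u , v , v ⟩

infixl 8 _⊞_

_⊞_ : ∀ {V} → Term V → Term V → Term V
u ⊞ v = add ⟨ u , v ⟩

⊞≐ : Γ ⊢ x ≐ x′ → Γ ⊢ y ≐ y′ → Γ ⊢ x ⊞ y ≐ x′ ⊞ y′
⊞≐ = cong2 add

⊞-ε : Γ ⊢ ε ⊞ v ≐ ε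
⊞-ε = β _ ∙ scan-ε addᵇ

⊞~ : ∀ u v → Γ ⊢ u ⊞ v ~ u
⊞~ u v = ~refl (β _) ∙ scan~ addᵇ _ _ _

⊞-snoc : ∀ i j c → Γ ⊢ u ~ v → Γ ⊢ carry ⟨ u , v ⟩ ≐ bit c →
         Γ ⊢ u · bit i ⊞ v · bit j ≐ (u ⊞ v) · bit (xor₃ᵇ i j c)
⊞-snoc i j c p q = β _ ∙ scan-snoc addᵇ i j j p p ∙ sy (β _) ·≐
  (lb-≐ (β _ ∙ cong3 xor₃ (br-snoc _ i) (br-snoc _ j) (cong2 carry (dr-snoc i) (dr-snoc j) ∙ q) ∙
         xor₃-bit i j c) ∙ lb-bit (xor₃ᵇ i j c))

⊞-comm-carry : Γ ⊢ u ~ v → Γ ⊢ u ⊞ v ≐ v ⊞ u ∧ carry ⟨ u , v ⟩ ≐ carry ⟨ v , u ⟩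
⊞-comm-carry {u = u} {v = v} p =
  ind₃ (var 0 ⊞ var 1 ≐ var 1 ⊞ var 0 ∧ carry ⟨ var 0 , var 1 ⟩ ≐ carry ⟨ var 1 , var 0 ⟩)
    (pair rfl rfl)
    (λ i j k → onBit (carry-Bit (var 0) (var 1)) λ c → step i j c (wk (fst (fst hyp₀))) (wk (snd hyp₀)) hyp)
    (u ◂ v ◂ u ◂ var) p rfl
  where
  step : ∀ {Γ x y} i j c → Γ ⊢ x ~ y → Γ ⊢ x ⊞ y ≐ y ⊞ x ∧ carry ⟨ x , y ⟩ ≐ carry ⟨ y , x ⟩ →
    Γ ⊢ carry ⟨ x , y ⟩ ≐ bit c →
    Γ ⊢ x · bit i ⊞ y · bit j ≐ y · bit j ⊞ x · bit i ∧
        carry ⟨ x · bit i , y · bit j ⟩ ≐ carry ⟨ y · bit j , x · bit i ⟩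
  step i j c p q r =
    let r′ = sy (snd q) ∙ r in
    pair (⊞-snoc i j c p r ∙ fst q ·≐ ≡⇒≐ (cong bit (xor-comm i j c)) ∙ sy (⊞-snoc j i c (sy p) r′))
         (carry-snoc i j c p r ∙ ≡⇒≐ (cong bit (maj-comm i j c)) ∙ sy (carry-snoc j i c (sy p) r′))
    where
    xor-comm : ∀ i j c → xor₃ᵇ i j c ≡ xor₃ᵇ j i c
    xor-comm false false c     = refl
    xor-comm true  true  c     = refl
    xor-comm false true  c     = refl
    xor-comm true  false c     = refl

    maj-comm : ∀ i j c → majᵇ i j c ≡ majᵇ j i c
    maj-comm false false c = refl
    maj-comm true  true  c = refl
    maj-comm false true  c = refl
    maj-comm true  false c = refl

⊞-comm : Γ ⊢ u ~ v → Γ ⊢ u ⊞ v ≐ v ⊞ u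
⊞-comm p = fst (⊞-comm-carry p)

⊞-zr-carry : ∀ u → Γ ⊢ u ⊞ zr u ≐ u ∧ carry ⟨ u , zr u ⟩ ≐ 𝟎
⊞-zr-carry u = indʳ (var 0 ⊞ zr (var 0) ≐ var 0 ∧ carry ⟨ var 0 , zr (var 0) ⟩ ≐ 𝟎) (u ◂ var)
  (pair ⊞-ε carry-ε)
  λ { false → pair (step false) (cong2 carry rfl (zr-snoc false) ∙ carry-snoc false false false (sy (one-zr _)) (snd hyp₀))
    ; true  → pair (step true) (cong2 carry rfl (zr-snoc true) ∙ carry-snoc true false false (sy (one-zr _)) (snd hyp₀)) }
  where
  xorʳ : ∀ i → xor₃ᵇ i false false ≡ i
  xorʳ false = refl
  xorʳ true  = refl

  step : ∀ i → _ ⊢ var 0 · bit i ⊞ zr (var 0 · bit i) ≐ var 0 · bit i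
  step i = ⊞≐ rfl (zr-snoc i) ∙ ⊞-snoc i false false (sy (one-zr _)) (snd hyp₀) ∙
           fst hyp₀ ·≐ ≡⇒≐ (cong bit (xorʳ i))

⊞-zr : Γ ⊢ u ~ v → Γ ⊢ u ⊞ zr v ≐ u
⊞-zr p = ⊞≐ rfl (sy (zr-~ p)) ∙ fst (⊞-zr-carry _)

zr-⊞ : Γ ⊢ u ~ v → Γ ⊢ zr v ⊞ u ≐ u
zr-⊞ p = ⊞-comm (one-zr _ ∙ sy p) ∙ ⊞-zr p

-- Carry-save addition: u + v + w = sum u v w + shift (major u v w).  In the induction,
-- carry (u , v) + carry (u + v , w) equals the bit shifted out plus the carry of the last
-- addition; both sums of two bits are compared through their two digits.

sum₃ major : Fun 3
sum₃  = bitwise xor₃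
major = bitwise maj

-- Doubling modulo 2 ^ |x|; the digit shifted out is `lb x`.
shift : Fun 1
shift = ƛ 1 λ x → (𝟎 · x) ◁ 𝟏

shift-snoc : ∀ i c → Γ ⊢ lb x ≐ bit c → Γ ⊢ shift ⟨ x · bit i ⟩ ≐ shift ⟨ x ⟩ · bit c
shift-snoc {x = x} i c p = β _ ∙ ·-snoc i ◁≐ rfl ∙ ◁snoc true i ∙ snocCase x
  (rfl ·≐ hyp ∙ ax ·-ε ∙ sy (ε· 𝟎) ∙
    (sy (◁snoc true false) ∙ (ε· _ ∙ sy (ax ·-ε)) ◁≐ rfl ∙ (rfl ·≐ sy hyp) ◁≐ rfl) ·≐ (sy lb-ε ∙ lb-≐ (sy hyp)) ∙
    sy (β _) ·≐ wk p)
  (λ j → rfl ·≐ hyp ∙ ·-snoc j ∙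
    (sy (◁snoc true j) ∙ sy (·-snoc j) ◁≐ rfl ∙ (rfl ·≐ sy hyp) ◁≐ rfl) ·≐ (sy (lb-snoc _ j) ∙ lb-≐ (sy hyp)) ∙
    sy (β _) ·≐ wk p)

shift~ : ∀ x → Γ ⊢ shift ⟨ x ⟩ ~ x
shift~ x = indʳ (shift ⟨ var 0 ⟩ ~ var 0) (x ◂ var)
  (~refl (β _ ∙ ax ·-ε ◁≐ rfl ∙ short false))
  (λ i → onBit (lb-Bit (var 0)) λ c → ~refl (shift-snoc i c hyp) ∙ ~snoc c i (wk hyp₀))

infix 6 _≗_

_≗_ : Term ℕ × Term ℕ → Term ℕ × Term ℕ → Formula
(a , b) ≗ (c , d) = xorB ⟨ a , b ⟩ ≐ xorB ⟨ c , d ⟩ ∧ andB ⟨ a , b ⟩ ≐ andB ⟨ c , d ⟩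

CSA : Term ℕ → Term ℕ → Term ℕ → Formula
CSA u v w =
  let s = sum₃ ⟨ u , v , w ⟩
      m = major ⟨ u , v , w ⟩ in
  u ⊞ v ⊞ w ≐ s ⊞ shift ⟨ m ⟩ ∧
  (carry ⟨ u , v ⟩ , carry ⟨ u ⊞ v , w ⟩) ≗ (lb m , carry ⟨ s , shift ⟨ m ⟩ ⟩)

eqᵇ : Bool → Bool → Bool
eqᵇ a b = Bool.not (a Bool.xor b)

eqᵇ⇒≡ : ∀ a b → eqᵇ a b ≡ true → a ≡ b
eqᵇ⇒≡ false false _ = refl
eqᵇ⇒≡ true  true  _ = refl

eqᵇ-refl : ∀ a → eqᵇ a a ≡ true
eqᵇ-refl false = refl
eqᵇ-refl true  = refl

-- Both sides add `i + j + k` to two incoming carries of equal sum. The parity of the total is the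
-- output digit, and the other half of it is the sum of the two outgoing carries. As a statement
-- about seven Booleans this is settled by its truth table.
csaᵇ : ∀ i j k a b c d → a Bool.xor b ≡ c Bool.xor d → a Bool.∧ b ≡ c Bool.∧ d →
  let p = xor₃ᵇ i j a ; q = xor₃ᵇ i j k
      a′ = majᵇ i j a ; b′ = majᵇ p k b ; c′ = majᵇ i j k ; d′ = majᵇ q c d in
  xor₃ᵇ p k b ≡ xor₃ᵇ q c d × a′ Bool.xor b′ ≡ c′ Bool.xor d′ × a′ Bool.∧ b′ ≡ c′ Bool.∧ d′
csaᵇ i j k a b c d e₁ e₂ =
  let t = valid 7 {λ i j k a b c d →
            let p = xor₃ᵇ i j a ; q = xor₃ᵇ i j k
                a′ = majᵇ i j a ; b′ = majᵇ p k b ; c′ = majᵇ i j k ; d′ = majᵇ q c d in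
            eqᵇ (a Bool.xor b) (c Bool.xor d) ⊃ eqᵇ (a Bool.∧ b) (c Bool.∧ d) ⊃
            (eqᵇ (xor₃ᵇ p k b) (xor₃ᵇ q c d) Bool.∧
             (eqᵇ (a′ Bool.xor b′) (c′ Bool.xor d′) Bool.∧ eqᵇ (a′ Bool.∧ b′) (c′ Bool.∧ d′)))}
            refl i j k a b c d
      p = xor₃ᵇ i j a ; q = xor₃ᵇ i j k
      a′ = majᵇ i j a ; b′ = majᵇ p k b ; c′ = majᵇ i j k ; d′ = majᵇ q c d
      r₁ , r₂ = ∧-true {eqᵇ (xor₃ᵇ p k b) (xor₃ᵇ q c d)} (detach (detach t (eq e₁)) (eq e₂))
      r₃ , r₄ = ∧-true {eqᵇ (a′ Bool.xor b′) (c′ Bool.xor d′)} r₂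
  in eqᵇ⇒≡ _ _ r₁ , eqᵇ⇒≡ _ _ r₃ , eqᵇ⇒≡ _ _ r₄
  where
  detach : ∀ {a b} → (a ⊃ b) ≡ true → a ≡ true → b ≡ true
  detach p refl = p
  eq : ∀ {a b} → a ≡ b → eqᵇ a b ≡ true
  eq {a} refl = eqᵇ-refl a

≗-bit : ∀ i j k l → Γ ⊢ x ≐ bit i → Γ ⊢ y ≐ bit j → Γ ⊢ z ≐ bit k → Γ ⊢ w ≐ bit l →
        Γ ⊢ (x , y) ≗ (z , w) → (i Bool.xor j ≡ k Bool.xor l → i Bool.∧ j ≡ k Bool.∧ l → Γ ⊢ C) → Γ ⊢ C
≗-bit i j k l p q r s h f =
  bit-distinct (sy (xorB-bit i j) ∙ sy (cong2 xorB p q) ∙ fst h ∙ cong2 xorB r s ∙ xorB-bit k l) λ e →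
  bit-distinct (sy (andB-bit i j) ∙ sy (cong2 andB p q) ∙ snd h ∙ cong2 andB r s ∙ andB-bit k l) (f e)

bit-≗ : ∀ i j k l → Γ ⊢ x ≐ bit i → Γ ⊢ y ≐ bit j → Γ ⊢ z ≐ bit k → Γ ⊢ w ≐ bit l →
        i Bool.xor j ≡ k Bool.xor l → i Bool.∧ j ≡ k Bool.∧ l → Γ ⊢ (x , y) ≗ (z , w)
bit-≗ i j k l p q r s e₁ e₂ =
  pair (cong2 xorB p q ∙ xorB-bit i j ∙ ≡⇒≐ (cong bit e₁) ∙ sy (cong2 xorB r s ∙ xorB-bit k l))
       (cong2 andB p q ∙ andB-bit i j ∙ ≡⇒≐ (cong bit e₂) ∙ sy (cong2 andB r s ∙ andB-bit k l))

csa-step : ∀ i j k a b c d → Γ ⊢ u ~ v → Γ ⊢ u ~ w → Γ ⊢ CSA u v w →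
  let s = sum₃ ⟨ u , v , w ⟩
      m = major ⟨ u , v , w ⟩ in
  Γ ⊢ carry ⟨ u , v ⟩ ≐ bit a → Γ ⊢ carry ⟨ u ⊞ v , w ⟩ ≐ bit b →
  Γ ⊢ lb m ≐ bit c → Γ ⊢ carry ⟨ s , shift ⟨ m ⟩ ⟩ ≐ bit d →
  Γ ⊢ CSA (u · bit i) (v · bit j) (w · bit k)
csa-step i j k a b c d l₁ l₂ h pa pb pc pd = ≗-bit a b c d pa pb pc pd (snd h) λ e₁ e₂ →
  let o , f₁ , f₂ = csaᵇ i j k a b c d e₁ e₂
      uv = ⊞-snoc i j a l₁ pa
      s  = bitwise-snoc xor₃-bit i j k l₁ l₂
      m  = bitwise-snoc maj-bit i j k l₁ l₂
      sm = cong1 shift m ∙ shift-snoc _ c pc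
      l₃ = ⊞~ _ _ ∙ l₂
      l₄ = bitwise~ xor₃ _ _ _ ∙ sy (shift~ _ ∙ bitwise~ maj _ _ _) in
  pair (⊞≐ uv rfl ∙ ⊞-snoc _ k b l₃ pb ∙ fst h ·≐ ≡⇒≐ (cong bit o) ∙
        sy (⊞≐ s sm ∙ ⊞-snoc _ c d l₄ pd))
       (bit-≗ _ _ _ _ (carry-snoc i j a l₁ pa) (cong2 carry uv rfl ∙ carry-snoc _ k b l₃ pb)
                      (lb-≐ m ∙ lb-snoc _ _) (cong2 carry s sm ∙ carry-snoc _ c d l₄ pd) f₁ f₂)

csa : Γ ⊢ u ~ v → Γ ⊢ u ~ w → Γ ⊢ CSA u v w
csa {u = u} {v = v} {w = w} = ind₃ (CSA (var 0) (var 1) (var 2))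
  (pair (⊞≐ ⊞-ε rfl ∙ ⊞-ε ∙ sy (⊞≐ (bitwise-ε xor₃) rfl ∙ ⊞-ε))
        (bit-≗ false false false false carry-ε (cong2 carry ⊞-ε rfl ∙ carry-ε)
          (lb-≐ (bitwise-ε maj) ∙ lb-ε) (cong2 carry (bitwise-ε xor₃) rfl ∙ carry-ε) refl refl))
  (λ i j k → onBit (carry-Bit _ _) λ a → onBit (carry-Bit _ _) λ b → onBit (lb-Bit _) λ c → onBit (carry-Bit _ _) λ d →
     csa-step i j k a b c d (up (fst (fst hyp₀))) (up (snd (fst hyp₀))) (up (snd hyp₀))
       (wk (wk hyp¹)) (wk hyp¹) hyp¹ hyp)
  (u ◂ v ◂ w ◂ var)
  where
  up : ∀ {A₁ A₂ A₃ A₄} → Γ ⊢ A → (((Γ ∧ A₁) ∧ A₂) ∧ A₃) ∧ A₄ ⊢ A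
  up p = wk (wk (wk (wk p)))

bitwise-rotate : ∀ {f φ} → Table f φ → (∀ i j k → φ i j k ≡ φ j k i) → Γ ⊢ u ~ v → Γ ⊢ u ~ w →
                 Γ ⊢ bitwise f ⟨ u , v , w ⟩ ≐ bitwise f ⟨ v , w , u ⟩
bitwise-rotate {u = u} {v = v} {w = w} {f = f} T r =
  ind₃ (bitwise f ⟨ var 0 , var 1 , var 2 ⟩ ≐ bitwise f ⟨ var 1 , var 2 , var 0 ⟩)
    (bitwise-ε f ∙ sy (bitwise-ε f))
    (λ i j k → let p = fst (fst hyp₀) ; q = snd (fst hyp₀) in
       bitwise-snoc T i j k p q ∙ snd hyp₀ ·≐ ≡⇒≐ (cong bit (r i j k)) ∙
       sy (bitwise-snoc T j k i (sy p ∙ q) (sy p)))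
    (u ◂ v ◂ w ◂ var)

-- The carry-save form does not change when `u`, `v`, `w` are rotated, because `xor₃` and `maj` do
-- not; rotation turns `(u ⊞ v) ⊞ w` into `(v ⊞ w) ⊞ u`, and commutativity does the rest.
⊞-assoc : Γ ⊢ u ~ v → Γ ⊢ u ~ w → Γ ⊢ u ⊞ v ⊞ w ≐ u ⊞ (v ⊞ w)
⊞-assoc p q =
  fst (csa p q) ∙
  ⊞≐ (bitwise-rotate xor₃-bit xor-rotate p q) (cong1 shift (bitwise-rotate maj-bit maj-rotate p q)) ∙
  sy (fst (csa (sy p ∙ q) (sy p))) ∙ ⊞-comm (⊞~ _ _ ∙ sy p)
  where
  xor-rotate : ∀ i j k → xor₃ᵇ i j k ≡ xor₃ᵇ j k i
  xor-rotate i j k = eqᵇ⇒≡ _ _ (valid 3 {λ i j k → eqᵇ (xor₃ᵇ i j k) (xor₃ᵇ j k i)} refl i j k)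

  maj-rotate : ∀ i j k → majᵇ i j k ≡ majᵇ j k i
  maj-rotate i j k = eqᵇ⇒≡ _ _ (valid 3 {λ i j k → eqᵇ (majᵇ i j k) (majᵇ j k i)} refl i j k)

-- Cancellation, sums without overflow, padding by zeros

⊞-cancel : Γ ⊢ u ~ v → Γ ⊢ u ⊞ v ≐ u → Γ ⊢ zr v ≐ v
⊞-cancel {u = u} {v = v} p q = fst (ind₃ (G (var 0) (var 1))
  (intro (pair (ax zero-ε) carry-ε))
  (λ i j k → intro (onBit (carry-Bit (var 0) (var 1)) λ c →
    step i j c (wk (wk (fst (fst hyp₀)))) (wk (wk (snd hyp₀))) hyp¹ hyp))
  (u ◂ v ◂ u ◂ var) p rfl $ q)
  where
  -- The carry is included because it drives the induction: with incoming carry 0, an output digit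
  -- equal to `i` forces `j` to be 0, and then no carry arises.
  G : Term ℕ → Term ℕ → Formula
  G u v = u ⊞ v ≐ u ⇒ zr v ≐ v ∧ carry ⟨ u , v ⟩ ≐ 𝟎

  last : ∀ {Γ u v} i j c → Γ ⊢ zr v ≐ v → Γ ⊢ carry ⟨ u , v ⟩ ≐ bit c → Γ ⊢ u ~ v →
         c ≡ false → xor₃ᵇ i j c ≡ i →
         Γ ⊢ zr (v · bit j) ≐ v · bit j ∧ carry ⟨ u · bit i , v · bit j ⟩ ≐ 𝟎
  last false true  c z e p refl ()
  last true  true  c z e p refl ()
  last false false c z e p refl _ = pair (zr-snoc false ∙ z ·ₗ _) (carry-snoc false false false p e)
  last true  false c z e p refl _ = pair (zr-snoc false ∙ z ·ₗ _) (carry-snoc true false false p e)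

  step : ∀ {Γ u v} i j c → Γ ⊢ u ~ v → Γ ⊢ G u v → Γ ⊢ u · bit i ⊞ v · bit j ≐ u · bit i →
         Γ ⊢ carry ⟨ u , v ⟩ ≐ bit c →
         Γ ⊢ zr (v · bit j) ≐ v · bit j ∧ carry ⟨ u · bit i , v · bit j ⟩ ≐ 𝟎
  step i j c p h q e =
    let r = sy (⊞-snoc i j c p e) ∙ q
        h′ = h $ snoc-injˡ (xor₃ᵇ i j c) i r in
    bit-distinct {i = c} {j = false} (sy e ∙ snd h′) λ c≡0 →
    bit-distinct (snoc-injʳ (xor₃ᵇ i j c) i r) λ o≡i → last i j c (fst h′) e p c≡0 o≡i

-- Without a carry out the sum is exact, so it vanishes only with its summands: an output digit 0
-- together with an outgoing carry 0 forces both the digit of `u` and the incoming carry to be 0.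
⊞-zero : Γ ⊢ u ~ v → Γ ⊢ u ⊞ v ≐ zr u → Γ ⊢ carry ⟨ u , v ⟩ ≐ 𝟎 → Γ ⊢ zr u ≐ u
⊞-zero {u = u} {v = v} p q r = ind₃ (G (var 0) (var 1))
  (intro (ax zero-ε))
  (λ i j k → intro (onBit (carry-Bit (var 0) (var 1)) λ c →
    step i j c (wk (wk (fst (fst hyp₀)))) (wk (wk (snd hyp₀))) hyp¹ hyp))
  (u ◂ v ◂ u ◂ var) p rfl $ pair q r
  where
  G : Term ℕ → Term ℕ → Formula
  G u v = u ⊞ v ≐ zr u ∧ carry ⟨ u , v ⟩ ≐ 𝟎 ⇒ zr u ≐ u

  last : ∀ i j c → xor₃ᵇ i j c ≡ false → majᵇ i j c ≡ false → i ≡ false × c ≡ false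
  last false false false _ _ = refl , refl
  last true  true  false _ ()
  last true  false true  _ ()
  last false true  true  _ ()
  last true  true  true  ()
  last false true  false ()

  step : ∀ {Γ u v} i j c → Γ ⊢ u ~ v → Γ ⊢ G u v →
         Γ ⊢ u · bit i ⊞ v · bit j ≐ zr (u · bit i) ∧ carry ⟨ u · bit i , v · bit j ⟩ ≐ 𝟎 →
         Γ ⊢ carry ⟨ u , v ⟩ ≐ bit c → Γ ⊢ zr (u · bit i) ≐ u · bit i
  step i j c p h q e =
    let r = sy (⊞-snoc i j c p e) ∙ fst q ∙ zr-snoc i in
    bit-distinct {i = xor₃ᵇ i j c} {j = false} (snoc-injʳ (xor₃ᵇ i j c) false r) λ o≡0 →
    bit-distinct {i = majᵇ i j c} {j = false} (sy (carry-snoc i j c p e) ∙ snd q) λ m≡0 →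
    let i≡0 , c≡0 = last i j c o≡0 m≡0 in
    zr-snoc i ∙ (h $ pair (snoc-injˡ (xor₃ᵇ i j c) false r) (e ∙ ≡⇒≐ (cong bit c≡0))) ·≐
    ≡⇒≐ (cong bit (sym i≡0))

⊞-pad : ∀ t → Γ ⊢ u ~ v → Γ ⊢ carry ⟨ u , v ⟩ ≐ 𝟎 →
        Γ ⊢ u · zr t ⊞ v · zr t ≐ (u ⊞ v) · zr t
⊞-pad {u = u} {v = v} t p q = fst (indʳ (G (var 0) (var 1) (var 2)) (t ◂ u ◂ v ◂ var)
  (intro (pair (⊞≐ (unit _) (unit _) ∙ sy (unit _)) (cong2 carry (unit _) (unit _) ∙ snd hyp)))
  (λ i → intro (step i (fst hyp) (wk hyp₀ $ hyp))) $ pair p q)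
  where
  H G : Term ℕ → Term ℕ → Term ℕ → Formula
  H t u v = u · zr t ⊞ v · zr t ≐ (u ⊞ v) · zr t ∧ carry ⟨ u · zr t , v · zr t ⟩ ≐ 𝟎
  G t u v = u ~ v ∧ carry ⟨ u , v ⟩ ≐ 𝟎 ⇒ H t u v

  unit : ∀ x → Γ ⊢ x · zr ε ≐ x
  unit x = rfl ·≐ ax zero-ε ∙ ax ·-ε

  step : ∀ {Γ t u v} i → Γ ⊢ u ~ v → Γ ⊢ H t u v → Γ ⊢ H (t · bit i) u v
  step {t = t} {u} {v} i p h =
    pair (⊞≐ (re u) (re v) ∙ ⊞-snoc false false false (~· p rfl) (snd h) ∙ fst h ·ₗ _ ∙ sy (re _))
         (cong2 carry (re u) (re v) ∙ carry-snoc false false false (~· p rfl) (snd h))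
    where
    re : ∀ x → _ ⊢ x · zr (t · bit i) ≐ (x · zr t) · 𝟎
    re x = rfl ·≐ zr-snoc i ∙ ·-snoc false

-- The number of ones of a string, modulo 2 ^ |W|

-- A pair of numbers u, v of width |W| is coded by u · v and stands for u + v; adding two
-- pairs by carry-save addition needs no carry propagation, so nodePair has rank 0.
leafPair : Fun 2
leafPair = ƛ 2 λ (x , W) → (x · zeroˢ ⟨ x ▷ W ⟩) · zeroˢ ⟨ W ⟩

nodePair : Fun 4
nodePair = ƛ 4 λ (x , W , r , s) →
  -- `r` and `s` code four numbers. One carry-save step reduces three of them to `a` and `b`, a
  -- second one reduces `a`, `b` and the fourth, `v`, to two.
  let v = W ▷ s
      a = sum₃ ⟨ take W r , W ▷ r , take W s ⟩
      b = shift ⟨ major ⟨ take W r , W ▷ r , take W s ⟩ ⟩ in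
  sum₃ ⟨ a , b , v ⟩ · shift ⟨ major ⟨ a , b , v ⟩ ⟩

onesPair : Fun 2
onesPair = STRN leafPair nodePair refl

value : ∀ {V} → Term V → Term V → Term V
value W r = take W r ⊞ (W ▷ r)

value-≐ : Γ ⊢ x ≐ y → Γ ⊢ value w x ≐ value w y
value-≐ p = ⊞≐ (p ◁≐ (rfl ▷≐ p)) (rfl ▷≐ p)

take-· : Γ ⊢ w ~ x → Γ ⊢ take w (x · y) ≐ x
take-· p = rfl ◁≐ ~▷ p ∙ ◁-cancel _ _

value-· : Γ ⊢ w ~ x → Γ ⊢ value w (x · y) ≐ x ⊞ y
value-· p = ⊞≐ (take-· p) (~▷ p)

-- The width is given as 1 · w, so that it is positive.
width : ∀ {V} → Term V → Term V
width w = 𝟏 · w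

unit : Term ℕ → Bool → Term ℕ
unit w i = bit i · zr w

onesP : ∀ {V} → Term V → Term V → Term V
onesP w x = onesPair ⟨ x , width w ⟩

count : Fun 2
count = ƛ 2 λ (w , x) → value (width w) (onesP w x)

ones : Term ℕ → Term ℕ → Term ℕ
ones w x = count ⟨ w , x ⟩

ones-≐ : Γ ⊢ x ≐ y → Γ ⊢ ones w x ≐ ones w y
ones-≐ = cong2 count rfl

unit~ : ∀ i → Γ ⊢ width w ~ unit w i
unit~ i = one-cons true _ ∙ _ ·ᵣ sy (one-zr _) ∙ sy (one-cons i _)

onesP-leaf : Γ ⊢ x ◁ 𝟏 ≐ ε → Γ ⊢ onesP w x ≐ (x · zr (x ▷ width w)) · zr (width w)
onesP-leaf q = STRN₂ leafPair nodePair refl _ _ ∙ cong4 cond q rfl rfl rfl ∙ ax cond-ε ∙ β _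

onesP-node : ∀ i → Γ ⊢ x ◁ 𝟏 ≐ y · bit i →
  Γ ⊢ onesP w x ≐ nodePair ⟨ x , width w , onesP w (lh ⟨ x ⟩) , onesP w (rh ⟨ x ⟩) ⟩
onesP-node i q = STRN₂ leafPair nodePair refl _ _ ∙ cong4 cond q rfl rfl rfl ∙ cond-same _ i

onesP-ε : Γ ⊢ x ≐ ε → Γ ⊢ onesP w x ≐ zr (width w) · zr (width w)
onesP-ε p = onesP-leaf (p ◁≐ rfl ∙ ε◁ 𝟏) ∙ (p ·≐ cong1 zeroˢ (p ▷≐ rfl ∙ ax ε▷) ∙ ε· _) ·≐ rfl

onesP-bit : ∀ i → Γ ⊢ x ≐ bit i → Γ ⊢ onesP w x ≐ unit w i · zr (width w)
onesP-bit i p = onesP-leaf (p ◁≐ rfl ∙ short i) ∙ (p ·≐ cong1 zeroˢ (p ▷≐ rfl ∙ ▷cons i true)) ·≐ rfl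

Pair~ : Term ℕ → Term ℕ → Formula
Pair~ W r = take W r ~ W ∧ W ▷ r ~ W

Pair~-· : Γ ⊢ x ≐ y · z → Γ ⊢ w ~ y → Γ ⊢ w ~ z → Γ ⊢ Pair~ w x
Pair~-· p q r = pair (~refl (rfl ◁≐ (rfl ▷≐ p) ∙ p ◁≐ rfl ∙ take-· q) ∙ sy q)
                     (~refl (rfl ▷≐ p ∙ ~▷ q) ∙ sy r)

onesP~ : ∀ w x → Γ ⊢ Pair~ (width w) (onesP w x)
onesP~ w x = indᵗ (P (var 1) (var 0)) (x ◂ w ◂ var) (at-ε rfl) (λ i → at-bit i rfl)
  (leafCase (var 0) (at-ε hyp) (λ i → at-bit i hyp)
    (λ i → at-node i hyp (wk (fst hyp₀))))
  where
  P : Term ℕ → Term ℕ → Formula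
  P w x = Pair~ (width w) (onesP w x)

  at-ε : ∀ {Γ w x} → Γ ⊢ x ≐ ε → Γ ⊢ P w x
  at-ε p = Pair~-· (onesP-ε p) (sy (one-zr _)) (sy (one-zr _))

  at-bit : ∀ {Γ w x} i → Γ ⊢ x ≐ bit i → Γ ⊢ P w x
  at-bit i p = Pair~-· (onesP-bit i p) (unit~ i) (sy (one-zr _))

  at-node : ∀ {Γ w x y} i → Γ ⊢ x ◁ 𝟏 ≐ y · bit i → Γ ⊢ P w (lh ⟨ x ⟩) → Γ ⊢ P w x
  at-node i p q = Pair~-· (onesP-node i p ∙ β _)
    (sy (bitwise~ xor₃ _ _ _ ∙ bitwise~ xor₃ _ _ _ ∙ fst q))
    (sy (shift~ _ ∙ bitwise~ maj _ _ _ ∙ bitwise~ xor₃ _ _ _ ∙ fst q))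

ones~ : ∀ w x → Γ ⊢ ones w x ~ width w
ones~ w x = ~refl (β _) ∙ ⊞~ _ _ ∙ fst (onesP~ w x)

ones-ε : ∀ w → Γ ⊢ ones w ε ≐ zr (width w)
ones-ε w = β _ ∙ value-≐ (onesP-ε rfl) ∙ value-· (sy (one-zr _)) ∙ ⊞-zr (one-zr _)

ones-bit : ∀ w i → Γ ⊢ ones w (bit i) ≐ unit w i
ones-bit w i = β _ ∙ value-≐ (onesP-bit i rfl) ∙ value-· (unit~ i) ∙ ⊞-zr (sy (unit~ i))

-- Undoing the two carry-save steps by `csa` gives the sum of the four coded numbers, associated to
-- the left; regrouped as two plus two, it consists of the values of the two halves.
ones-node : ∀ i → Γ ⊢ x ◁ 𝟏 ≐ y · bit i → Γ ⊢ ones w x ≐ ones w (lh ⟨ x ⟩) ⊞ ones w (rh ⟨ x ⟩)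
ones-node {w = w} i p =
  β _ ∙ value-≐ (onesP-node i p ∙ β _) ∙
  value-· (sy (bitwise~ xor₃ _ _ _ ∙ bitwise~ xor₃ _ _ _ ∙ fst L)) ∙
  sy (fst (csa (bitwise~ xor₃ _ _ _ ∙ fst L ∙ sy (fst L) ∙ sy (bitwise~ maj _ _ _) ∙ sy (shift~ _))
               (bitwise~ xor₃ _ _ _ ∙ fst L ∙ sy (snd R)))) ∙
  ⊞≐ (sy (fst (csa (fst L ∙ sy (snd L)) (fst L ∙ sy (fst R))))) rfl ∙
  ⊞-assoc (⊞~ _ _ ∙ fst L ∙ sy (fst R)) (⊞~ _ _ ∙ fst L ∙ sy (snd R)) ∙
  ⊞≐ (sy (β _)) (sy (β _))
  where
  L = onesP~ w _
  R = onesP~ w _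

ones-⊞-ε : ∀ w x → Γ ⊢ ones w x ⊞ ones w ε ≐ ones w x
ones-⊞-ε w x = ⊞≐ rfl (ones-ε w) ∙ ⊞-zr (ones~ w x)

ones-ε-⊞ : ∀ w x → Γ ⊢ ones w ε ⊞ ones w x ≐ ones w x
ones-ε-⊞ w x = ⊞≐ (ones-ε w) rfl ∙ zr-⊞ (ones~ w x)

halves-bit : ∀ i → Γ ⊢ x ≐ bit i → Γ ⊢ lh ⟨ x ⟩ ≐ ε ∧ rh ⟨ x ⟩ ≐ bit i
halves-bit i p = cases (ax ·-≐bit $ (ax lh·rh ∙ p)) hyp
  (absurd (sy (ax ◁ε) ∙ sy (fst hyp) ◁≐ sy (snd hyp) ∙ ax lh◁rh) (bit≠ε i))

-- This extends `ones-node` to the leaves, where the recursion does not split: there the left half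
-- is empty and counts as zero.
ones-halves : ∀ w x → Γ ⊢ ones w x ≐ ones w (lh ⟨ x ⟩) ⊞ ones w (rh ⟨ x ⟩)
ones-halves w x = leafCase x
  (let e = ax lh·rh ∙ hyp in
   ones-≐ hyp ∙ sy (ones-ε-⊞ w ε) ∙ sy (⊞≐ (ones-≐ (fst (ax ·-≐ε $ e))) (ones-≐ (snd (ax ·-≐ε $ e)))))
  (λ i → let h = halves-bit i hyp in
   ones-≐ (hyp ∙ sy (snd h)) ∙ sy (ones-ε-⊞ w _) ∙ ⊞≐ (ones-≐ (sy (fst h))) rfl)
  (λ i → ones-node i hyp)

-- Halves

cons~snoc : ∀ i j x → Γ ⊢ bit i · x ~ x · bit j
cons~snoc i j x = one-cons i x ∙ indʳ (𝟏 · one (var 0) ≐ one (var 0) · 𝟏) (x ◂ var)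
  (rfl ·≐ ax one-ε ∙ ax ·-ε ∙ sy (ε· _) ∙ sy (ax one-ε) ·≐ rfl)
  (λ k → rfl ·≐ one-snoc k ∙ ·-snoc true ∙ hyp₀ ·≐ rfl ∙ sy (one-snoc k) ·≐ rfl) ∙ sy (one-snoc j)

-- gap x is ε exactly when |x| is even.
gap : Term ℕ → Term ℕ
gap x = lh ⟨ x ⟩ ▷ rh ⟨ x ⟩

E-ε : Γ ⊢ gap x ≐ ε → Γ ⊢ E x y z ≐ y
E-ε p = cong4 cond p rfl rfl rfl ∙ ax cond-ε

E-snoc : ∀ i → Γ ⊢ gap x ≐ w · bit i → Γ ⊢ E x y z ≐ z
E-snoc i p = cong4 cond p rfl rfl rfl ∙ cond-same _ i

lh-snoc-even : ∀ i → Γ ⊢ gap x ≐ ε → Γ ⊢ lh ⟨ x · bit i ⟩ ≐ lh ⟨ x ⟩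
lh-snoc-even i p = ax lh-bitʳ ∙ E-ε p

rh-snoc-even : ∀ i → Γ ⊢ gap x ≐ ε → Γ ⊢ rh ⟨ x · bit i ⟩ ≐ rh ⟨ x ⟩ · bit i
rh-snoc-even i p = ax rh-bitʳ ∙ E-ε p

lh-snoc-odd : ∀ i j k → Γ ⊢ gap x ≐ w · bit k → Γ ⊢ rh ⟨ x ⟩ ≐ bit j · y →
              Γ ⊢ lh ⟨ x · bit i ⟩ ≐ lh ⟨ x ⟩ · bit j
lh-snoc-odd i j k p q = ax lh-bitʳ ∙ E-snoc k p ∙
  rfl ·≐ ((q ·≐ rfl ∙ ·-assoc _ _ _) ◁≐ rfl ∙ ~◁ (~refl q ∙ cons~snoc j i _))

rh-snoc-odd : ∀ i j k → Γ ⊢ gap x ≐ w · bit k → Γ ⊢ rh ⟨ x ⟩ ≐ bit j · y →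
              Γ ⊢ rh ⟨ x · bit i ⟩ ≐ y · bit i
rh-snoc-odd i j k p q = ax rh-bitʳ ∙ E-snoc k p ∙
  rfl ▷≐ (q ·≐ rfl ∙ ·-assoc _ _ _) ∙ ▷cons true j

-- Associativity turns the balanced tree of additions into a sequential one.  That the
-- count of x is the sum of those of its halves determines the count of x · i; the middle
-- bit moves from one half to the other, so the induction also covers 𝟏 ▷ x.

ones-assoc : ∀ w x y z → Γ ⊢ ones w x ⊞ ones w y ⊞ ones w z ≐ ones w x ⊞ (ones w y ⊞ ones w z)
ones-assoc w x y z = ⊞-assoc (ones~ w x ∙ sy (ones~ w y)) (ones~ w x ∙ sy (ones~ w z))

ones-assoc₄ : ∀ w x y z t → Γ ⊢ (ones w x ⊞ ones w y) ⊞ (ones w z ⊞ ones w t) ≐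
                                (ones w x ⊞ (ones w y ⊞ ones w z)) ⊞ ones w t
ones-assoc₄ w x y z t =
  sy (⊞-assoc (⊞~ _ _ ∙ ones~ w x ∙ sy (ones~ w z)) (⊞~ _ _ ∙ ones~ w x ∙ sy (ones~ w t))) ∙
  ⊞≐ (ones-assoc w x y z) rfl

Snoc : Term ℕ → Term ℕ → Bool → Formula
Snoc w x i = ones w (x · bit i) ≐ ones w x ⊞ ones w (bit i)

-- The term `x ◁ (𝟏 ▷ x)` is the first bit of `x`, or `ε` if `x` is empty, so `Uncons` makes sense
-- for every `x`.
Snocs Uncons Seq : Term ℕ → Term ℕ → Formula
Snocs w x  = Snoc w x false ∧ Snoc w x true
Uncons w x = ones w x ≐ ones w (x ◁ (𝟏 ▷ x)) ⊞ ones w (𝟏 ▷ x)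
Seq w x    = Snocs w x ∧ (Snocs w (𝟏 ▷ x) ∧ Uncons w x)

snoc-at : ∀ i → Γ ⊢ Snocs w x → Γ ⊢ Snoc w x i
snoc-at false p = fst p
snoc-at true  p = snd p

snocs : (∀ i → Γ ⊢ Snoc w x i) → Γ ⊢ Snocs w x
snocs f = pair (f false) (f true)

Snoc-≐ : ∀ i → Γ ⊢ x ≐ y → Γ ⊢ Snoc w x i → Γ ⊢ Snoc w y i
Snoc-≐ i p q = ones-≐ (sy p ·≐ rfl) ∙ q ∙ ⊞≐ (ones-≐ p) rfl

uncons-at : ∀ i → Γ ⊢ x ≐ bit i · y → Γ ⊢ Uncons w x → Γ ⊢ ones w (bit i · y) ≐ ones w (bit i) ⊞ ones w y
uncons-at i p q =
  let t = rfl ▷≐ p ∙ ▷cons true i in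
  ones-≐ (sy p) ∙ q ∙ ⊞≐ (ones-≐ (p ◁≐ t ∙ ◁-cancel _ _)) (ones-≐ t)

uncons : ∀ i → Γ ⊢ x ≐ bit i · y → Γ ⊢ ones w (bit i · y) ≐ ones w (bit i) ⊞ ones w y → Γ ⊢ Uncons w x
uncons i p q =
  let t = rfl ▷≐ p ∙ ▷cons true i in
  ones-≐ p ∙ q ∙ ⊞≐ (ones-≐ (sy (p ◁≐ t ∙ ◁-cancel _ _))) (ones-≐ (sy t))

Snoc-ε : ∀ i → Γ ⊢ x ≐ ε → Γ ⊢ Snoc w x i
Snoc-ε {w = w} i p = Snoc-≐ i (sy p) (ones-≐ (ε· _) ∙ sy (ones-ε-⊞ w _))

snoc-even : ∀ i → Γ ⊢ gap x ≐ ε → Γ ⊢ Snoc w (rh ⟨ x ⟩) i → Γ ⊢ Snoc w x i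
snoc-even {x = x} {w = w} i g p =
  ones-halves w _ ∙ ⊞≐ (ones-≐ (lh-snoc-even i g)) (ones-≐ (rh-snoc-even i g) ∙ p) ∙
  sy (ones-assoc w _ _ _) ∙ ⊞≐ (sy (ones-halves w x)) rfl

-- At odd length the bit `j` leaves the front of the right half and joins the end of the left one:
-- `Uncons` releases it there, `Snoc` absorbs it here, and associativity moves it across.
snoc-odd : ∀ i j k → Γ ⊢ gap x ≐ y · bit k → Γ ⊢ rh ⟨ x ⟩ ≐ bit j · z →
  Γ ⊢ Snoc w (lh ⟨ x ⟩) j → Γ ⊢ Snoc w (𝟏 ▷ rh ⟨ x ⟩) i → Γ ⊢ Uncons w (rh ⟨ x ⟩) → Γ ⊢ Snoc w x i
snoc-odd {x = x} {w = w} i j k g e p q r =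
  ones-halves w _ ∙
  ⊞≐ (ones-≐ (lh-snoc-odd i j k g e) ∙ p)
     (ones-≐ (rh-snoc-odd i j k g e) ∙ Snoc-≐ i (rfl ▷≐ e ∙ ▷cons true j) q) ∙
  ones-assoc₄ w _ _ _ _ ∙
  ⊞≐ (⊞≐ rfl (sy (uncons-at j e r) ∙ ones-≐ (sy e)) ∙ sy (ones-halves w x)) rfl

snoc-step : ∀ i → Γ ⊢ Snocs w (lh ⟨ x ⟩) → Γ ⊢ Seq w (rh ⟨ x ⟩) → Γ ⊢ Snoc w x i
snoc-step {x = x} i p q = snocCase (gap x)
  (snoc-even i hyp (wk (snoc-at i (fst q))))
  λ k → consCase (rh ⟨ x ⟩)
    (absurd (sy hyp¹ ∙ rfl ▷≐ hyp ∙ ▷ε _) (snoc≠ε _ k))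
    λ j → snoc-odd i j k hyp¹ hyp (wk (wk (snoc-at j p))) (wk (wk (snoc-at i (fst (snd q)))))
                                  (wk (wk (snd (snd q))))

lh-cons-even : ∀ i → Γ ⊢ gap y ≐ ε → Γ ⊢ lh ⟨ bit i · y ⟩ ≐ (bit i · lh ⟨ y ⟩) ◁ 𝟏
lh-cons-even i p = ax lh-bitˡ ∙ E-ε p

rh-cons-even : ∀ i → Γ ⊢ gap y ≐ ε → Γ ⊢ rh ⟨ bit i · y ⟩ ≐ (lh ⟨ y ⟩ ▷ (bit i · lh ⟨ y ⟩)) · rh ⟨ y ⟩
rh-cons-even i p = ax rh-bitˡ ∙ E-ε p

lh-cons-odd : ∀ i k → Γ ⊢ gap y ≐ w · bit k → Γ ⊢ lh ⟨ bit i · y ⟩ ≐ bit i · lh ⟨ y ⟩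
lh-cons-odd i k p = ax lh-bitˡ ∙ E-snoc k p

rh-cons-odd : ∀ i k → Γ ⊢ gap y ≐ w · bit k → Γ ⊢ rh ⟨ bit i · y ⟩ ≐ rh ⟨ y ⟩
rh-cons-odd i k p = ax rh-bitˡ ∙ E-snoc k p

Tail : Term ℕ → Term ℕ → Formula
Tail w x = Snocs w (𝟏 ▷ x) ∧ Uncons w x

tail-≐ : Γ ⊢ x ≐ y → Γ ⊢ Tail w x → Γ ⊢ Tail w y
tail-≐ p q =
  pair (snocs λ i → Snoc-≐ i (rfl ▷≐ p) (snoc-at i (fst q)))
       (ones-≐ (sy p) ∙ snd q ∙ ⊞≐ (ones-≐ (p ◁≐ (rfl ▷≐ p))) (ones-≐ (rfl ▷≐ p)))

tail-intro : ∀ i → Γ ⊢ x ≐ bit i · y → (∀ j → Γ ⊢ Snoc w y j) →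
             Γ ⊢ ones w (bit i · y) ≐ ones w (bit i) ⊞ ones w y → Γ ⊢ Tail w x
tail-intro i p q r = pair (snocs λ j → Snoc-≐ j (sy (rfl ▷≐ p ∙ ▷cons true i)) (q j)) (uncons i p r)

tail-snoc : ∀ i j → Γ ⊢ x ≐ bit i · y → Γ ⊢ Tail w x → Γ ⊢ Snoc w y j
tail-snoc i j p q = Snoc-≐ j (rfl ▷≐ p ∙ ▷cons true i) (snoc-at j (fst q))

tail-uncons : ∀ i → Γ ⊢ x ≐ bit i · y → Γ ⊢ Tail w x → Γ ⊢ ones w (bit i · y) ≐ ones w (bit i) ⊞ ones w y
tail-uncons i p q = uncons-at i p (snd q)

tail-single : ∀ i → Γ ⊢ y ≐ ε → Γ ⊢ Tail w (bit i · y)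
tail-single {w = w} i p = tail-intro i rfl (λ j → Snoc-ε j p)
  (ones-≐ (rfl ·≐ p ∙ ax ·-ε) ∙ sy (ones-⊞-ε w _) ∙ ⊞≐ rfl (ones-≐ (sy p)))

tail-ε : Γ ⊢ x ≐ ε → Γ ⊢ Tail w x
tail-ε {w = w} p =
  pair (snocs λ i → Snoc-ε i e)
       (ones-≐ p ∙ sy (ones-ε-⊞ w ε) ∙ ⊞≐ (ones-≐ (sy (p ◁≐ rfl ∙ ε◁ _))) (ones-≐ (sy e)))
  where e = rfl ▷≐ p ∙ ▷ε 𝟏

tail-odd : ∀ i c → Γ ⊢ gap y ≐ ε → Γ ⊢ lh ⟨ y ⟩ ≐ z · bit c →
  Γ ⊢ lh ⟨ bit i · y ⟩ ≐ bit i · z → Γ ⊢ rh ⟨ bit i · y ⟩ ≐ bit c · rh ⟨ y ⟩ →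
  Γ ⊢ Tail w (lh ⟨ bit i · y ⟩) → Γ ⊢ Tail w (rh ⟨ bit i · y ⟩) → Γ ⊢ Tail w (bit i · y)
tail-odd {y = y} {w = w} i c g e l r p q = tail-intro i rfl (λ j → snoc-even j g (tail-snoc c j r q))
  (ones-halves w _ ∙
   ⊞≐ (ones-≐ l ∙ tail-uncons i l p) (ones-≐ r ∙ tail-uncons c r q) ∙
   ones-assoc₄ w _ _ _ _ ∙
   ⊞≐ (⊞≐ rfl (sy (tail-snoc i c l p) ∙ ones-≐ (sy e))) rfl ∙
   ones-assoc w _ _ _ ∙ ⊞≐ rfl (sy (ones-halves w y)))

tail-even : ∀ i k → Γ ⊢ gap y ≐ z · bit k →
  Γ ⊢ lh ⟨ bit i · y ⟩ ≐ bit i · lh ⟨ y ⟩ → Γ ⊢ rh ⟨ bit i · y ⟩ ≐ rh ⟨ y ⟩ →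
  Γ ⊢ Tail w (lh ⟨ bit i · y ⟩) → Γ ⊢ Tail w (rh ⟨ y ⟩) → Γ ⊢ Tail w (bit i · y)
tail-even {y = y} {w = w} i k g l r p q = tail-intro i rfl
  (λ j → consCase (rh ⟨ y ⟩)
    (absurd (sy (wk g) ∙ rfl ▷≐ hyp ∙ ▷ε _) (snoc≠ε _ k))
    λ c → snoc-odd j c k (wk g) hyp (wk (tail-snoc i c l p)) (wk (snoc-at j (fst q))) (wk (snd q)))
  (ones-halves w _ ∙ ⊞≐ (ones-≐ l ∙ tail-uncons i l p) (ones-≐ r) ∙
   ones-assoc w _ _ _ ∙ ⊞≐ rfl (sy (ones-halves w y)))

-- The hypotheses concern the halves of `bit i · y`, while counts of `y` are wanted. Up to the
-- middle bit, the left half of `y` is that of `bit i · y` without its first bit `i`; this is where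
-- statements about `𝟏 ▷ x` are used.
tail-step : ∀ i → Γ ⊢ Tail w (lh ⟨ bit i · y ⟩) → Γ ⊢ Tail w (rh ⟨ bit i · y ⟩) → Γ ⊢ Tail w (bit i · y)
tail-step {y = y} i p q = snocCase (gap y)
  (snocCase (lh ⟨ y ⟩)
    (tail-single i (sy (ax lh·rh) ∙ hyp ·≐ rfl ∙ ε· _ ∙ sy (ax ε▷) ∙ sy hyp ▷≐ rfl ∙ hyp¹))
    (λ c → tail-odd i c hyp¹ hyp
      (lh-cons-even i hyp¹ ∙ (rfl ·≐ hyp ∙ ·-snoc c) ◁≐ rfl ∙ ◁snoc true c)
      (rh-cons-even i hyp¹ ∙ (rfl ▷≐ (rfl ·≐ hyp ∙ ·-snoc c) ∙
         ~▷ (~refl hyp ∙ sy (cons~snoc i c _))) ·≐ rfl)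
      (wk (wk p)) (wk (wk q))))
  λ k → tail-even i k hyp (lh-cons-odd i k hyp) (rh-cons-odd i k hyp) (wk p)
          (tail-≐ (rh-cons-odd i k hyp) (wk q))

seq-ε : Γ ⊢ x ≐ ε → Γ ⊢ Seq w x
seq-ε p = pair (snocs λ i → Snoc-ε i p) (tail-ε p)

seq-bit : ∀ i → Γ ⊢ x ≐ bit i → Γ ⊢ Seq w x
seq-bit {Γ} {x} {w} i p = pair
  (snocs λ j → snoc-odd j i i (fst halves ▷≐ snd halves ∙ ax ε▷ ∙ sy (ε· _)) (snd halves ∙ sy (ax ·-ε))
                  (Snoc-ε i (fst halves)) (snoc-at j (fst (tail (snd halves)))) (snd (tail (snd halves))))
  (tail p)
  where
  tail : ∀ {x} → Γ ⊢ x ≐ bit i → Γ ⊢ Tail w x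
  tail p = tail-≐ (ax ·-ε ∙ sy p) (tail-single i rfl)

  halves : Γ ⊢ lh ⟨ x ⟩ ≐ ε ∧ rh ⟨ x ⟩ ≐ bit i
  halves = halves-bit i p

seq-step : Γ ⊢ Seq w (lh ⟨ x ⟩) → Γ ⊢ Seq w (rh ⟨ x ⟩) → Γ ⊢ Seq w x
seq-step {x = x} p q = consCase x (seq-ε hyp) λ j →
  pair (snocs λ k → snoc-step k (wk (fst p)) (wk q))
       (tail-≐ (sy hyp) (tail-step j (tail-≐ (cong1 lh hyp) (wk (snd p))) (tail-≐ (cong1 rh hyp) (wk (snd q)))))

ones-snoc : ∀ w x i → Γ ⊢ ones w (x · bit i) ≐ ones w x ⊞ unit w i
ones-snoc w x i = snoc-at i (fst (indᵗ (Seq (var 1) (var 0)) (x ◂ w ◂ var)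
    (seq-ε rfl) (λ j → seq-bit j rfl) (seq-step (fst hyp₀) (snd hyp₀))))
  ∙ ⊞≐ rfl (ones-bit w i)

-- The count of x vanishes from position |x| on

cons▷ : ∀ i → Γ ⊢ (bit i · x) ▷ y ≐ x ▷ (bit i ▷ y)
cons▷ i = ax bit·▷ ∙ sy (▷-bit-comm _ i _)

-- A carry out of the first |x| digits lands in the digit `𝟎` that follows them, and the zeros
-- beyond are not reached.
⊞-high : ∀ i → Γ ⊢ x ~ v → Γ ⊢ x ~ y →
  Γ ⊢ (v · bit i) ▷ ((x · (𝟎 · zr z)) ⊞ (y · (𝟎 · zr z))) ≐ zr z
⊞-high {x = x} {y = y} i p q = onBit (carry-Bit x y) λ c →
  rfl ▷≐ (⊞≐ (sy (·-assoc _ _ _)) (sy (·-assoc _ _ _)) ∙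
          ⊞-pad _ (~snoc false false (wk q)) (carry-snoc false false c (wk q) hyp) ∙
          ⊞-snoc false false c (wk q) hyp ·≐ rfl) ∙
  ~▷ (~snoc i c (sy (⊞~ _ _ ∙ wk p)))

High : Term ℕ → Term ℕ → Formula
High w x = x ▷ ones w x ≐ zr (x ▷ width w)

-- The empty `x` is separate because the digit `bit i` of `unit w i` is at position 0 and so not
-- among the first |x| digits.
high-first : ∀ i → Γ ⊢ x ≐ ε → Γ ⊢ High w (x · bit i)
high-first {w = w} i p =
  e ▷≐ (ones-≐ e ∙ ones-bit w i) ∙ sy (ax ·-ε) ▷≐ rfl ∙ cons▷ i ∙ ax ε▷ ∙ ▷cons i i ∙
  cong1 zeroˢ (sy (e ▷≐ rfl ∙ ▷cons i true))
  where e = p ·≐ rfl ∙ ε· _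

high-next : ∀ i k j → Γ ⊢ High w x → Γ ⊢ x ≐ bit k · y → Γ ⊢ y ▷ w ≐ bit j · z → Γ ⊢ High w (x · bit i)
high-next {Γ} {w} {x} {y} {z} i k j h p q =
  rfl ▷≐ (ones-snoc w x i ∙ ⊞≐ e₁ e₂) ∙
  ⊞-high i (take~ x _ (refute (absurd (sy (wk e₀) ∙ hyp) (cons≠ε false _))))
           (~cancelʳ {y = 𝟎 · zr z} (~refl (sy e₁) ∙ ones~ w x ∙ unit~ i ∙ ~refl e₂) rfl) ∙
  cong1 zeroˢ (sy (snoc▷ x i _ ∙ rfl ▷≐ e ∙ ▷cons i j))
  where
  e : Γ ⊢ x ▷ width w ≐ bit j · z
  e = p ▷≐ rfl ∙ cons▷ k ∙ rfl ▷≐ ▷cons k true ∙ q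

  e₀ : Γ ⊢ x ▷ ones w x ≐ 𝟎 · zr z
  e₀ = h ∙ cong1 zeroˢ e ∙ zr-cons j _

  e₁ : Γ ⊢ ones w x ≐ take x (ones w x) · (𝟎 · zr z)
  e₁ = take-drop x _ ∙ rfl ·≐ e₀

  e₂ : Γ ⊢ unit w i ≐ (bit i · zr (take y w)) · (𝟎 · zr z)
  e₂ = rfl ·≐ (cong1 zeroˢ (take-drop y w ∙ rfl ·≐ q) ∙ zr-· _ _ ∙ rfl ·≐ zr-cons j _) ∙ sy (·-assoc _ _ _)

high-end : ∀ i k → Γ ⊢ x ≐ bit k · y → Γ ⊢ y ▷ w ≐ ε → Γ ⊢ High w (x · bit i)
high-end {Γ} {x} {w = w} i k p q =
  snoc▷ x i _ ∙ rfl ▷≐ ~ε (▷~▷ rfl (ones~ w _) ∙ ~refl e) ∙ ax bit▷ε ∙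
  sy (cong1 zeroˢ (snoc▷ x i _ ∙ rfl ▷≐ e ∙ ax bit▷ε) ∙ ax zero-ε)
  where
  e : Γ ⊢ x ▷ width w ≐ ε
  e = p ▷≐ rfl ∙ cons▷ k ∙ rfl ▷≐ ▷cons k true ∙ q

ones-high : ∀ w x → Γ ⊢ High w x
ones-high w x = indʳ (High (var 1) (var 0)) (x ◂ w ◂ var)
  (ax ε▷ ∙ ones-ε _ ∙ cong1 zeroˢ (sy (ax ε▷)))
  (λ i → step i hyp₀)
  where
  step : ∀ {Γ w x} i → Γ ⊢ High w x → Γ ⊢ High w (x · bit i)
  step {w = w} {x} i p = consCase x (high-first i hyp) λ k → consCase ((𝟏 ▷ x) ▷ w)
    (high-end i k hyp¹ hyp) (λ j → high-next i k j (wk (wk p)) hyp¹ hyp)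

-- Both summands end in a digit `𝟎`, so the last digit of their sum is the carry out of the digits
-- before it. If the sum is zero, this carry is 0, and `⊞-zero` makes `U` zero although it begins
-- with `𝟏`.
ones-no-wrap : Γ ⊢ x ~ y → Γ ⊢ unit (y · 𝟏) true ⊞ ones (y · 𝟏) x ≐ zr (width (y · 𝟏)) → Γ ⊢ C
ones-no-wrap {Γ} {x} {y} p q = onBit (carry-Bit U V) λ c → finish c (wk s) hyp
  where
  U V : Term ℕ
  U = 𝟏 · zr y
  -- The count has two vanishing digits from position |x| on: one brings `V` to the length of `U`,
  -- the other remains to receive the carry.
  V = take x (ones (y · 𝟏) x) · 𝟎

  e₁ : Γ ⊢ unit (y · 𝟏) true ≐ U · 𝟎
  e₁ = rfl ·≐ zr-snoc true ∙ sy (·-assoc _ _ _)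

  e₂ : Γ ⊢ ones (y · 𝟏) x ≐ V · 𝟎
  e₂ = take-drop x _ ∙
       rfl ·≐ (ones-high _ _ ∙ zr-~ (▷~▷ p (cons~snoc true true _)) ∙
               cong1 zeroˢ (rfl ▷≐ (·-assoc _ _ _) ∙ ▷-cancel _ _) ∙ zr-snoc true ∙ zr-bit true ·≐ rfl) ∙
       sy (·-assoc _ _ _)

  l : Γ ⊢ U ~ V
  l = ~snoc⁻ false false (~refl (sy e₁) ∙ sy (unit~ true) ∙ sy (ones~ _ _) ∙ ~refl e₂)

  s : Γ ⊢ U · 𝟎 ⊞ V · 𝟎 ≐ zr U · 𝟎
  s = ⊞≐ (sy e₁) (sy e₂) ∙ q ∙ zr-~ (unit~ true) ∙ cong1 zeroˢ e₁ ∙ zr-snoc false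

  finish : ∀ {A} c → Γ ∧ A ⊢ U · 𝟎 ⊞ V · 𝟎 ≐ zr U · 𝟎 → Γ ∧ A ⊢ carry ⟨ U , V ⟩ ≐ bit c → Γ ∧ A ⊢ C
  finish c s r = absurd (cons-injˡ false true (sy (zr-cons true _) ∙ ⊞-zero (wk l)
      (snoc-injˡ c false r′) (r ∙ snoc-injʳ c false r′))) (ax 0≠1)
    where r′ = sy (⊞-snoc false false c (wk l) r) ∙ s

-- Deleting the first one of a string

suffix : ∀ x z → Γ ⊢ x ≐ (x ◁ z) · ((x ◁ z) ▷ x)
suffix x z = indʳ (var 1 ≐ (var 1 ◁ var 0) · ((var 1 ◁ var 0) ▷ var 1)) (z ◂ x ◂ var)
  (sy (ax ·-ε) ∙ sy (ax ◁ε) ·≐ sy (▷-self _ ) ∙ rfl ·≐ (sy (ax ◁ε) ▷≐ rfl))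
  (λ i → step i hyp₀)
  where
  move : ∀ {Γ x y y′} → Γ ⊢ y ≐ y′ → Γ ⊢ x ≐ y′ · (y′ ▷ x) → Γ ⊢ x ≐ y · (y ▷ x)
  move p q = q ∙ sy p ·≐ (sy p ▷≐ rfl)

  step : ∀ {Γ x z} i → Γ ⊢ x ≐ (x ◁ z) · ((x ◁ z) ▷ x) →
         Γ ⊢ x ≐ (x ◁ (z · bit i)) · ((x ◁ (z · bit i)) ▷ x)
  step {x = x} {z} i p = snocCase (x ◁ z)
    (move (ax ◁·bit ∙ hyp ◁≐ rfl ∙ ax ε◁bit) (sy (ε· _) ∙ rfl ·≐ sy (ax ε▷)))
    (λ k → move (ax ◁·bit ∙ hyp ◁≐ rfl ∙ ◁snoc i k)
      (re k ∙ rfl ·≐ (sy (▷-cancel _ _) ∙ rfl ▷≐ sy (re k))))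
    where
    re : ∀ k → _ ∧ x ◁ z ≐ (x ◁ z ◁ 𝟏) · bit k ⊢ x ≐ (x ◁ z ◁ 𝟏) · (bit k · ((x ◁ z) ▷ x))
    re k = wk p ∙ hyp ·≐ rfl ∙ ·-assoc _ _ _

suffix≠ε : ∀ i → Γ ⊢ x ≠ ε → Γ ⊢ (x ◁ (bit i · z)) ▷ x ≠ ε
suffix≠ε {x = x} {z = z} i p = snocCase x (absurd hyp (wk p)) λ k →
  refute (absurd (sy (wk (drop k)) ∙ hyp) (snoc≠ε _ k))
  where
  drop : ∀ k → _ ∧ x ≐ (x ◁ 𝟏) · bit k ⊢
         (x ◁ (bit i · z)) ▷ x ≐ ((x ◁ 𝟏 ◁ z) ▷ (x ◁ 𝟏)) · bit k
  drop k = (◁-· x (bit i) z ∙ bit◁-any i true x ◁≐ rfl) ▷≐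
      (hyp ∙ suffix (x ◁ 𝟏) z ·≐ rfl ∙ ·-assoc _ _ _) ∙ ▷-cancel _ _

◁-comm : ∀ z x y → Γ ⊢ (z ◁ x) ◁ y ≐ (z ◁ y) ◁ x
◁-comm z x y = indʳ ((var 1 ◁ var 2) ◁ var 0 ≐ (var 1 ◁ var 0) ◁ var 2) (y ◂ z ◂ x ◂ var)
  (ax ◁ε ∙ sy (ax ◁ε) ◁≐ rfl)
  (λ i → ax ◁·bit ∙ hyp₀ ◁≐ rfl ∙ ◁-bit-comm _ _ i ∙ sy (ax ◁·bit) ◁≐ rfl)

and₂ᵇ : Fun 3
and₂ᵇ = ƛ 3 λ (z , x , y) → andB ⟨ bl ⟨ rc ⟨ x , z ⟩ ⟩ , bl ⟨ rc ⟨ y , z ⟩ ⟩ ⟩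

conjunction : Term ℕ → Term ℕ → Term ℕ → Term ℕ
conjunction z x y = ℓCRN and₂ᵇ ⟨ z , x , y ⟩

and₂-≐ : Γ ⊢ x ~ y → Γ ⊢ and₂ ⟨ x , y ⟩ ≐ conjunction x x y
and₂-≐ {Γ} {x} {y} p = β _ ∙ cong3 (ℓCRN and₂ᵇ) m
    (β _ ∙ (cong1 zeroˢ (m ◁≐ rfl ∙ ◁-self _) ∙ ax zero-ε) ·≐ rfl ∙ ε· _)
    (β _ ∙ (cong1 zeroˢ (m ◁≐ rfl ∙ ◁-~ rfl (sy p) ∙ ◁-self _) ∙ ax zero-ε) ·≐ rfl ∙ ε· _)
  where
  m : Γ ⊢ max ⟨ x , y ⟩ ≐ x
  m = β _ ∙ β _ ∙ cong4 cond (▷-~ p rfl ∙ ▷-self _) rfl rfl rfl ∙ ax cond-ε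

-- `rc` measures positions from the right end, so equally long strings appended to the argument and
-- to the position marker compensate each other.
rc-append : ∀ i → Γ ⊢ x ≠ ε → Γ ⊢ t ~ u →
            Γ ⊢ bl ⟨ rc ⟨ x · t , bit i · (z · u) ⟩ ⟩ ≐ bl ⟨ rc ⟨ x , bit i · z ⟩ ⟩
rc-append {Γ} {x} {t} {u} {z} i p q = consCase s
  (absurd hyp (wk (suffix≠ε i p)))
  (λ j → cong1 bl (wk e ∙ hyp ·≐ rfl ∙ ·-assoc _ _ _) ∙ bl-cons j _ ∙
         sy (cong1 bl (wk (β _) ∙ hyp) ∙ bl-cons j _))
  where
  s = (x ◁ (bit i · z)) ▷ x

  e : Γ ⊢ rc ⟨ x · t , bit i · (z · u) ⟩ ≐ s · t
  e = β _ ∙ (rfl ◁≐ sy (·-assoc _ _ _) ∙ ◁-· _ _ _ ∙ ◁-comm _ _ _ ∙ ~◁ (sy q) ◁≐ rfl) ▷≐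
      (suffix x (bit i · z) ·≐ rfl ∙ ·-assoc _ _ _) ∙ ▷-cancel _ _

-- `ℓCRN` builds its result from the right: the positions in the appended part yield `v`, and by
-- `rc-append` the positions further left read the same bits as before.
conjunction-append : ∀ z → Γ ⊢ x ≠ ε → Γ ⊢ y ≠ ε → Γ ⊢ t ~ u → Γ ⊢ conjunction t (x · t) (y · u) ≐ v →
                     Γ ⊢ conjunction (z · t) (x · t) (y · u) ≐ conjunction z x y · v
conjunction-append {x = x} {y = y} {t = t} {u = u} {v = v} z p q r s =
  indˡ (H (var 1) (var 2) (var 3) (var 4) (var 5) ⇒ G (var 0) (var 1) (var 2) (var 3) (var 4) (var 5))
    (z ◂ x ◂ y ◂ t ◂ u ◂ v ◂ var)
    (intro (cong3 (ℓCRN and₂ᵇ) (ε· _) rfl rfl ∙ snd (snd hyp) ∙ sy (ε· _) ∙ sy (ax (ℓCRN-ε and₂ᵇ)) ·≐ rfl))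
    (λ i → intro (step i (fst (fst hyp)) (snd (fst hyp)) (fst (snd hyp)) (wk hyp₀ $ hyp)))
  $ pair (pair p q) (pair r s)
  where
  H : (x y t u v : Term ℕ) → Formula
  H x y t u v = (x ≠ ε ∧ y ≠ ε) ∧ (t ~ u ∧ conjunction t (x · t) (y · u) ≐ v)

  G : (z x y t u v : Term ℕ) → Formula
  G z x y t u v = conjunction (z · t) (x · t) (y · u) ≐ conjunction z x y · v

  step : ∀ {Γ z x y t u v} i → Γ ⊢ x ≠ ε → Γ ⊢ y ≠ ε → Γ ⊢ t ~ u → Γ ⊢ G z x y t u v →
         Γ ⊢ G (bit i · z) x y t u v
  step i p q r s =
    cong3 (ℓCRN and₂ᵇ) (·-assoc _ _ _) rfl rfl ∙ ax (ℓCRN-bit and₂ᵇ) ∙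
    fb-≐ (β _ ∙ cong2 andB (rc-append i p rfl) (rc-append i q (sy r)) ∙ sy (β _)) ·≐ s ∙
    sy (·-assoc _ _ _) ∙ sy (ax (ℓCRN-bit and₂ᵇ)) ·≐ rfl

conjunction-last : ∀ i j → Γ ⊢ conjunction (bit i) (x · bit i) (y · bit j) ≐ bit (i Bool.∧ j)
conjunction-last {Γ} i j =
  cong3 (ℓCRN and₂ᵇ) (sy (ax ·-ε)) rfl rfl ∙ ax (ℓCRN-bit and₂ᵇ) ∙
  (fb-≐ (β _ ∙ cong2 andB (end i i) (end j i) ∙ andB-bit i j) ∙ fb-bit _) ·≐ ax (ℓCRN-ε and₂ᵇ) ∙ ax ·-ε
  where
  end : ∀ {x} i j → Γ ⊢ bl ⟨ rc ⟨ x · bit i , bit j · ε ⟩ ⟩ ≐ bit i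
  end i j = cong1 bl (β _ ∙ (rfl ◁≐ ax ·-ε ∙ ◁snoc j i) ▷≐ rfl ∙ ▷-cancel _ _ ∙ sy (ax ·-ε)) ∙ bl-cons i ε

and₂-snoc : ∀ i j → Γ ⊢ x ~ y → Γ ⊢ and₂ ⟨ x · bit i , y · bit j ⟩ ≐ and₂ ⟨ x , y ⟩ · bit (i Bool.∧ j)
and₂-snoc {x = x} {y = y} i j p = and₂-≐ (~snoc i j p) ∙ split (x ≐ ε)
  (cong3 (ℓCRN and₂ᵇ) (hyp ·≐ rfl ∙ ε· _) rfl rfl ∙ conjunction-last i j ∙ sy (ε· _) ∙
   sy (cong3 (ℓCRN and₂ᵇ) hyp rfl rfl ∙ ax (ℓCRN-ε and₂ᵇ)) ·≐ rfl)
  (conjunction-append x hyp (refute (absurd (~ε (wk (wk p) ∙ ~refl hyp)) hyp¹))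
    (one-bit1 i ∙ sy (one-bit1 j)) (conjunction-last i j))
  ∙ sy (and₂-≐ p) ·≐ rfl

not-cons : ∀ i → Γ ⊢ not ⟨ bit i · x ⟩ ≐ bit (Bool.not i) · not ⟨ x ⟩
not-cons i = ax (ℓCRN-bit _) ∙ (fb-≐ (β _ ∙ cong1 notB (bl-cons i _) ∙ notB-bit i) ∙ fb-bit _) ·≐ rfl

not-ε : Γ ⊢ not ⟨ ε ⟩ ≐ ε
not-ε = ax (ℓCRN-ε _)

not-snoc : ∀ x i → Γ ⊢ not ⟨ x · bit i ⟩ ≐ not ⟨ x ⟩ · bit (Bool.not i)
not-snoc x i = indˡ (not ⟨ var 1 ⟩ ≐ var 2 ⇒ not ⟨ var 0 · var 1 ⟩ ≐ not ⟨ var 0 ⟩ · var 2)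
    (x ◂ bit i ◂ bit (Bool.not i) ◂ var)
    (intro (cong1 not (ε· _) ∙ hyp ∙ sy (ε· _) ∙ sy not-ε ·≐ rfl))
    (λ j → intro (cong1 not (·-assoc _ _ _) ∙ not-cons j ∙ rfl ·≐ (wk hyp₀ $ hyp) ∙ sy (·-assoc _ _ _) ∙
                  sy (not-cons j) ·≐ rfl))
  $ (cong1 not (sy (ax ·-ε)) ∙ not-cons i ∙ rfl ·≐ not-ε ∙ ax ·-ε)

not~ : ∀ x → Γ ⊢ not ⟨ x ⟩ ~ x
not~ x = indʳ (not ⟨ var 0 ⟩ ~ var 0) (x ◂ var) (~refl not-ε)
  (λ i → ~refl (not-snoc _ i) ∙ ~snoc _ i hyp₀)

first₁-snoc : ∀ i o → Γ ⊢ nz x ≐ bit o →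
              Γ ⊢ first₁ ⟨ x · bit i ⟩ ≐ first₁ ⟨ x ⟩ · bit (if o then false else i)
first₁-snoc i o p = ax (rCRN-bit _) ∙ rfl ·≐
  (lb-≐ (β _ ∙ cong3 cB (cong1 OR (dr-snoc i)) rfl (br-snoc _ i) ∙ cB-OR false i ∙
         cong3 cB p rfl rfl ∙ cB-bit o false i) ∙ lb-bit _)

first₁~ : ∀ x → Γ ⊢ first₁ ⟨ x ⟩ ~ x
first₁~ x = indʳ (first₁ ⟨ var 0 ⟩ ~ var 0) (x ◂ var) (~refl (ax (rCRN-ε _)))
  (λ i → ~refl (ax (rCRN-bit _)) ∙ ~lb i _ hyp₀)

-- A one is kept exactly when `o` reports an earlier one, so a one in the result witnesses two ones
-- in the string.
delfirst₁-snoc : ∀ i o → Γ ⊢ nz x ≐ bit o →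
                 Γ ⊢ delfirst₁ ⟨ x · bit i ⟩ ≐ delfirst₁ ⟨ x ⟩ · bit (i Bool.∧ o)
delfirst₁-snoc i o p =
  β _ ∙ cong2 and₂ rfl (cong1 not (first₁-snoc i o p) ∙ not-snoc _ _) ∙
  and₂-snoc i _ (sy (not~ _ ∙ first₁~ _)) ∙ sy (β _) ·≐ ≡⇒≐ (cong bit (e i o))
  where
  e : ∀ i o → i Bool.∧ Bool.not (if o then false else i) ≡ i Bool.∧ o
  e false false = refl
  e false true  = refl
  e true  false = refl
  e true  true  = refl

-- Counting bit by bit

ones-append : ∀ i → Γ ⊢ x ≐ y · z → Γ ⊢ z ≐ bit i → Γ ⊢ ones w x ≐ ones w y ⊞ unit w i
ones-append i p q = ones-≐ (p ∙ rfl ·≐ q) ∙ ones-snoc _ _ i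

unit-⊞ : ∀ w i j → (i Bool.∧ j) ≡ false → Γ ⊢ unit w i ⊞ unit w j ≐ unit w (i Bool.∨ j)
unit-⊞ w i false _ =
  ⊞≐ rfl (sy (zr-cons true w)) ∙ ⊞-zr (sy (unit~ i)) ∙ ≡⇒≐ (cong (unit w) (∨-false i))
  where
  ∨-false : ∀ i → i ≡ i Bool.∨ false
  ∨-false false = refl
  ∨-false true  = refl
unit-⊞ w false true _ = ⊞≐ (sy (zr-cons true w)) rfl ∙ zr-⊞ (sy (unit~ true))

⊞-interchange : ∀ w x y i j → Γ ⊢ (ones w x ⊞ unit w i) ⊞ (ones w y ⊞ unit w j) ≐
                              (ones w x ⊞ ones w y) ⊞ (unit w i ⊞ unit w j)
⊞-interchange w x y i j =
  ⊞-assoc (ones~ w x ∙ unit~ i) (ones~ w x ∙ sy (⊞~ _ _ ∙ ones~ w y)) ∙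
  ⊞≐ rfl (sy (⊞-assoc (sy (ones~ w y ∙ unit~ i)) (sy (unit~ i) ∙ unit~ j)) ∙
          ⊞≐ (⊞-comm (sy (ones~ w y ∙ unit~ i))) rfl ∙
          ⊞-assoc (ones~ w y ∙ unit~ i) (ones~ w y ∙ unit~ j)) ∙
  sy (⊞-assoc (ones~ w x ∙ sy (ones~ w y)) (ones~ w x ∙ sy (⊞~ _ _ ∙ sy (unit~ i))))

ones-zr : ∀ w x → Γ ⊢ ones w (zr x) ≐ zr (width w)
ones-zr w x = indʳ (ones (var 1) (zr (var 0)) ≐ zr (width (var 1))) (x ◂ w ◂ var)
  (ones-≐ (ax zero-ε) ∙ ones-ε _)
  (λ i → ones-append false (zr-snoc i) rfl ∙
         ⊞≐ hyp₀ (sy (zr-cons true _)) ∙ ⊞-zr (one-zr _))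

-- covered marks the columns with a one in some row of l; fresh marks the ones of row l in
-- columns with no one in a row before l; idle marks the rows without fresh ones.

covered fresh : Fun 4
covered = rCRN (ƛ 4 λ (k , l , a , N) → OR ⟨ loc ⟨ a , N , k , l ⟩ ⟩)
fresh   = rCRN (ƛ 4 λ (k , l , a , N) →
  cB ⟨ OR ⟨ loc ⟨ a , N , k , l ◁ 𝟏 ⟩ ⟩ , 𝟎 , entry ⟨ a , N , k , l ⟩ ▷ (𝟎 · entry ⟨ a , N , k , l ⟩) ⟩)

idle : Fun 3
idle = rCRN (ƛ 3 λ (l , a , N) → notB ⟨ OR ⟨ fresh ⟨ N · 𝟏 , l , a , N ⟩ ⟩ ⟩)

variable
  a n l : Term ℕ

-- The bit that `rCRN` appends for an entry. `loc` and `wor` append the same one, and this is the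
-- link between columns and rows on which the counting relies.
cell : (a n x l : Term ℕ) → Term ℕ
cell a n x l = lb (entry ⟨ a , n , x , l ⟩)

loc-ε : Γ ⊢ loc ⟨ a , n , x , ε ⟩ ≐ ε
loc-ε = β _ ∙ ax (rCRN-ε _)

loc-snoc : ∀ i → Γ ⊢ l ≐ y · bit i → Γ ⊢ loc ⟨ a , n , x , l ⟩ ≐ loc ⟨ a , n , x , y ⟩ · cell a n x l
loc-snoc i p = cong4 loc rfl rfl rfl p ∙ β _ ∙ ax (rCRN-bit _) ∙
  sy (β _) ·≐ lb-≐ (β _ ∙ cong4 entry rfl rfl rfl (sy p))

wor-snoc : ∀ i → Γ ⊢ wor ⟨ a , n , x · bit i , l ⟩ ≐ wor ⟨ a , n , x , l ⟩ · cell a n (x · bit i) l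
wor-snoc i = β _ ∙ ax (rCRN-bit _) ∙ sy (β _) ·≐ lb-≐ (β _)

covered-ε : Γ ⊢ covered ⟨ ε , l , a , n ⟩ ≐ ε
covered-ε = ax (rCRN-ε _)

covered-snoc : ∀ i → Γ ⊢ covered ⟨ x · bit i , l , a , n ⟩ ≐
                         covered ⟨ x , l , a , n ⟩ · nz (loc ⟨ a , n , x · bit i , l ⟩)
covered-snoc i = ax (rCRN-bit _) ∙ rfl ·≐ (lb-≐ (β _) ∙ lb-OR _)

fresh-ε : Γ ⊢ fresh ⟨ ε , l , a , n ⟩ ≐ ε
fresh-ε = ax (rCRN-ε _)

fresh-snoc : ∀ i o b → Γ ⊢ nz (loc ⟨ a , n , x · bit i , l ◁ 𝟏 ⟩) ≐ bit o → Γ ⊢ cell a n (x · bit i) l ≐ bit b →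
  Γ ⊢ fresh ⟨ x · bit i , l , a , n ⟩ ≐ fresh ⟨ x , l , a , n ⟩ · bit (if o then false else b)
fresh-snoc i o b p q = ax (rCRN-bit _) ∙ rfl ·≐
  (lb-≐ (β _ ∙ cong3 cB rfl rfl q ∙ cB-OR false b ∙ cong3 cB p rfl rfl ∙ cB-bit o false b) ∙ lb-bit _)

new : Bool → Bool → Bool
new o b = if o then false else b

∨-new : ∀ o b → o Bool.∨ new o b ≡ o Bool.∨ b
∨-new false b = refl
∨-new true  b = refl

∧-new : ∀ o b → o Bool.∧ new o b ≡ false
∧-new false b = refl
∧-new true  b = refl

-- Covered columns and idle rows, counted row by row

Grows : (w a n l x : Term ℕ) → Formula
Grows w a n l x = ones w (covered ⟨ x , l , a , n ⟩) ≐
                  ones w (covered ⟨ x , l ◁ 𝟏 , a , n ⟩) ⊞ ones w (fresh ⟨ x , l , a , n ⟩)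

grows-ε : Γ ⊢ Grows w a n l ε
grows-ε {w = w} =
  ones-≐ covered-ε ∙ sy (ones-⊞-ε w ε) ∙ ⊞≐ (ones-≐ (sy covered-ε)) (ones-≐ (sy fresh-ε))

-- In each column the bit `o ∨ b` is the sum of `o` and `new o b`, which are never both 1, so the
-- units of the column add up without a carry.
grows-snoc : ∀ i j o b → Γ ⊢ l ≐ (l ◁ 𝟏) · bit j → Γ ⊢ Grows w a n l x →
  Γ ⊢ nz (loc ⟨ a , n , x · bit i , l ◁ 𝟏 ⟩) ≐ bit o → Γ ⊢ cell a n (x · bit i) l ≐ bit b →
  Γ ⊢ Grows w a n l (x · bit i)
grows-snoc {w = w} i j o b e p q r =
  ones-append (o Bool.∨ b) (covered-snoc i) (nz-≐ (loc-snoc j e ∙ rfl ·≐ r) ∙ nz-snocᵇ o b q) ∙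
  ⊞≐ p (≡⇒≐ (cong (unit w) (sym (∨-new o b))) ∙ sy (unit-⊞ w o (new o b) (∧-new o b))) ∙
  sy (⊞-interchange w _ _ o (new o b)) ∙
  ⊞≐ (sy (ones-append o (covered-snoc i) q)) (sy (ones-append (new o b) (fresh-snoc i o b q r) rfl))

grows : ∀ w a n l x → Γ ⊢ l ≠ ε → Γ ⊢ Grows w a n l x
grows w a n l x p =
  indʳ (var 4 ≠ ε ⇒ Grows (var 1) (var 2) (var 3) (var 4) (var 0)) (x ◂ w ◂ a ◂ n ◂ l ◂ var)
    (intro grows-ε)
    (λ i → intro (snocCase (var 4) (absurd hyp hyp¹) λ j →
      onBit (nz-Bit (loc ⟨ var 2 , var 3 , var 0 · bit i , var 4 ◁ 𝟏 ⟩)) λ o →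
      onBit (lb-Bit (entry ⟨ var 2 , var 3 , var 0 · bit i , var 4 ⟩)) λ b →
      grows-snoc i j o b (wk hyp¹) (wk (wk (wk (wk hyp₀ $ hyp)))) hyp¹ hyp))
  $ p

-- The second part carries the induction along the columns: after a fresh one the row contains a
-- one, and then `AtMostOne` forbids any further one in it.
Once : (w a n l x : Term ℕ) → Formula
Once w a n l x = ones w (fresh ⟨ x , l , a , n ⟩) ≐ nz (fresh ⟨ x , l , a , n ⟩) · zr w ∧
                 (nz (fresh ⟨ x , l , a , n ⟩) ≐ 𝟏 ⇒ nz (wor ⟨ a , n , x , l ⟩) ≐ 𝟏)

AtMostOne : (a n l x : Term ℕ) → Formula
AtMostOne a n l x = nz (delfirst₁ ⟨ wor ⟨ a , n , x , l ⟩ ⟩) ≐ 𝟎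

once-ε : Γ ⊢ Once w a n l ε
once-ε {w = w} = pair
  (ones-≐ fresh-ε ∙ ones-ε w ∙ zr-cons true w ∙ sy (nz-≐ fresh-ε ∙ nz-ε) ·≐ rfl)
  (intro (absurd (sy (nz-≐ fresh-ε ∙ nz-ε) ∙ hyp) (ax 0≠1)))

once-snocᵇ : ∀ i o b c g → (c Bool.∧ new o b) ≡ false → (c Bool.∨ new o b ≡ true → g Bool.∨ b ≡ true) →
  Γ ⊢ nz (loc ⟨ a , n , x · bit i , l ◁ 𝟏 ⟩) ≐ bit o → Γ ⊢ cell a n (x · bit i) l ≐ bit b →
  Γ ⊢ nz (fresh ⟨ x , l , a , n ⟩) ≐ bit c → Γ ⊢ nz (wor ⟨ a , n , x , l ⟩) ≐ bit g →
  Γ ⊢ Once w a n l x → Γ ⊢ Once w a n l (x · bit i)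
once-snocᵇ {Γ} {a} {n} {x} {l} {w} i o b c g e₁ e₂ p q r s h = pair
  (ones-append (new o b) f rfl ∙ ⊞≐ (fst h ∙ r ·≐ rfl) rfl ∙ unit-⊞ w c (new o b) e₁ ∙ sy f′ ·≐ rfl)
  (intro (bit-distinct {i = c Bool.∨ new o b} {j = true} (sy (wk f′) ∙ hyp) λ t →
     wk (nz-≐ (wor-snoc i ∙ rfl ·≐ q) ∙ nz-snocᵇ g b s ∙ ≡⇒≐ (cong bit (e₂ t)))))
  where
  f : Γ ⊢ fresh ⟨ x · bit i , l , a , n ⟩ ≐ fresh ⟨ x , l , a , n ⟩ · bit (new o b)
  f = fresh-snoc i o b p q

  f′ : Γ ⊢ nz (fresh ⟨ x · bit i , l , a , n ⟩) ≐ bit (c Bool.∨ new o b)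
  f′ = nz-≐ f ∙ nz-snocᵇ c (new o b) r

once-snoc : ∀ i o b c g h →
  Γ ⊢ nz (loc ⟨ a , n , x · bit i , l ◁ 𝟏 ⟩) ≐ bit o → Γ ⊢ cell a n (x · bit i) l ≐ bit b →
  Γ ⊢ nz (fresh ⟨ x , l , a , n ⟩) ≐ bit c → Γ ⊢ nz (wor ⟨ a , n , x , l ⟩) ≐ bit g →
  Γ ⊢ nz (delfirst₁ ⟨ wor ⟨ a , n , x , l ⟩ ⟩) ≐ bit h → Γ ⊢ AtMostOne a n l (x · bit i) →
  Γ ⊢ AtMostOne a n l x ⇒ Once w a n l x → Γ ⊢ Once w a n l (x · bit i)
once-snoc {Γ} {a} {n} {x} {l} {w} i o b c g h p q r s t d k =
  -- By `delfirst₁-snoc` the extended row has a second one if `h` holds or if `b` meets an earlier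
  -- one `g`; `AtMostOne` rules out both.
  bit-distinct {i = h Bool.∨ (b Bool.∧ g)} {j = false}
    (sy (nz-≐ (cong1 delfirst₁ (wor-snoc i ∙ rfl ·≐ q) ∙ delfirst₁-snoc b g s) ∙ nz-snocᵇ h (b Bool.∧ g) t) ∙ d)
    λ e → implies c g (λ { refl → sy s ∙ (snd (once e) $ r) }) λ c⇒g →
    once-snocᵇ i o b c g (disjoint o b c g (∨-falseʳ h e) c⇒g) (covers o b c g c⇒g) p q r s (once e)
  where
  ∨-falseˡ : ∀ h {x} → h Bool.∨ x ≡ false → h ≡ false
  ∨-falseˡ false _ = refl

  ∨-falseʳ : ∀ h {x} → h Bool.∨ x ≡ false → x ≡ false
  ∨-falseʳ false e = e

  once : h Bool.∨ (b Bool.∧ g) ≡ false → Γ ⊢ Once w a n l x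
  once e = k $ (t ∙ ≡⇒≐ (cong bit (∨-falseˡ h e)))

  implies : ∀ c g → (c ≡ true → Γ ⊢ bit g ≐ 𝟏) → ((c ≡ true → g ≡ true) → Γ ⊢ C) → Γ ⊢ C
  implies false g f k = k λ ()
  implies true  g f k = bit-distinct {i = g} {j = true} (f refl) λ e → k λ _ → e

  disjoint : ∀ o b c g → b Bool.∧ g ≡ false → (c ≡ true → g ≡ true) → c Bool.∧ new o b ≡ false
  disjoint o     b     false g _ f = refl
  disjoint true  b     true  g _ f = refl
  disjoint false false true  g _ f = refl
  disjoint false true  true  g e f = trans (sym (f refl)) e

  covers : ∀ o b c g → (c ≡ true → g ≡ true) → c Bool.∨ new o b ≡ true → g Bool.∨ b ≡ true
  covers o     b    true  g f _ = cong (Bool._∨ b) (f refl)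
  covers false true false false f _ = refl
  covers false true false true  f _ = refl

once : ∀ w a n l x → Γ ⊢ AtMostOne a n l x → Γ ⊢ Once w a n l x
once w a n l x p =
  indʳ (AtMostOne (var 2) (var 3) (var 4) (var 0) ⇒ Once (var 1) (var 2) (var 3) (var 4) (var 0))
    (x ◂ w ◂ a ◂ n ◂ l ◂ var)
    (intro once-ε)
    (λ i → intro (step i hyp (wk hyp₀)))
  $ p
  where
  step : ∀ {Γ w a n l x} i → Γ ⊢ AtMostOne a n l (x · bit i) → Γ ⊢ AtMostOne a n l x ⇒ Once w a n l x →
         Γ ⊢ Once w a n l (x · bit i)
  step {a = a} {n} {l} {x} i p q =
    onBit (nz-Bit (loc ⟨ a , n , x · bit i , l ◁ 𝟏 ⟩)) λ o →
    onBit (lb-Bit (entry ⟨ a , n , x · bit i , l ⟩)) λ b →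
    onBit (nz-Bit (fresh ⟨ x , l , a , n ⟩)) λ c →
    onBit (nz-Bit (wor ⟨ a , n , x , l ⟩)) λ g →
    onBit (nz-Bit (delfirst₁ ⟨ wor ⟨ a , n , x , l ⟩ ⟩)) λ h →
    once-snoc i o b c g h (wk (wk (wk hyp¹))) (wk (wk hyp¹)) (wk hyp¹) hyp¹ hyp
      (wk (wk (wk (wk (wk p))))) (wk (wk (wk (wk (wk q)))))

idle-snoc : ∀ i c → Γ ⊢ nz (fresh ⟨ n · 𝟏 , l · bit i , a , n ⟩) ≐ bit c →
            Γ ⊢ idle ⟨ l · bit i , a , n ⟩ ≐ idle ⟨ l , a , n ⟩ · bit (Bool.not c)
idle-snoc i c p = ax (rCRN-bit _) ∙ rfl ·≐
  (lb-≐ (β _ ∙ notB-OR _ ∙ cong1 notB p ∙ notB-bit c) ∙ lb-bit _)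

idle~ : ∀ l → Γ ⊢ idle ⟨ l , a , n ⟩ ~ l
idle~ {a = a} {n = n} l = indʳ (idle ⟨ var 0 , var 1 , var 2 ⟩ ~ var 0) (l ◂ a ◂ n ◂ var)
  (~refl (ax (rCRN-ε _))) (λ i → ~refl (ax (rCRN-bit _)) ∙ ~lb i _ hyp₀)

jni-ε : Γ ⊢ jni ⟨ a , n , ε ⟩ ≐ ε
jni-ε = β _ ∙ ax (rCRN-ε _)

jni-snoc : ∀ i h → Γ ⊢ nz (delfirst₁ ⟨ wor ⟨ a , n , n · 𝟏 , l · bit i ⟩ ⟩) ≐ bit h →
           Γ ⊢ jni ⟨ a , n , l · bit i ⟩ ≐ jni ⟨ a , n , l ⟩ · bit (Bool.not h)
jni-snoc i h p = β _ ∙ ax (rCRN-bit _) ∙ sy (β _) ·≐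
  (lb-≐ (β _ ∙ cong1 notB (cong1 OR (cong1 delfirst₁ (β _))) ∙ notB-OR _ ∙ cong1 notB p ∙ notB-bit h) ∙ lb-bit _)

jni~ : ∀ l → Γ ⊢ jni ⟨ a , n , l ⟩ ~ l
jni~ {a = a} {n = n} l = indʳ (jni ⟨ var 1 , var 2 , var 0 ⟩ ~ var 0) (l ◂ a ◂ n ◂ var)
  (~refl jni-ε)
  (λ i → onBit (nz-Bit (delfirst₁ ⟨ wor ⟨ var 1 , var 2 , var 2 · 𝟏 , var 0 · bit i ⟩ ⟩)) λ h →
    ~refl (jni-snoc i h hyp) ∙ ~snoc _ i (wk hyp₀))

-- The number |l| is written as the count of `one l`, so that it grows by one unit under the same
-- lemma as the other counts.
Counted : (w a n l : Term ℕ) → Formula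
Counted w a n l = ones w (covered ⟨ n · 𝟏 , l , a , n ⟩) ⊞ ones w (idle ⟨ l , a , n ⟩) ≐ ones w (one l)

covered-zr : ∀ a n x → Γ ⊢ covered ⟨ x , ε , a , n ⟩ ≐ zr x
covered-zr a n x = indʳ (covered ⟨ var 0 , ε , var 1 , var 2 ⟩ ≐ zr (var 0)) (x ◂ a ◂ n ◂ var)
  (covered-ε ∙ sy (ax zero-ε))
  (λ i → covered-snoc i ∙ hyp₀ ·≐ (nz-≐ loc-ε ∙ nz-ε) ∙ sy (zr-snoc i))

counted-ε : Γ ⊢ Counted w a n ε
counted-ε {w = w} {a = a} {n = n} =
  ⊞≐ (ones-≐ (covered-zr a n _) ∙ ones-zr w _) (ones-≐ (ax (rCRN-ε _)) ∙ ones-ε w) ∙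
  ⊞-zr (one-zr _) ∙ sy (ones-≐ (ax one-ε) ∙ ones-ε w)

-- The new row contributes `c` to the covered columns and the negation of `c` to the idle rows,
-- exactly one unit in total.
counted-snoc : ∀ i c → Γ ⊢ Counted w a n l → Γ ⊢ AtMostOne a n (l · bit i) (n · 𝟏) →
  Γ ⊢ nz (fresh ⟨ n · 𝟏 , l · bit i , a , n ⟩) ≐ bit c → Γ ⊢ Counted w a n (l · bit i)
counted-snoc {Γ} {w} {a} {n} {l} i c p q r =
  ⊞≐ (grows w a n (l · bit i) (n · 𝟏) (snoc≠ε l i) ∙
      ⊞≐ (ones-≐ (cong4 covered rfl (◁snoc true i) rfl rfl))
         (fst (once w a n (l · bit i) (n · 𝟏) q) ∙ r ·≐ rfl))
     (ones-append (Bool.not c) (idle-snoc i c r) rfl) ∙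
  ⊞-interchange w _ _ c (Bool.not c) ∙
  ⊞≐ p (unit-⊞ w c (Bool.not c) (∧-not c) ∙ ≡⇒≐ (cong (unit w) (∨-not c))) ∙
  sy (ones-append true (one-snoc i) rfl)
  where
  ∧-not : ∀ c → c Bool.∧ Bool.not c ≡ false
  ∧-not false = refl
  ∧-not true  = refl

  ∨-not : ∀ c → c Bool.∨ Bool.not c ≡ true
  ∨-not false = refl
  ∨-not true  = refl

counted : ∀ w a n l → Γ ⊢ jni ⟨ a , n , l ⟩ ≐ one l → Γ ⊢ Counted w a n l
counted w a n l p =
  indʳ (jni ⟨ var 2 , var 3 , var 0 ⟩ ≐ one (var 0) ⇒ Counted (var 1) (var 2) (var 3) (var 0))
    (l ◂ w ◂ a ◂ n ◂ var)
    (intro counted-ε)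
    (λ i → intro (step i hyp (wk hyp₀)))
  $ p
  where
  step : ∀ {Γ w a n l} i → Γ ⊢ jni ⟨ a , n , l · bit i ⟩ ≐ one (l · bit i) →
         Γ ⊢ jni ⟨ a , n , l ⟩ ≐ one l ⇒ Counted w a n l → Γ ⊢ Counted w a n (l · bit i)
  step {a = a} {n} {l} i p q =
    onBit (nz-Bit (delfirst₁ ⟨ wor ⟨ a , n , n · 𝟏 , l · bit i ⟩ ⟩)) λ h →
    onBit (nz-Bit (fresh ⟨ n · 𝟏 , l · bit i , a , n ⟩)) λ c →
    go h c (wk (wk q)) hyp¹ hyp (sy (jni-snoc i h hyp¹) ∙ wk (wk p) ∙ one-snoc i)
    where
    go : ∀ {Δ w} h c → Δ ⊢ jni ⟨ a , n , l ⟩ ≐ one l ⇒ Counted w a n l →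
         Δ ⊢ nz (delfirst₁ ⟨ wor ⟨ a , n , n · 𝟏 , l · bit i ⟩ ⟩) ≐ bit h →
         Δ ⊢ nz (fresh ⟨ n · 𝟏 , l · bit i , a , n ⟩) ≐ bit c →
         Δ ⊢ jni ⟨ a , n , l ⟩ · bit (Bool.not h) ≐ one l · 𝟏 → Δ ⊢ Counted w a n (l · bit i)
    go false c q r s t = counted-snoc i c (q $ snoc-injˡ true true t) r s
    go true  c q r s t = absurd (snoc-injʳ false true t) (ax 0≠1)

pam-≐ : ∀ a n x → Γ ⊢ pam ⟨ a , n , x ⟩ ≐ covered ⟨ x , n , a , n ⟩
pam-≐ a n x = β _ ∙
  indʳ (rCRN pamᵇ ⟨ var 0 , var 1 , var 2 ⟩ ≐ covered ⟨ var 0 , var 2 , var 1 , var 2 ⟩) (x ◂ a ◂ n ◂ var)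
    (ax (rCRN-ε _) ∙ sy (ax (rCRN-ε _)))
    (λ i → ax (rCRN-bit _) ∙ hyp₀ ·≐ lb-≐ (β _ ∙ cong1 OR (β _) ∙ sy (β _)) ∙ sy (ax (rCRN-bit _)))
  where
  pamᵇ : Fun 3
  pamᵇ = ƛ 3 λ (x , a , N) → OR ⟨ col ⟨ a , N , x ⟩ ⟩

covered~ : ∀ x → Γ ⊢ covered ⟨ x , l , a , n ⟩ ~ x
covered~ {l = l} {a = a} {n = n} x =
  indʳ (covered ⟨ var 0 , var 1 , var 2 , var 3 ⟩ ~ var 0) (x ◂ l ◂ a ◂ n ◂ var)
    (~refl (ax (rCRN-ε _))) (λ i → ~refl (ax (rCRN-bit _)) ∙ ~lb i _ hyp₀)

AND-full : Γ ⊢ AND ⟨ x ⟩ ≐ 𝟏 → Γ ⊢ x ~ y → Γ ⊢ x ≐ one y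
AND-full p q = sy (AND≐1 p) ∙ q

-- The contradiction, and the defining formula of `php`

pigeonhole : Γ ⊢ map ⟨ a , n ⟩ ≐ 𝟏 → Γ ⊢ inj ⟨ a , n ⟩ ≐ 𝟏 → Γ ⊢ C
pigeonhole {Γ} {a} {n} p q = ones-no-wrap (idle~ n)
  (sy (⊞-cancel (ones~ W _ ∙ unit~ true ∙ sy (⊞~ _ _)) (sy assoc ∙ sum)) ∙ zr-~ (⊞~ _ _ ∙ sy (unit~ true)))
  where
  W : Term ℕ
  -- With `width` this makes |n| + 2 digits, the format in which `ones-no-wrap` has a digit to spare
  -- for the carry.
  W = n · 𝟏

  columns : Γ ⊢ covered ⟨ n · 𝟏 , n , a , n ⟩ ≐ one n · 𝟏
  columns = AND-full (cong1 AND (sy (pam-≐ a n _)) ∙ sy (β _) ∙ p) (covered~ _) ∙ one-snoc true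

  rows : Γ ⊢ jni ⟨ a , n , n ⟩ ≐ one n
  rows = AND-full (sy (β _) ∙ q) (jni~ n)

  sum : Γ ⊢ ones W (one n) ⊞ unit W true ⊞ ones W (idle ⟨ n , a , n ⟩) ≐ ones W (one n)
  sum = ⊞≐ (sy (ones-append true columns rfl)) rfl ∙ counted W a n n rows

  assoc : Γ ⊢ ones W (one n) ⊞ unit W true ⊞ ones W (idle ⟨ n , a , n ⟩) ≐
              ones W (one n) ⊞ (unit W true ⊞ ones W (idle ⟨ n , a , n ⟩))
  assoc = ⊞-assoc (ones~ W _ ∙ unit~ true) (ones~ W _ ∙ sy (ones~ W _))

imp : ∀ i j → Γ ⊢ x ≐ bit i → Γ ⊢ y ≐ bit j → Γ ⊢ impB ⟨ x , y ⟩ ≐ bit (if i then j else true)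
imp i j p q = β _ ∙ cong3 cB p (cong1 sg q ∙ sg-bit j) rfl ∙ cB-bit i j true

php≐1 : ∀ a n → Γ ⊢ php ⟨ a , n ⟩ ≐ 𝟏
php≐1 a n = β _ ∙ onTri (Tri-≐ (β _) (AND-Tri _))
  -- `Tri` leaves the value `ε` open for `map` and `inj`; there `impB` and `notB`, respectively,
  -- default to `𝟏`.
  (β _ ∙ cong3 cB hyp rfl rfl ∙ cB-ε)
  λ { false → onTri (Tri-≐ (β _) (AND-Tri _))
        (imp false true hyp¹ (cong1 notB hyp ∙ notB-ε))
        (λ j → imp false (Bool.not j) hyp¹ (cong1 notB hyp ∙ notB-bit j))
    ; true → onTri (Tri-≐ (β _) (AND-Tri _))
        (imp true true hyp¹ (cong1 notB hyp ∙ notB-ε))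
        λ { false → imp true true hyp¹ (cong1 notB hyp ∙ notB-bit false)
          ; true  → pigeonhole hyp¹ hyp } }

mainTheorem5 : T₁⊢ php ⟨ var 0 , var 1 ⟩ ≐ 𝟏
mainTheorem5 = close (php≐1 (var 0) (var 1))
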